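{- Let $k\geq 5$ and $h\geq 2$ be integers, and let $\mathcal{P}_{h}$ be the set of all $k$-polycyclic chains with $h$ $k$-polygons, i.e. the set of graphs isomorphic to $P(w)$ for some $w\in\{0,1,\dots,k-4\}^{h-2}$. Then for every $G\in\mathcal{P}_{h}$, $$Kf(G)\geq Kf(P(\underbrace{0,0,\dots,0}_{h-2})),$$ with equality if and only if $G\cong D_{h}$, where $D_h:=P(0,0,\dots,0)$ (the helicene $k$-polycyclic chain; note $P(0,\dots,0)\cong P(k-4,\dots,k-4)$).
   Context: All graphs are simple and connected. Regard each edge of a graph $G$ as a unit resistor; the resistance distance $\Omega_G(u,v)$ is the effective resistance between $u$ and $v$ in the resulting electrical network. The Kirchhoff index is $Kf(G)=\sum_{\{u,v\}\subseteq V(G)}\Omega_G(u,v)$. $k$-polycyclic chains: Let $h\geq 2$. The linear quadrilateral chain $Q_h$ has vertices $t_0,\dots,t_h,s_0,\dots,s_h$ and edges $t_{j-1}t_j$, $s_{j-1}s_j$ ($1\leq j\leq h$) and $t_js_j$ ($0\leq j\leq h$); its $i$-th square $S_i$ ($1\le i\le h$) is the 4-cycle $t_{i-1}t_is_is_{i-1}$, with top edge $t_{i-1}t_i$ and bottom edge $s_{i-1}s_i$. For $w=(w_1,\dots,w_{h-2})$ with each $w_i\in\{0,1,\dots,k-4\}$, the $k$-polycyclic chain $P(w)=P_h(w)$ is obtained from $Q_h$ by: subdividing the top edges of $S_1$ and $S_h$ with $\lceil\frac{k-4}{2}\rceil$ new vertices each and the bottom edges of $S_1$ and $S_h$ with $\lfloor\frac{k-4}{2}\rfloor$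 new vertices each; and, for $1\le i\le h-2$, subdividing the top edge of $S_{i+1}$ with $w_i$ new vertices and the bottom edge of $S_{i+1}$ with $k-4-w_i$ new vertices. Thus each square becomes a $k$-cycle (a $k$-polygon) and consecutive polygons share the edge $t_is_i$. -}

module Defs where

open import Data.Nat as ℕ using (ℕ; zero; suc; _∸_; _≡ᵇ_; _<ᵇ_; ⌊_/2⌋; ⌈_/2⌉)
open import Data.Bool using (Bool; true; false; if_then_else_; _∧_; _∨_)
open import Data.Fin using (Fin; toℕ)
open import Data.Fin using (zero; suc) renaming (_≟_ to _≟F_)
open import Data.List using (List; []; _∷_; _++_; [_]; map)
open import Data.Bool.ListAction using (any)
open import Data.Vec using (Vec; toList; replicate)
open import Data.Product using (Σ; _×_; _,_; proj₁; proj₂)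
open import Data.Rational using (ℚ; 0ℚ; 1ℚ; _+_; _-_)
open import Relation.Binary.PropositionalEquality using (_≡_)
open import Relation.Nullary using (does)
open import Function.Bundles using (_↔_; Inverse)

Graph : ℕ → Set
Graph n = Fin n → Fin n → Bool

_≅_ : ∀ {n m} → Graph n → Graph m → Set
_≅_ {n} {m} A B = Σ (Fin n ↔ Fin m) λ f →
  ∀ u v → A u v ≡ B (Inverse.to f u) (Inverse.to f v)

-- Resistance distance via the electrical network (Kirchhoff + Ohm):
-- inject unit current at u, extract it at v; a potential x satisfies
-- (L x)(w) = δ_{uw} - δ_{vw}, where L is the Laplacian (unit resistors);
-- the effective resistance is x u - x v.

sumFin : ∀ {n} → (Fin n → ℚ) → ℚ
sumFin {zero}  f = 0ℚ
sumFin {suc n} f = f zero + sumFin (λ i → f (suc i))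

δ : ∀ {n} → Fin n → Fin n → ℚ
δ u w = if does (u ≟F w) then 1ℚ else 0ℚ

laplacian : ∀ {n} → Graph n → (Fin n → ℚ) → Fin n → ℚ
laplacian A x w = sumFin λ z → if A w z then x w - x z else 0ℚ

IsResistance : ∀ {n} → Graph n → Fin n → Fin n → ℚ → Set
IsResistance A u v r = Σ (_ → ℚ) λ x →
  (∀ w → laplacian A x w ≡ δ u w - δ v w) × (r ≡ x u - x v)

IsKf : ∀ {n} → Graph n → ℚ → Set
IsKf {n} A r = Σ (Fin n → Fin n → ℚ) λ R →
  (∀ u v → IsResistance A u v (R u v)) ×
  (r ≡ sumFin λ u → sumFin λ v → if toℕ u <ᵇ toℕ v then R u v else 0ℚ)

-- k-polycyclic chain P_h(w).
-- Vertex numbering: t_j = j (0 ≤ j ≤ h), s_j = h+1+j (0 ≤ j ≤ h),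
-- subdivision vertices numbered consecutively from 2h+2 on.
-- Total number of vertices: 2(h+1) + h(k-4) = h(k-2) + 2.

numV : ℕ → ℕ → ℕ
numV k h = h ℕ.* (k ∸ 2) ℕ.+ 2

pathEdges : ℕ → ℕ → ℕ → ℕ → List (ℕ × ℕ)
pathEdges x y c zero    = [ (x , y) ]
pathEdges x y c (suc m) = (x , c) ∷ pathEdges c y (suc c) m

-- numbers of subdivision vertices (top, bottom) of the squares S_1..S_h
subdivs : ∀ {m} → ℕ → Vec ℕ m → List (ℕ × ℕ)
subdivs k w =
  ((⌈ (k ∸ 4) /2⌉ , ⌊ (k ∸ 4) /2⌋) ∷ map (λ a → (a , k ∸ 4 ∸ a)) (toList w))
  ++ [ (⌈ (k ∸ 4) /2⌉ , ⌊ (k ∸ 4) /2⌋) ]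

-- top/bottom edges of squares S_{j+1}, S_{j+2}, ...; c = next free index
squareEdges : ℕ → ℕ → ℕ → List (ℕ × ℕ) → List (ℕ × ℕ)
squareEdges h j c [] = []
squareEdges h j c ((a , b) ∷ rest) =
  pathEdges j (suc j) c a
  ++ pathEdges (h ℕ.+ 1 ℕ.+ j) (h ℕ.+ 1 ℕ.+ suc j) (c ℕ.+ a) b
  ++ squareEdges h (suc j) (c ℕ.+ a ℕ.+ b) rest

rungs : ℕ → List (ℕ × ℕ)
rungs h = go (suc h)
  where
  go : ℕ → List (ℕ × ℕ)
  go zero    = []
  go (suc j) = (j , h ℕ.+ 1 ℕ.+ j) ∷ go j

chainEdges : ∀ {m} → ℕ → ℕ → Vec ℕ m → List (ℕ × ℕ)
chainEdges k h w =
  rungs h ++ squareEdges h 0 (2 ℕ.* h ℕ.+ 2) (subdivs k w)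

edgeGraph : ∀ {n} → List (ℕ × ℕ) → Graph n
edgeGraph es u v = any (λ e →
  ((proj₁ e ≡ᵇ toℕ u) ∧ (proj₂ e ≡ᵇ toℕ v)) ∨
  ((proj₁ e ≡ᵇ toℕ v) ∧ (proj₂ e ≡ᵇ toℕ u))) es

-- P_h(w) for w = (w_1, ..., w_{h-2}), entries intended in {0,...,k-4}
P : (k h : ℕ) → Vec ℕ (h ∸ 2) → Graph (numV k h)
P k h w = edgeGraph (chainEdges k h w)

D : (k h : ℕ) → Graph (numV k h)
D k h = P k h (replicate (h ∸ 2) 0)

{-# OPTIONS --safe #-}
module Submission where

open import Defs
open import Data.Bool using (Bool; true; false; if_then_else_; _∧_; _∨_; T)
open import Data.Bool.ListAction using (any)
open import Data.Bool.Properties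
  using (∨-comm; ∨-assoc; ∨-identityʳ; ∧-comm; T-≡; T-∧; T-∨; ∨-idempotentCommutativeMonoid)
open import Data.Empty using (⊥)
open import Data.Fin using (Fin; zero; suc; toℕ; fromℕ<)
open import Data.Fin.Properties using (toℕ<n; toℕ-injective; toℕ-fromℕ<) renaming (_≟_ to _≟F_)
open import Data.List as List using (List; []; _∷_; _++_; map; length)
open import Data.List.Properties using (map-++; length-++; length-map; ++-assoc)
open import Data.List.Membership.Propositional using (_∈_; _∉_)
open import Data.List.Relation.Unary.All as Allᴸ using ([]; _∷_) renaming (All to Allᴸ)
open import Data.List.Relation.Unary.All.Properties using (++⁺)
open import Data.List.Relation.Unary.Any using (here; there)
open import Data.Maybe using (Maybe; just; nothing)
open import Data.Nat as ℕ
  using (ℕ; zero; suc; _≤_; _<_; _∸_; _≡ᵇ_; _<ᵇ_; ⌊_/2⌋; ⌈_/2⌉; z≤n; s≤s; s<s⁻¹)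
open import Data.Nat.ListAction using (sum)
import Data.Nat.Properties as ℕₚ
open import Data.Nat.Tactic.RingSolver using () renaming (solve-∀ to solveℕ-∀)
open import Data.List.Membership.DecPropositional ℕₚ._≟_ using (_∈?_)
open import Data.Product using (Σ; _×_; _,_; proj₁; proj₂)
open import Data.Rational using (ℚ; 0ℚ; 1ℚ; ½; _+_; _*_; _-_; -_; 1/_; positive; nonNegative; ≢-nonZero)
  renaming (_≤_ to _≤ℚ_; _<_ to _<ℚ_)
open import Data.Rational.Properties
open import Data.Sum as Sum using (_⊎_; inj₁; inj₂)
open import Data.Unit using (⊤; tt)
open import Data.Vec using (Vec; []; _∷_; toList; replicate)
open import Data.Vec.Properties using (length-toList)
open import Data.Vec.Relation.Unary.All using (All; []; _∷_)
open import Function using (_∘_)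
open import Function.Bundles using (_↔_; _⇔_; mk⇔; mk↔ₛ′; Equivalence; Inverse)
open import Function.Construct.Composition using (_↔-∘_)
open import Function.Construct.Identity using (↔-id)
open import Level using (0ℓ)
open import Relation.Binary.PropositionalEquality
  using (_≡_; _≢_; refl; sym; trans; cong; cong₂; subst; subst₂; ≢-sym; module ≡-Reasoning)
open import Relation.Nullary using (yes; no; contradiction)
open import Tactic.RingSolver using (solve-∀)
open import Tactic.RingSolver.Core.AlmostCommutativeRing using (AlmostCommutativeRing; fromCommutativeRing)
import Algebra.Properties.CommutativeMonoid.Sum +-0-commutativeMonoid as Σ-Props
import Algebra.Solver.IdempotentCommutativeMonoid ∨-idempotentCommutativeMonoid as ∨-Solver
open ∨-Solver using (_⊕_; _⊜_)

-- A chain grows from the edge t₀s₀ by attaching pendant vertices to its two ends and closing each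
-- polygon with a unit resistor between the ends t and s, an update of rank one of the resistance
-- matrix R. Put ψ x = R x t - R x s. The numbers |V|, R t s, Σ ψ, Σ ψ², Σ (R x t + R x s) and ΣΣ R
-- evolve autonomously under these operations. With σ the difference of the numbers of subdivision
-- vertices on top and bottom of a polygon, solving the recursion gives 4 Kf = C - Φ(σ), where Φ is
-- a quadratic form in the σ of the inner polygons all of whose coefficients are positive. As |σ|
-- is at most k - 4, Φ is maximal exactly when all σ equal k - 4 or all equal 4 - k, that is for
-- w = (k - 4, …, k - 4) and w = (0, …, 0), and these two chains are isomorphic: interchange the
-- two sides of the chain.

-- The moments evolve autonomously because a pendant vertex replaces `R x t` by `1 + R x t` at every
-- old vertex `x`, while closing merely multiplies `ψ` by `1 / (1 + R t s)`. The two end polygons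
-- drop out of `Φ` for different reasons. The coefficients of the first contain the factor
-- `|V| - (R t s + 1)`, which is zero for a single edge and positive once a polygon is closed; those
-- of the last count what is still to come, which is nothing. Positivity of the other coefficients
-- is not visible step by step: `Σ ψ²` lowers the index at each closing and `(Σ ψ)²` raises it. Only
-- after both are expanded in the skews do the terms of the wrong sign cancel. Two obstacles shape
-- the graph side. `IsKf` supplies an unknown matrix of resistances, so these must be shown to be
-- unique. And the network does not grow in the order in which the chain lists its vertices and
-- edges, so lists are compared only through sums over them and through Boolean adjacency.

ℚ-ring : AlmostCommutativeRing 0ℓ 0ℓ
ℚ-ring = fromCommutativeRing +-*-commutativeRing isZero
  where
  isZero : ∀ x → Maybe (0ℚ ≡ x)
  isZero x with 0ℚ ≟ x
  ... | yes p = just p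
  ... | no _  = nothing

2ℚ 4ℚ : ℚ
2ℚ = 1ℚ + 1ℚ
4ℚ = 2ℚ + 2ℚ

0≤1 : 0ℚ ≤ℚ 1ℚ
0≤1 = ≤ᵇ⇒≤ _

0<1 : 0ℚ <ℚ 1ℚ
0<1 = ≰⇒> λ p → contradiction (≤⇒≤ᵇ p) λ ()

+-nonneg : ∀ {x y} → 0ℚ ≤ℚ x → 0ℚ ≤ℚ y → 0ℚ ≤ℚ x + y
+-nonneg {x} {y} p q = subst (_≤ℚ x + y) (+-identityˡ 0ℚ) (+-mono-≤ p q)

+-pos-nonneg : ∀ {x y} → 0ℚ <ℚ x → 0ℚ ≤ℚ y → 0ℚ <ℚ x + y
+-pos-nonneg {x} {y} p q = subst (_<ℚ x + y) (+-identityˡ 0ℚ) (+-mono-<-≤ p q)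

*-nonneg : ∀ {x y} → 0ℚ ≤ℚ x → 0ℚ ≤ℚ y → 0ℚ ≤ℚ x * y
*-nonneg {x} {y} p q = subst (_≤ℚ x * y) (*-zeroˡ y)
  (*-monoʳ-≤-nonNeg y {{nonNegative q}} p)

*-pos : ∀ {x y} → 0ℚ <ℚ x → 0ℚ <ℚ y → 0ℚ <ℚ x * y
*-pos {x} {y} p q = subst (_<ℚ x * y) (*-zeroˡ y)
  (*-monoˡ-<-pos y {{positive q}} p)

0≤-⇒≤ : ∀ {x y} → 0ℚ ≤ℚ y - x → x ≤ℚ y
0≤-⇒≤ {x} {y} p = subst₂ _≤ℚ_ (+-identityˡ x) (cancel x y) (+-monoˡ-≤ x p)
  where
  cancel : ∀ x y → y - x + x ≡ y
  cancel = solve-∀ ℚ-ring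

-≡0⇒≡ : ∀ {x y} → y - x ≡ 0ℚ → x ≡ y
-≡0⇒≡ {x} {y} p = ≤-antisym (0≤-⇒≤ (≤-reflexive (sym p)))
  (0≤-⇒≤ (≤-reflexive (trans (sym (cong -_ p)) (flip x y))))
  where
  flip : ∀ x y → - (y - x) ≡ x - y
  flip = solve-∀ ℚ-ring

nonneg-sum≡0ˡ : ∀ {x y} → 0ℚ ≤ℚ x → 0ℚ ≤ℚ y → x + y ≡ 0ℚ → x ≡ 0ℚ
nonneg-sum≡0ˡ {x} {y} p q e = ≤-antisym
  (subst₂ _≤ℚ_ (+-identityʳ x) e (+-monoʳ-≤ x q)) p

nonneg-sum≡0ʳ : ∀ {x y} → 0ℚ ≤ℚ x → 0ℚ ≤ℚ y → x + y ≡ 0ℚ → y ≡ 0ℚ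
nonneg-sum≡0ʳ {x} {y} p q e = nonneg-sum≡0ˡ q p (trans (+-comm y x) e)

pos⇒≢0 : ∀ {x} → 0ℚ <ℚ x → x ≢ 0ℚ
pos⇒≢0 p refl = <-irrefl refl p

*-cancel-≡0 : ∀ {x y} → x ≢ 0ℚ → x * y ≡ 0ℚ → y ≡ 0ℚ
*-cancel-≡0 {x} {y} x≢0 e = trans (sym (*-identityˡ y))
  (trans (cong (_* y) (sym (*-inverseˡ x)))
  (trans (*-assoc (1/ x) x y) (trans (cong (1/ x *_) e) (*-zeroʳ (1/ x)))))
  where instance nz = ≢-nonZero x≢0

abstract
  -- Total, with value 0 at 0, so that the recursion for the moments can be written down before any
  -- gap is known to be nonnegative.
  recip : ℚ → ℚ
  recip x with x ≟ 0ℚ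
  ... | yes _  = 0ℚ
  ... | no x≢0 = (1/ x) {{≢-nonZero x≢0}}

  recip-inverse : ∀ {x} → 0ℚ <ℚ x → recip x * x ≡ 1ℚ
  recip-inverse {x} p with x ≟ 0ℚ
  ... | yes e  = contradiction e (pos⇒≢0 p)
  ... | no x≢0 = *-inverseˡ x {{≢-nonZero x≢0}}

  recip-pos : ∀ {x} → 0ℚ <ℚ x → 0ℚ <ℚ recip x
  recip-pos {x} p with x ≟ 0ℚ
  ... | yes e  = contradiction e (pos⇒≢0 p)
  ... | no x≢0 = positive⁻¹ _ {{1/pos⇒pos x {{positive p}}}}

ι : ℕ → ℚ
ι zero    = 0ℚ
ι (suc n) = 1ℚ + ι n

ι-nonneg : ∀ n → 0ℚ ≤ℚ ι n
ι-nonneg zero    = ≤-refl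
ι-nonneg (suc n) = +-nonneg 0≤1 (ι-nonneg n)

ι-pos : ∀ n → 0ℚ <ℚ ι (suc n)
ι-pos n = +-pos-nonneg 0<1 (ι-nonneg n)

ι-+ : ∀ m n → ι (m ℕ.+ n) ≡ ι m + ι n
ι-+ zero    n = sym (+-identityˡ (ι n))
ι-+ (suc m) n = trans (cong (1ℚ +_) (ι-+ m n)) (sym (+-assoc 1ℚ (ι m) (ι n)))

-- Moments

-- For a resistance matrix R and marked vertices t and s, with ψ x = R x t - R x s: the number of
-- vertices, R t s, Σ ψ, Σ ψ², 2 Σ (R x t + R x s) and 2 ΣΣ R, the last being 4 Kf.
record Moments : Set where
  constructor mom
  field
    size gap Σψ Σψ² Σends total : ℚ
open Moments public

mom-≡ : ∀ {n n′ a a′ x x′ q q′ p p′ f f′} → n ≡ n′ → a ≡ a′ → x ≡ x′ →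
  q ≡ q′ → p ≡ p′ → f ≡ f′ → mom n a x q p f ≡ mom n′ a′ x′ q′ p′ f′
mom-≡ refl refl refl refl refl refl = refl

-- A pendant vertex is attached at t (ε = 1) or at s (ε = -1) and replaces it as a marked vertex;
-- closeM adds a unit resistor between t and s.
pendM : ℚ → Moments → Moments
pendM ε (mom n a x q p f) = mom (n + 1ℚ) (a + 1ℚ)
  (x + ε * (n - (a + 1ℚ)))
  (q + 2ℚ * (ε * x) + n + (a + 1ℚ) * (a + 1ℚ))
  (p + 2ℚ * n + 2ℚ * (a + 1ℚ))
  (f + 4ℚ * n + p + 2ℚ * (ε * x))

flipM : Moments → Moments
flipM (mom n a x q p f) = mom n a (- x) q p f

closeM : Moments → Moments
closeM (mom n a x q p f) = mom n (i * a) (i * x) (i * i * q)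
  (p - i * (q + n * (a * a))) (f - i * (n * q - x * x))
  where i = recip (1ℚ + a)

-- Pendant steps preserve n - (a + 1), hence N of them with signs adding up to σ act quadratically
-- in σ, with corrections depending only on n, a and N.
cQ cP cF : ℚ → ℚ → ℕ → ℚ
cQ n a zero    = 0ℚ
cQ n a (suc N) = cQ n a N + (n + ι N) + (a + ι N + 1ℚ) * (a + ι N + 1ℚ) - (n - (a + 1ℚ))
cP n a zero    = 0ℚ
cP n a (suc N) = cP n a N + 2ℚ * (n + ι N) + 2ℚ * (a + ι N + 1ℚ)
cF n a zero    = 0ℚ
cF n a (suc N) = cF n a N + 4ℚ * (n + ι N) + cP n a N - (n - (a + 1ℚ))

pendsM : ℚ → ℕ → Moments → Moments
pendsM σ N (mom n a x q p f) = mom (n + ι N) (a + ι N)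
  (x + A * σ)
  (q + 2ℚ * (σ * x) + A * (σ * σ) + cQ n a N)
  (p + cP n a N)
  (f + ι N * p + 2ℚ * (σ * x) + A * (σ * σ) + cF n a N)
  where A = n - (a + 1ℚ)

pendsM-zero : ∀ M → pendsM 0ℚ 0 M ≡ M
pendsM-zero (mom n a x q p f) = mom-≡ (+-identityʳ n) (+-identityʳ a)
  (l₁ n a x) (l₂ n a x q) (+-identityʳ p) (l₃ n a x p f)
  where
  l₁ : ∀ n a x → x + (n - (a + 1ℚ)) * 0ℚ ≡ x
  l₁ = solve-∀ ℚ-ring
  l₂ : ∀ n a x q → q + (1ℚ + 1ℚ) * (0ℚ * x) + (n - (a + 1ℚ)) * (0ℚ * 0ℚ) + 0ℚ ≡ q
  l₂ = solve-∀ ℚ-ring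
  l₃ : ∀ n a x p f → f + 0ℚ * p + (1ℚ + 1ℚ) * (0ℚ * x) + (n - (a + 1ℚ)) * (0ℚ * 0ℚ) + 0ℚ ≡ f
  l₃ = solve-∀ ℚ-ring

-- Completing the square: `2 ε σ = (ε + σ)² - σ² - 1` for a sign ε. So only the sum of the signs is
-- remembered, and each step puts `- A` into `cQ` and `cF`, where `A = n - (a + 1)`.
pendM-pendsM : ∀ ε σ N M → ε * ε ≡ 1ℚ →
  pendM ε (pendsM σ N M) ≡ pendsM (ε + σ) (suc N) M
pendM-pendsM ε σ N (mom n a x q p f) εε = mom-≡ (l₀ n (ι N)) (l₀ a (ι N))
  (l₁ n a x ε σ (ι N))
  (eq (l₂ n a x q ε σ (ι N) (cQ n a N)))
  (l₃ n a p (ι N) (cP n a N))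
  (eq (l₄ n a x p f ε σ (ι N) (cP n a N) (cF n a N)))
  where
  -- The ring identities `l₂` and `l₄` cannot use `ε * ε ≡ 1ℚ`; they carry the difference
  -- `A * (ε * ε) - A`, removed here.
  eq : ∀ {y z} → y + (n - (a + 1ℚ)) * (ε * ε) - (n - (a + 1ℚ)) ≡ z →
    y ≡ z
  eq {y} {z} e = trans (back y (n - (a + 1ℚ)))
    (trans (cong (λ r → y + (n - (a + 1ℚ)) * r - (n - (a + 1ℚ))) (sym εε)) e)
    where
    back : ∀ y A → y ≡ y + A * 1ℚ - A
    back = solve-∀ ℚ-ring
  l₀ : ∀ n N → n + N + 1ℚ ≡ n + (1ℚ + N)
  l₀ = solve-∀ ℚ-ring
  l₁ : ∀ n a x ε σ N → x + (n - (a + 1ℚ)) * σ + ε * (n + N - (a + N + 1ℚ))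
    ≡ x + (n - (a + 1ℚ)) * (ε + σ)
  l₁ = solve-∀ ℚ-ring
  l₂ : ∀ n a x q ε σ N c →
    q + (1ℚ + 1ℚ) * (σ * x) + (n - (a + 1ℚ)) * (σ * σ) + c
      + (1ℚ + 1ℚ) * (ε * (x + (n - (a + 1ℚ)) * σ)) + (n + N)
      + (a + N + 1ℚ) * (a + N + 1ℚ)
      + (n - (a + 1ℚ)) * (ε * ε) - (n - (a + 1ℚ))
    ≡ q + (1ℚ + 1ℚ) * ((ε + σ) * x) + (n - (a + 1ℚ)) * ((ε + σ) * (ε + σ))
      + (c + (n + N) + (a + N + 1ℚ) * (a + N + 1ℚ) - (n - (a + 1ℚ)))
  l₂ = solve-∀ ℚ-ring
  l₃ : ∀ n a p N c → p + c + (1ℚ + 1ℚ) * (n + N) + (1ℚ + 1ℚ) * (a + N + 1ℚ)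
    ≡ p + (c + (1ℚ + 1ℚ) * (n + N) + (1ℚ + 1ℚ) * (a + N + 1ℚ))
  l₃ = solve-∀ ℚ-ring
  l₄ : ∀ n a x p f ε σ N c d →
    f + N * p + (1ℚ + 1ℚ) * (σ * x) + (n - (a + 1ℚ)) * (σ * σ) + d
      + (1ℚ + 1ℚ + (1ℚ + 1ℚ)) * (n + N) + (p + c)
      + (1ℚ + 1ℚ) * (ε * (x + (n - (a + 1ℚ)) * σ))
      + (n - (a + 1ℚ)) * (ε * ε) - (n - (a + 1ℚ))
    ≡ f + (1ℚ + N) * p + (1ℚ + 1ℚ) * ((ε + σ) * x)
      + (n - (a + 1ℚ)) * ((ε + σ) * (ε + σ))
      + (d + (1ℚ + 1ℚ + (1ℚ + 1ℚ)) * (n + N) + c - (n - (a + 1ℚ)))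
  l₄ = solve-∀ ℚ-ring

module Value (N : ℕ) where

  runM : List ℚ → Moments → Moments
  runM []       M = M
  runM (σ ∷ σs) M = runM σs (closeM (pendsM σ N M))

  i : ℚ → ℚ
  i a = recip (1ℚ + (a + ι N))

  -- The gap after a block: resistance `a + N` in parallel with a unit resistor.
  a⁺ : ℚ → ℚ
  a⁺ a = i a * (a + ι N)

  -- Only z and Φ depend on the skews themselves, all other coefficients just on their number.
  m : ℕ → ℚ
  m zero    = 0ℚ
  m (suc r) = ι N + m r

  g : ℕ → ℚ → ℚ
  g zero    a = 0ℚ
  g (suc r) a = i a + g r (a⁺ a) * (i a * i a)

  -- Put `A = n - (a + 1)`. A skew enters `total` and `Σψ²` through the same `y = 2 σ x + A σ²`, and
  -- `(Σψ)²` through `A y`. Since `n + N = A + (1 + a + N)` and `i (1 + a + N) = 1`, every term with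
  -- `A` and the leading 1 cancel in the coefficient of `y`. What remains is `- e`, and `e` has no
  -- negative term.
  e : ℕ → ℚ → ℚ
  e r a = m r * i a + g r (a⁺ a) * i a + m r * (g r (a⁺ a) * (i a * i a))

  z : List ℚ → ℚ → ℚ
  z []       a = 0ℚ
  z (σ ∷ σs) a = 2ℚ * (e (length σs) a * σ) + i a * z σs (a⁺ a)

  Φ : List ℚ → ℚ → ℚ → ℚ
  Φ []       n a = 0ℚ
  Φ (σ ∷ σs) n a = e (length σs) a * (n - (a + 1ℚ)) * (σ * σ)
    + i a * (n - (a + 1ℚ)) * (σ * z σs (a⁺ a)) + Φ σs (n + ι N) (a⁺ a)

  C : ℕ → ℚ → ℚ → ℚ
  C zero    n a = 0ℚ
  C (suc r) n a = cF n a N + m r * cP n a N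
    - (n + m (suc r)) * g (suc r) a * cQ n a N
    - m r * (i a * ((n + ι N) * ((a + ι N) * (a + ι N))))
    + C r (n + ι N) (a⁺ a)

  1+a-pos : ∀ {a} → 0ℚ ≤ℚ a → 0ℚ <ℚ 1ℚ + (a + ι N)
  1+a-pos p = +-pos-nonneg 0<1 (+-nonneg p (ι-nonneg N))

  i-pos : ∀ {a} → 0ℚ ≤ℚ a → 0ℚ <ℚ i a
  i-pos p = recip-pos (1+a-pos p)

  a⁺-nonneg : ∀ {a} → 0ℚ ≤ℚ a → 0ℚ ≤ℚ a⁺ a
  a⁺-nonneg p = *-nonneg (<⇒≤ (i-pos p)) (+-nonneg p (ι-nonneg N))

  -- A block acts affinely on `total`, `Σends` and `Σψ²` and quadratically on `Σψ`, so an expression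
  -- of this shape is preserved; peeling off one block yields the recursions that define its
  -- coefficients.
  total-run : ∀ σs M → 0ℚ ≤ℚ gap M →
    total (runM σs M) ≡
      total M + m (length σs) * Σends M
      - (size M + m (length σs)) * g (length σs) (gap M) * Σψ² M
      + g (length σs) (gap M) * (Σψ M * Σψ M) - z σs (gap M) * Σψ M
      - Φ σs (size M) (gap M) + C (length σs) (size M) (gap M)
  total-run [] (mom n a x q p f) _ = base n x q p f
    where
    base : ∀ n x q p f → f ≡ f + 0ℚ * p - (n + 0ℚ) * 0ℚ * q + 0ℚ * (x * x)
      - 0ℚ * x - 0ℚ + 0ℚ
    base = solve-∀ ℚ-ring
  total-run (σ ∷ σs) (mom n a x q p f) 0≤a = trans
    (total-run σs (closeM (pendsM σ N (mom n a x q p f))) (a⁺-nonneg 0≤a))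
    (trans
      (collect n a x q p f σ (ι N) (i a) (m r) (g r (a⁺ a)) (z σs (a⁺ a))
        (Φ σs (n + ι N) (a⁺ a)) (C r (n + ι N) (a⁺ a)) (cF n a N) (cP n a N) (cQ n a N))
      (drop _ (1ℚ + g r (a⁺ a) * i a) _ _ (recip-inverse (1+a-pos 0≤a))))
    where
    r = length σs
    drop : ∀ y u v h → h ≡ 1ℚ → y + u * ((1ℚ - h) * v) ≡ y
    drop y u v _ refl = cancel y u v
      where
      cancel : ∀ y u v → y + u * ((1ℚ - 1ℚ) * v) ≡ y
      cancel = solve-∀ ℚ-ring
    -- The last summand vanishes because i (1 + a + N) = 1.
    collect : ∀ n a x q p f σ N i m g z Φ C cF cP cQ →
      (f + N * p + (1ℚ + 1ℚ) * (σ * x) + (n - (a + 1ℚ)) * (σ * σ) + cF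
        - i * ((n + N) * (q + (1ℚ + 1ℚ) * (σ * x) + (n - (a + 1ℚ)) * (σ * σ) + cQ)
          - (x + (n - (a + 1ℚ)) * σ) * (x + (n - (a + 1ℚ)) * σ)))
      + m * (p + cP - i * ((q + (1ℚ + 1ℚ) * (σ * x) + (n - (a + 1ℚ)) * (σ * σ) + cQ)
          + (n + N) * ((a + N) * (a + N))))
      - (n + N + m) * g * (i * i * (q + (1ℚ + 1ℚ) * (σ * x) + (n - (a + 1ℚ)) * (σ * σ) + cQ))
      + g * ((i * (x + (n - (a + 1ℚ)) * σ)) * (i * (x + (n - (a + 1ℚ)) * σ)))
      - z * (i * (x + (n - (a + 1ℚ)) * σ)) - Φ + C
      ≡
      f + (N + m) * p - (n + (N + m)) * (i + g * (i * i)) * q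
      + (i + g * (i * i)) * (x * x)
      - ((1ℚ + 1ℚ) * ((m * i + g * i + m * (g * (i * i))) * σ) + i * z) * x
      - ((m * i + g * i + m * (g * (i * i))) * (n - (a + 1ℚ)) * (σ * σ)
         + i * (n - (a + 1ℚ)) * (σ * z) + Φ)
      + (cF + m * cP - (n + (N + m)) * (i + g * (i * i)) * cQ
         - m * (i * ((n + N) * ((a + N) * (a + N)))) + C)
      + (1ℚ + g * i) * ((1ℚ - i * (1ℚ + (a + N)))
          * ((1ℚ + 1ℚ) * (σ * x) + (n - (a + 1ℚ)) * (σ * σ)))
    collect = solve-∀ ℚ-ring

-- Extremality of equal skews

skew : ℕ × ℕ → ℚ
skew (p , q) = ι p - ι q

module Extremal (N′ K′ : ℕ) where

  N = suc N′
  K = suc K′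
  open Value N

  -- `Zmax r` and `Φmax r` are `z` and `Φ` for `r` inner blocks of skew `K` and a final end block.
  -- The end block is counted in `e (suc r)` but has no term of its own.
  Zmax : ℕ → ℚ → ℚ
  Zmax zero    a = 0ℚ
  Zmax (suc r) a = 2ℚ * (e (suc r) a * ι K) + i a * Zmax r (a⁺ a)

  Φmax : ℕ → ℚ → ℚ → ℚ
  Φmax zero    n a = 0ℚ
  Φmax (suc r) n a = e (suc r) a * (n - (a + 1ℚ)) * (ι K * ι K)
    + i a * (n - (a + 1ℚ)) * (ι K * Zmax r (a⁺ a)) + Φmax r (n + ι N) (a⁺ a)

  m-nonneg : ∀ r → 0ℚ ≤ℚ m r
  m-nonneg zero    = ≤-refl
  m-nonneg (suc r) = +-nonneg (ι-nonneg N) (m-nonneg r)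

  g-nonneg : ∀ r {a} → 0ℚ ≤ℚ a → 0ℚ ≤ℚ g r a
  g-nonneg zero    p = ≤-refl
  g-nonneg (suc r) p = +-nonneg (<⇒≤ (i-pos p))
    (*-nonneg (g-nonneg r (a⁺-nonneg p)) (*-nonneg (<⇒≤ (i-pos p)) (<⇒≤ (i-pos p))))

  e-pos : ∀ r {a} → 0ℚ ≤ℚ a → 0ℚ <ℚ e (suc r) a
  e-pos r {a} p = +-pos-nonneg
    (+-pos-nonneg (*-pos (+-pos-nonneg (ι-pos N′) (m-nonneg r)) (i-pos p))
      (*-nonneg g≥0 i≥0))
    (*-nonneg (m-nonneg (suc r)) (*-nonneg g≥0 (*-nonneg i≥0 i≥0)))
    where
    i≥0 = <⇒≤ (i-pos p)
    g≥0 = g-nonneg (suc r) (a⁺-nonneg p)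

  Zmax-nonneg : ∀ r {a} → 0ℚ ≤ℚ a → 0ℚ ≤ℚ Zmax r a
  Zmax-nonneg zero    p = ≤-refl
  Zmax-nonneg (suc r) p = +-nonneg
    (*-nonneg (+-nonneg 0≤1 0≤1) (*-nonneg (<⇒≤ (e-pos r p)) (ι-nonneg K)))
    (*-nonneg (<⇒≤ (i-pos p)) (Zmax-nonneg r (a⁺-nonneg p)))

  Zmax-pos : ∀ r {a} → 0ℚ ≤ℚ a → 0ℚ <ℚ Zmax (suc r) a
  Zmax-pos r p = +-pos-nonneg
    (*-pos (+-pos-nonneg 0<1 0≤1) (*-pos (e-pos r p) (ι-pos K′)))
    (*-nonneg (<⇒≤ (i-pos p)) (Zmax-nonneg r (a⁺-nonneg p)))

  -- As `a⁺ a = 1 - i a`, the excess `A = n - (a + 1)` becomes `A + a + N′ + i a`. It is positive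
  -- even if `A` was zero, which is the situation after the first polygon.
  excess-step : ∀ {n a} → 0ℚ ≤ℚ a → 0ℚ ≤ℚ n - (a + 1ℚ) →
    0ℚ <ℚ n + ι N - (a⁺ a + 1ℚ)
  excess-step {n} {a} p A≥0 = subst (0ℚ <ℚ_)
    (rearrange n a (ι N′) (i a) (recip-inverse (1+a-pos p)))
    (subst (0ℚ <ℚ_) (shuffle (i a) (n - (a + 1ℚ)) a (ι N′))
      (+-pos-nonneg (i-pos p) (+-nonneg A≥0 (+-nonneg p (ι-nonneg N′)))))
    where
    shuffle : ∀ i A a N → i + (A + (a + N)) ≡ A + (a + (N + i))
    shuffle = solve-∀ ℚ-ring
    rearrange : ∀ n a N i → i * (1ℚ + (a + (1ℚ + N))) ≡ 1ℚ →
      n - (a + 1ℚ) + (a + (N + i)) ≡ n + (1ℚ + N) - (i * (a + (1ℚ + N)) + 1ℚ)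
    rearrange n a N i h = trans (l n a N i)
      (trans (cong (λ t → n + (1ℚ + N) - (i * (a + (1ℚ + N)) + 1ℚ) + (t - 1ℚ)) h)
        (+-identityʳ _))
      where
      l : ∀ n a N i → n - (a + 1ℚ) + (a + (N + i))
        ≡ n + (1ℚ + N) - (i * (a + (1ℚ + N)) + 1ℚ) + (i * (1ℚ + (a + (1ℚ + N))) - 1ℚ)
      l = solve-∀ ℚ-ring

  module _ (d : ℚ) where

    skews : List (ℕ × ℕ) → List ℚ
    skews ws = map skew ws ++ (d ∷ [])

    length-skews : ∀ ws → length (skews ws) ≡ suc (length ws)
    length-skews []       = refl
    length-skews (_ ∷ ws) = cong suc (length-skews ws)

    Split : ℕ × ℕ → Set
    Split w = proj₁ w ℕ.+ proj₂ w ≡ K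

    -- Nothing follows the last block, so its skew `d` disappears from `z` and `Φ`.
    e-last : ∀ a → e 0 a ≡ 0ℚ
    e-last a = l (i a)
      where
      l : ∀ i → 0ℚ * i + 0ℚ * i + 0ℚ * (0ℚ * (i * i)) ≡ 0ℚ
      l = solve-∀ ℚ-ring

    z-last : ∀ a → z (d ∷ []) a ≡ 0ℚ
    z-last a = trans (cong (λ t → 2ℚ * (t * d) + i a * 0ℚ) (e-last a)) (l d (i a))
      where
      l : ∀ d i → (1ℚ + 1ℚ) * (0ℚ * d) + i * 0ℚ ≡ 0ℚ
      l = solve-∀ ℚ-ring

    Φ-last : ∀ n a → Φ (d ∷ []) n a ≡ 0ℚ
    Φ-last n a = trans
      (cong (λ t → t * (n - (a + 1ℚ)) * (d * d) + i a * (n - (a + 1ℚ)) * (d * 0ℚ) + 0ℚ)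
        (e-last a))
      (l d (i a) (n - (a + 1ℚ)))
      where
      l : ∀ d i A → 0ℚ * A * (d * d) + i * A * (d * 0ℚ) + 0ℚ ≡ 0ℚ
      l = solve-∀ ℚ-ring

    e-skews : ∀ ws a → e (length (skews ws)) a ≡ e (suc (length ws)) a
    e-skews ws a = cong (λ r → e r a) (length-skews ws)

    ι-split : ∀ p q → p ℕ.+ q ≡ K → ι K ≡ ι p + ι q
    ι-split p q eq = trans (cong ι (sym eq)) (ι-+ p q)

    -- With `ι K = p + q` and skew `p - q`, maximum minus skew is `2 q`; maximum plus skew is `2 p`
    -- in `Zmax+z`.
    Zmax-z : ∀ p q ws a → p ℕ.+ q ≡ K →
      Zmax (suc (length ws)) a - z (skews ((p , q) ∷ ws)) a
        ≡ 4ℚ * (e (suc (length ws)) a * ι q)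
          + i a * (Zmax (length ws) (a⁺ a) - z (skews ws) (a⁺ a))
    Zmax-z p q ws a eq = l (ι p) (ι q) (i a) (Zmax (length ws) (a⁺ a)) (z (skews ws) (a⁺ a))
      (e-skews ws a) (ι-split p q eq)
      where
      ring : ∀ e p q i Z z → (1ℚ + 1ℚ) * (e * (p + q)) + i * Z
        - ((1ℚ + 1ℚ) * (e * (p - q)) + i * z)
        ≡ (1ℚ + 1ℚ + (1ℚ + 1ℚ)) * (e * q) + i * (Z - z)
      ring = solve-∀ ℚ-ring
      l : ∀ {e e′ k} p q i Z z → e′ ≡ e → k ≡ p + q →
        2ℚ * (e * k) + i * Z - (2ℚ * (e′ * (p - q)) + i * z)
        ≡ 4ℚ * (e * q) + i * (Z - z)
      l {e} p q i Z z refl refl = ring e p q i Z z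

    Zmax+z : ∀ p q ws a → p ℕ.+ q ≡ K →
      Zmax (suc (length ws)) a + z (skews ((p , q) ∷ ws)) a
        ≡ 4ℚ * (e (suc (length ws)) a * ι p)
          + i a * (Zmax (length ws) (a⁺ a) + z (skews ws) (a⁺ a))
    Zmax+z p q ws a eq = l (ι p) (ι q) (i a) (Zmax (length ws) (a⁺ a)) (z (skews ws) (a⁺ a))
      (e-skews ws a) (ι-split p q eq)
      where
      ring : ∀ e p q i Z z → (1ℚ + 1ℚ) * (e * (p + q)) + i * Z
        + ((1ℚ + 1ℚ) * (e * (p - q)) + i * z)
        ≡ (1ℚ + 1ℚ + (1ℚ + 1ℚ)) * (e * p) + i * (Z + z)
      ring = solve-∀ ℚ-ring
      l : ∀ {e e′ k} p q i Z z → e′ ≡ e → k ≡ p + q →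
        2ℚ * (e * k) + i * Z + (2ℚ * (e′ * (p - q)) + i * z)
        ≡ 4ℚ * (e * p) + i * (Z + z)
      l {e} p q i Z z refl refl = ring e p q i Z z

    -- The form in which maximality can be read off: `K² - σ² = 4 p q` and
    -- `K Z - σ z = p (Z - z) + q (Z + z)`, so each summand is a product of nonnegative factors.
    Φmax-Φ : ∀ p q ws n a → p ℕ.+ q ≡ K →
      Φmax (suc (length ws)) n a - Φ (skews ((p , q) ∷ ws)) n a
        ≡ 4ℚ * (e (suc (length ws)) a * (n - (a + 1ℚ))) * (ι p * ι q)
          + i a * (n - (a + 1ℚ))
            * (ι p * (Zmax (length ws) (a⁺ a) - z (skews ws) (a⁺ a))
               + ι q * (Zmax (length ws) (a⁺ a) + z (skews ws) (a⁺ a)))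
          + (Φmax (length ws) (n + ι N) (a⁺ a) - Φ (skews ws) (n + ι N) (a⁺ a))
    Φmax-Φ p q ws n a eq = l (n - (a + 1ℚ)) (ι p) (ι q) (i a)
      (Zmax (length ws) (a⁺ a)) (z (skews ws) (a⁺ a))
      (Φmax (length ws) (n + ι N) (a⁺ a)) (Φ (skews ws) (n + ι N) (a⁺ a))
      (e-skews ws a) (ι-split p q eq)
      where
      ring : ∀ e A p q i Z z Y y →
        e * A * ((p + q) * (p + q)) + i * A * ((p + q) * Z) + Y
          - (e * A * ((p - q) * (p - q)) + i * A * ((p - q) * z) + y)
        ≡ (1ℚ + 1ℚ + (1ℚ + 1ℚ)) * (e * A) * (p * q)
          + i * A * (p * (Z - z) + q * (Z + z)) + (Y - y)
      ring = solve-∀ ℚ-ring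
      l : ∀ {e e′ k} A p q i Z z Y y → e′ ≡ e → k ≡ p + q →
        e * A * (k * k) + i * A * (k * Z) + Y
          - (e′ * A * ((p - q) * (p - q)) + i * A * ((p - q) * z) + y)
        ≡ 4ℚ * (e * A) * (p * q)
          + i * A * (p * (Z - z) + q * (Z + z)) + (Y - y)
      l {e} A p q i Z z Y y refl refl = ring e A p q i Z z Y y

    0≤4 : 0ℚ ≤ℚ 4ℚ
    0≤4 = +-nonneg (+-nonneg 0≤1 0≤1) (+-nonneg 0≤1 0≤1)

    -- Both bounds on `z` are needed: in `Φmax-Φ` the number `p` multiplies `Zmax - z` and `q`
    -- multiplies `Zmax + z`.
    z-bounds : ∀ {ws} → Allᴸ Split ws → ∀ {a} → 0ℚ ≤ℚ a →
      0ℚ ≤ℚ Zmax (length ws) a - z (skews ws) a × 0ℚ ≤ℚ Zmax (length ws) a + z (skews ws) a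
    z-bounds {[]} [] {a} _ =
      subst (λ t → 0ℚ ≤ℚ 0ℚ - t × 0ℚ ≤ℚ 0ℚ + t) (sym (z-last a)) (≤-refl , ≤-refl)
    z-bounds {(p , q) ∷ ws} (s ∷ ss) {a} a≥0 =
      subst (0ℚ ≤ℚ_) (sym (Zmax-z p q ws a s)) (both q (proj₁ rest)) ,
      subst (0ℚ ≤ℚ_) (sym (Zmax+z p q ws a s)) (both p (proj₂ rest))
      where
      rest = z-bounds ss (a⁺-nonneg a≥0)
      both : ∀ t {y} → 0ℚ ≤ℚ y → 0ℚ ≤ℚ 4ℚ * (e (suc (length ws)) a * ι t) + i a * y
      both t y≥0 = +-nonneg
        (*-nonneg 0≤4 (*-nonneg (<⇒≤ (e-pos (length ws) a≥0)) (ι-nonneg t)))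
        (*-nonneg (<⇒≤ (i-pos a≥0)) y≥0)

    -- All inner skews equal `- K` and `z` is linear in them, hence `z = - Zmax`; `Φ`, being
    -- quadratic, attains `Φmax` at the same point.
    z-allˡ : ∀ {ws} → Allᴸ Split ws → Allᴸ (λ w → proj₁ w ≡ 0) ws → ∀ a →
      Zmax (length ws) a + z (skews ws) a ≡ 0ℚ
    z-allˡ {[]} [] [] a = trans (+-identityˡ (z (d ∷ []) a)) (z-last a)
    z-allˡ {(_ , q) ∷ ws} (s ∷ ss) (refl ∷ zs) a = trans (Zmax+z 0 q ws a s)
      (trans (cong (λ t → 4ℚ * (e (suc (length ws)) a * 0ℚ) + i a * t) (z-allˡ ss zs (a⁺ a)))
        (l (e (suc (length ws)) a) (i a)))
      where
      l : ∀ e i → (1ℚ + 1ℚ + (1ℚ + 1ℚ)) * (e * 0ℚ) + i * 0ℚ ≡ 0ℚ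
      l = solve-∀ ℚ-ring

    z-allʳ : ∀ {ws} → Allᴸ Split ws → Allᴸ (λ w → proj₂ w ≡ 0) ws → ∀ a →
      Zmax (length ws) a - z (skews ws) a ≡ 0ℚ
    z-allʳ {[]} [] [] a = cong (λ t → 0ℚ - t) (z-last a)
    z-allʳ {(p , _) ∷ ws} (s ∷ ss) (refl ∷ zs) a = trans (Zmax-z p 0 ws a s)
      (trans (cong (λ t → 4ℚ * (e (suc (length ws)) a * 0ℚ) + i a * t) (z-allʳ ss zs (a⁺ a)))
        (l (e (suc (length ws)) a) (i a)))
      where
      l : ∀ e i → (1ℚ + 1ℚ + (1ℚ + 1ℚ)) * (e * 0ℚ) + i * 0ℚ ≡ 0ℚ
      l = solve-∀ ℚ-ring

    Φ-allˡ : ∀ {ws} → Allᴸ Split ws → Allᴸ (λ w → proj₁ w ≡ 0) ws → ∀ n a →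
      Φmax (length ws) n a - Φ (skews ws) n a ≡ 0ℚ
    Φ-allˡ {[]} [] [] n a = cong (λ t → 0ℚ - t) (Φ-last n a)
    Φ-allˡ {(_ , q) ∷ ws} (s ∷ ss) (refl ∷ zs) n a = trans (Φmax-Φ 0 q ws n a s)
      (trans (cong₂ (λ t u → 4ℚ * (e (suc (length ws)) a * (n - (a + 1ℚ))) * (0ℚ * ι q)
            + i a * (n - (a + 1ℚ))
              * (0ℚ * (Zmax (length ws) (a⁺ a) - z (skews ws) (a⁺ a)) + ι q * t) + u)
          (z-allˡ ss zs (a⁺ a)) (Φ-allˡ ss zs (n + ι N) (a⁺ a)))
        (l (e (suc (length ws)) a * (n - (a + 1ℚ))) (ι q) (i a * (n - (a + 1ℚ)))
          (Zmax (length ws) (a⁺ a) - z (skews ws) (a⁺ a))))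
      where
      l : ∀ e q i y → (1ℚ + 1ℚ + (1ℚ + 1ℚ)) * e * (0ℚ * q) + i * (0ℚ * y + q * 0ℚ) + 0ℚ ≡ 0ℚ
      l = solve-∀ ℚ-ring

    module Terms {p q : ℕ} {ws : List (ℕ × ℕ)} (ss : Allᴸ Split ws)
      {n a : ℚ} (a≥0 : 0ℚ ≤ℚ a) (A>0 : 0ℚ <ℚ n - (a + 1ℚ)) where
      coef₁>0 : 0ℚ <ℚ 4ℚ * (e (suc (length ws)) a * (n - (a + 1ℚ)))
      coef₁>0 = *-pos (+-pos-nonneg (+-pos-nonneg 0<1 0≤1) (+-nonneg 0≤1 0≤1))
        (*-pos (e-pos (length ws) a≥0) A>0)
      coef₂>0 : 0ℚ <ℚ i a * (n - (a + 1ℚ))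
      coef₂>0 = *-pos (i-pos a≥0) A>0
      term₁ : 0ℚ ≤ℚ ι p * (Zmax (length ws) (a⁺ a) - z (skews ws) (a⁺ a))
      term₁ = *-nonneg (ι-nonneg p) (proj₁ (z-bounds ss (a⁺-nonneg a≥0)))
      term₂ : 0ℚ ≤ℚ ι q * (Zmax (length ws) (a⁺ a) + z (skews ws) (a⁺ a))
      term₂ = *-nonneg (ι-nonneg q) (proj₂ (z-bounds ss (a⁺-nonneg a≥0)))
      summand₁ : 0ℚ ≤ℚ 4ℚ * (e (suc (length ws)) a * (n - (a + 1ℚ))) * (ι p * ι q)
      summand₁ = *-nonneg (<⇒≤ coef₁>0) (*-nonneg (ι-nonneg p) (ι-nonneg q))
      summand₂ : 0ℚ ≤ℚ i a * (n - (a + 1ℚ))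
            * (ι p * (Zmax (length ws) (a⁺ a) - z (skews ws) (a⁺ a))
               + ι q * (Zmax (length ws) (a⁺ a) + z (skews ws) (a⁺ a)))
      summand₂ = *-nonneg (<⇒≤ coef₂>0) (+-nonneg term₁ term₂)

    Φ≤Φmax : ∀ {ws} → Allᴸ Split ws → ∀ {n a} → 0ℚ ≤ℚ a → 0ℚ <ℚ n - (a + 1ℚ) →
      0ℚ ≤ℚ Φmax (length ws) n a - Φ (skews ws) n a
    Φ≤Φmax {[]} [] {n} {a} _ _ = ≤-reflexive (sym (cong (λ t → 0ℚ - t) (Φ-last n a)))
    Φ≤Φmax {(p , q) ∷ ws} (s ∷ ss) {n} {a} a≥0 A>0 =
      subst (0ℚ ≤ℚ_) (sym (Φmax-Φ p q ws n a s))
        (+-nonneg (+-nonneg summand₁ summand₂)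
          (Φ≤Φmax ss {n + ι N} (a⁺-nonneg a≥0) (excess-step {n} {a} a≥0 (<⇒≤ A>0))))
      where open Terms {p} {q} ss {n} {a} a≥0 A>0

    -- Every nonnegative summand of `Φmax-Φ` must vanish. From `p q = 0` each block is extreme. If,
    -- say, `p = 0`, then `z = - Zmax` for the later blocks; were these extreme on the opposite
    -- side, also `z = Zmax`, so `Zmax = 0` and no inner block is left.
    Φ≡Φmax : ∀ {ws} → Allᴸ Split ws → ∀ {n a} → 0ℚ ≤ℚ a → 0ℚ <ℚ n - (a + 1ℚ) →
      Φmax (length ws) n a - Φ (skews ws) n a ≡ 0ℚ →
      Allᴸ (λ w → proj₁ w ≡ 0) ws ⊎ Allᴸ (λ w → proj₂ w ≡ 0) ws
    Φ≡Φmax {[]} [] _ _ _ = inj₁ []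
    Φ≡Φmax {(p , q) ∷ ws} (s ∷ ss) {n} {a} a≥0 A>0 eq =
      decide p q s pq≡0 (proj₁ vanish) (proj₂ vanish)
        (Φ≡Φmax ss {n + ι N} (a⁺-nonneg a≥0) (excess-step {n} {a} a≥0 (<⇒≤ A>0))
          (nonneg-sum≡0ʳ (+-nonneg summand₁ summand₂) rest eq′))
      where
      open Terms {p} {q} ss {n} {a} a≥0 A>0
      Z = Zmax (length ws) (a⁺ a)
      ζ = z (skews ws) (a⁺ a)
      rest = Φ≤Φmax ss {n + ι N} (a⁺-nonneg a≥0) (excess-step {n} {a} a≥0 (<⇒≤ A>0))
      eq′ = trans (sym (Φmax-Φ p q ws n a s)) eq
      front = nonneg-sum≡0ˡ (+-nonneg summand₁ summand₂) rest eq′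
      pq≡0 : ι p * ι q ≡ 0ℚ
      pq≡0 = *-cancel-≡0 (pos⇒≢0 coef₁>0) (nonneg-sum≡0ˡ summand₁ summand₂ front)
      cross = *-cancel-≡0 (pos⇒≢0 coef₂>0) (nonneg-sum≡0ʳ summand₁ summand₂ front)
      vanish : ι p * (Z - ζ) ≡ 0ℚ × ι q * (Z + ζ) ≡ 0ℚ
      vanish = nonneg-sum≡0ˡ term₁ term₂ cross , nonneg-sum≡0ʳ term₁ term₂ cross
      opposite : ∀ Z ζ → Z - ζ + (Z + ζ) ≡ 2ℚ * Z
      opposite = solve-∀ ℚ-ring
      empty : Z - ζ ≡ 0ℚ → Z + ζ ≡ 0ℚ → ws ≡ []
      empty e₁ e₂ = nil ws (*-cancel-≡0 (pos⇒≢0 (+-pos-nonneg 0<1 0≤1))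
          (trans (sym (opposite Z ζ)) (cong₂ _+_ e₁ e₂)))
        where
        nil : ∀ vs → Zmax (length vs) (a⁺ a) ≡ 0ℚ → vs ≡ []
        nil []       _ = refl
        nil (v ∷ vs) h = contradiction h (pos⇒≢0 (Zmax-pos (length vs) (a⁺-nonneg a≥0)))
      decide : ∀ p q → p ℕ.+ q ≡ K → ι p * ι q ≡ 0ℚ →
        ι p * (Z - ζ) ≡ 0ℚ → ι q * (Z + ζ) ≡ 0ℚ →
        Allᴸ (λ w → proj₁ w ≡ 0) ws ⊎ Allᴸ (λ w → proj₂ w ≡ 0) ws →
        Allᴸ (λ w → proj₁ w ≡ 0) ((p , q) ∷ ws) ⊎ Allᴸ (λ w → proj₂ w ≡ 0) ((p , q) ∷ ws)
      decide zero    (suc q) _ _ _ _ (inj₁ h) = inj₁ (refl ∷ h)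
      decide zero    (suc q) _ _ _ v (inj₂ h) = inj₁ (refl ∷ subst (Allᴸ _)
        (sym (empty (z-allʳ ss h (a⁺ a)) (*-cancel-≡0 (pos⇒≢0 (ι-pos q)) v))) [])
      decide (suc p) zero    _ _ _ _ (inj₂ h) = inj₂ (refl ∷ h)
      decide (suc p) zero    _ _ v _ (inj₁ h) = inj₂ (refl ∷ subst (Allᴸ _)
        (sym (empty (*-cancel-≡0 (pos⇒≢0 (ι-pos p)) v) (z-allˡ ss h (a⁺ a)))) [])
      decide (suc p) (suc q) _ h _ _ _ =
        contradiction h (pos⇒≢0 (*-pos (ι-pos p) (ι-pos q)))
      decide zero zero () _ _ _ _

    module _ (n a q p f : ℚ) (a≥0 : 0ℚ ≤ℚ a) (A≡0 : n - (a + 1ℚ) ≡ 0ℚ) where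

      run-total : List (ℕ × ℕ) → ℚ
      run-total ws = total (runM (d ∷ skews ws) (mom n a 0ℚ q p f))

      offset : ℕ → ℚ
      offset r = f + m r * p - (n + m r) * g r a * q + C r n a

      -- The first block contributes nothing to Φ because n - (a + 1) = 0 and Σψ = 0 at the start.
      run-total-Φ : ∀ ws → run-total ws
        ≡ offset (suc (suc (length ws))) - Φ (skews ws) (n + ι N) (a⁺ a)
      run-total-Φ ws = trans (total-run (d ∷ skews ws) (mom n a 0ℚ q p f) a≥0)
        (trans (l (f + m r′ * p - (n + m r′) * g r′ a * q) (g r′ a) (z (d ∷ skews ws) a)
                  (e (length (skews ws)) a) (n - (a + 1ℚ)) (d * d) (i a)
                  (d * z (skews ws) (a⁺ a)) (Φ (skews ws) (n + ι N) (a⁺ a)) (C r′ n a) A≡0)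
          (cong (λ r → offset r - Φ (skews ws) (n + ι N) (a⁺ a))
            (cong suc (length-skews ws))))
        where
        r′ = suc (length (skews ws))
        ring : ∀ y g z e d i w F c →
          y + g * (0ℚ * 0ℚ) - z * 0ℚ - (e * 0ℚ * d + i * 0ℚ * w + F) + c ≡ y + c - F
        ring = solve-∀ ℚ-ring
        l : ∀ y g z e A d i w F c → A ≡ 0ℚ →
          y + g * (0ℚ * 0ℚ) - z * 0ℚ - (e * A * d + i * A * w + F) + c ≡ y + c - F
        l y g z e _ d i w F c refl = ring y g z e d i w F c

      -- `offset` depends only on the number of blocks and cancels, while the reference chain `ws₀`
      -- has `Φ = Φmax`.
      run-total-gap : ∀ ws ws₀ → length ws ≡ length ws₀ →
        Allᴸ Split ws₀ → Allᴸ (λ w → proj₁ w ≡ 0) ws₀ →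
        run-total ws - run-total ws₀
          ≡ Φmax (length ws) (n + ι N) (a⁺ a) - Φ (skews ws) (n + ι N) (a⁺ a)
      run-total-gap ws ws₀ len ss₀ zs₀ = trans
        (cong₂ _-_ (run-total-Φ ws) (run-total-Φ ws₀))
        (l (offset (suc (suc (length ws)))) (offset (suc (suc (length ws₀))))
          (Φ (skews ws) (n + ι N) (a⁺ a)) (Φ (skews ws₀) (n + ι N) (a⁺ a))
          (Φmax (length ws) (n + ι N) (a⁺ a)) (cong (λ r → offset (suc (suc r))) len)
          (Φ-allˡ ss₀ zs₀ (n + ι N) (a⁺ a))
          (cong (λ r → Φmax r (n + ι N) (a⁺ a)) len))
        where
        l : ∀ c c₀ F F₀ {M₀} M → c ≡ c₀ → M₀ - F₀ ≡ 0ℚ → M ≡ M₀ → c - F - (c₀ - F₀) ≡ M - F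
        l c _ F F₀ M refl e₀ refl = trans (ring c F F₀ M)
          (trans (cong (λ t → M - F - t) e₀) (+-identityʳ (M - F)))
          where
          ring : ∀ c F F₀ M → c - F - (c - F₀) ≡ M - F - (M - F₀)
          ring = solve-∀ ℚ-ring

      module _ {ws ws₀ : List (ℕ × ℕ)} (len : length ws ≡ length ws₀) (ss : Allᴸ Split ws)
        (ss₀ : Allᴸ Split ws₀) (zs₀ : Allᴸ (λ w → proj₁ w ≡ 0) ws₀) where

        A⁺>0 : 0ℚ <ℚ n + ι N - (a⁺ a + 1ℚ)
        A⁺>0 = excess-step {n} {a} a≥0 (≤-reflexive (sym A≡0))

        run-total-min : run-total ws₀ ≤ℚ run-total ws
        run-total-min = 0≤-⇒≤ (subst (0ℚ ≤ℚ_) (sym (run-total-gap ws ws₀ len ss₀ zs₀))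
          (Φ≤Φmax ss {n + ι N} (a⁺-nonneg a≥0) A⁺>0))

        run-total-unique : run-total ws ≡ run-total ws₀ →
          Allᴸ (λ w → proj₁ w ≡ 0) ws ⊎ Allᴸ (λ w → proj₂ w ≡ 0) ws
        run-total-unique eq = Φ≡Φmax ss {n + ι N} (a⁺-nonneg a≥0) A⁺>0
          (trans (sym (run-total-gap ws ws₀ len ss₀ zs₀))
            (trans (cong (_- run-total ws₀) eq) (+-inverseʳ (run-total ws₀))))

-- Edge lists and Boolean adjacency

≡ᵇ-refl : ∀ n → (n ≡ᵇ n) ≡ true
≡ᵇ-refl zero    = refl
≡ᵇ-refl (suc n) = ≡ᵇ-refl n

≡ᵇ-≢ : ∀ {m n} → m ≢ n → (m ≡ᵇ n) ≡ false
≡ᵇ-≢ {m} {n} m≢n with m ≡ᵇ n in eq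
... | false = refl
... | true  = contradiction (ℕₚ.≡ᵇ⇒≡ m n (subst T (sym eq) tt)) m≢n

≡ᵇ-true : ∀ {m n} → (m ≡ᵇ n) ≡ true → m ≡ n
≡ᵇ-true {m} {n} eq = ℕₚ.≡ᵇ⇒≡ m n (subst T (sym eq) tt)

Edge : Set
Edge = ℕ × ℕ

joins : ℕ → ℕ → Edge → Bool
joins u v e = ((proj₁ e ≡ᵇ u) ∧ (proj₂ e ≡ᵇ v)) ∨ ((proj₁ e ≡ᵇ v) ∧ (proj₂ e ≡ᵇ u))

mem : List Edge → ℕ → ℕ → Bool
mem E u v = any (joins u v) E

mem-++ : ∀ E E′ u v → mem (E ++ E′) u v ≡ mem E u v ∨ mem E′ u v
mem-++ []      E′ u v = refl
mem-++ (e ∷ E) E′ u v = trans (cong (joins u v e ∨_) (mem-++ E E′ u v))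
  (sym (∨-assoc (joins u v e) (mem E u v) (mem E′ u v)))

joins-sym : ∀ u v e → joins u v e ≡ joins v u e
joins-sym u v (a , b) = ∨-comm ((a ≡ᵇ u) ∧ (b ≡ᵇ v)) ((a ≡ᵇ v) ∧ (b ≡ᵇ u))

mem-sym : ∀ E u v → mem E u v ≡ mem E v u
mem-sym []      u v = refl
mem-sym (e ∷ E) u v = cong₂ _∨_ (joins-sym u v e) (mem-sym E u v)

joins-flip : ∀ u v a b → joins u v (a , b) ≡ joins u v (b , a)
joins-flip u v a b = trans
  (cong₂ _∨_ (∧-comm (a ≡ᵇ u) (b ≡ᵇ v)) (∧-comm (a ≡ᵇ v) (b ≡ᵇ u)))
  (∨-comm ((b ≡ᵇ v) ∧ (a ≡ᵇ u)) ((b ≡ᵇ u) ∧ (a ≡ᵇ v)))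

joins-true : ∀ {u v} a b → joins u v (a , b) ≡ true →
  (a ≡ u × b ≡ v) ⊎ (a ≡ v × b ≡ u)
joins-true {u} {v} a b eq
  with Equivalence.to (T-∨ {(a ≡ᵇ u) ∧ (b ≡ᵇ v)}) (Equivalence.from T-≡ eq)
... | inj₁ h = let (p , q) = Equivalence.to (T-∧ {a ≡ᵇ u}) h
               in inj₁ (ℕₚ.≡ᵇ⇒≡ a u p , ℕₚ.≡ᵇ⇒≡ b v q)
... | inj₂ h = let (p , q) = Equivalence.to (T-∧ {a ≡ᵇ v}) h
               in inj₂ (ℕₚ.≡ᵇ⇒≡ a v p , ℕₚ.≡ᵇ⇒≡ b u q)

Within : List ℕ → Edge → Set
Within vs e = proj₁ e ∈ vs × proj₂ e ∈ vs

mem-∈ : ∀ {vs} E {u v} → Allᴸ (Within vs) E → mem E u v ≡ true → u ∈ vs × v ∈ vs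
mem-∈ ((a , b) ∷ E) {u} {v} ((a∈ , b∈) ∷ ends) eq with joins u v (a , b) in eq′
... | false = mem-∈ E ends eq
... | true with joins-true a b eq′
...   | inj₁ (refl , refl) = a∈ , b∈
...   | inj₂ (refl , refl) = b∈ , a∈

mem-∉ : ∀ {vs} E {u v} → Allᴸ (Within vs) E → u ∉ vs → mem E u v ≡ false
mem-∉ E {u} {v} ends u∉ with mem E u v in eq
... | false = refl
... | true  = contradiction (proj₁ (mem-∈ E ends eq)) u∉

-- `laplacian` counts an adjacent pair once, `lap` counts every list entry; they agree on lists
-- without loops and repetitions.
Simple : List Edge → Set
Simple []            = ⊤
Simple ((a , b) ∷ E) = a ≢ b × mem E a b ≡ false × Simple E

-- Sums over vertex lists and Laplacians of edge lists

sumL : List ℕ → (ℕ → ℚ) → ℚ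
sumL []       f = 0ℚ
sumL (x ∷ xs) f = f x + sumL xs f

sumL-cong : ∀ xs {f g} → (∀ {x} → x ∈ xs → f x ≡ g x) → sumL xs f ≡ sumL xs g
sumL-cong []       _ = refl
sumL-cong (x ∷ xs) h = cong₂ _+_ (h (here refl)) (sumL-cong xs (λ x∈ → h (there x∈)))

-- One fixed shape, three functions and a constant, serves all later linear computations; spare
-- places are filled with coefficient 0.
sumL-lin : ∀ xs α f β g γ h d →
  sumL xs (λ x → α * f x + β * g x + γ * h x + d)
  ≡ α * sumL xs f + β * sumL xs g + γ * sumL xs h + d * sumL xs (λ _ → 1ℚ)
sumL-lin []       α f β g γ h d = l α β γ d
  where
  l : ∀ α β γ d → 0ℚ ≡ α * 0ℚ + β * 0ℚ + γ * 0ℚ + d * 0ℚ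
  l = solve-∀ ℚ-ring
sumL-lin (x ∷ xs) α f β g γ h d = trans
  (cong (α * f x + β * g x + γ * h x + d +_) (sumL-lin xs α f β g γ h d))
  (l α (f x) (sumL xs f) β (g x) (sumL xs g) γ (h x) (sumL xs h) d (sumL xs (λ _ → 1ℚ)))
  where
  l : ∀ α f F β g G γ h H d N →
    α * f + β * g + γ * h + d + (α * F + β * G + γ * H + d * N)
    ≡ α * (f + F) + β * (g + G) + γ * (h + H) + d * (1ℚ + N)
  l = solve-∀ ℚ-ring

ind : ℕ → ℕ → ℚ
ind a w = if a ≡ᵇ w then 1ℚ else 0ℚ

ind-refl : ∀ a → ind a a ≡ 1ℚ
ind-refl a = cong (λ b → if b then 1ℚ else 0ℚ) (≡ᵇ-refl a)

ind-≢ : ∀ {a w} → a ≢ w → ind a w ≡ 0ℚ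
ind-≢ a≢w = cong (λ b → if b then 1ℚ else 0ℚ) (≡ᵇ-≢ a≢w)

-- The Laplacian as incidence matrix times its transpose: a new edge is a new summand.
lap : List Edge → (ℕ → ℚ) → ℕ → ℚ
lap []            f w = 0ℚ
lap ((a , b) ∷ E) f w = (ind a w - ind b w) * (f a - f b) + lap E f w

lap-cong : ∀ {vs} E {f g} → Allᴸ (Within vs) E → (∀ {x} → x ∈ vs → f x ≡ g x) →
  ∀ w → lap E f w ≡ lap E g w
lap-cong []            []                   h w = refl
lap-cong ((a , b) ∷ E) ((a∈ , b∈) ∷ ends) h w = cong₂ _+_
  (cong₂ (λ x y → (ind a w - ind b w) * (x - y)) (h a∈) (h b∈)) (lap-cong E ends h w)

lap-lin : ∀ E α f β g γ h d w →
  lap E (λ x → α * f x + β * g x + γ * h x + d) w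
  ≡ α * lap E f w + β * lap E g w + γ * lap E h w
lap-lin []            α f β g γ h d w = l α β γ
  where
  l : ∀ α β γ → 0ℚ ≡ α * 0ℚ + β * 0ℚ + γ * 0ℚ
  l = solve-∀ ℚ-ring
lap-lin ((a , b) ∷ E) α f β g γ h d w = trans
  (cong ((ind a w - ind b w) * (α * f a + β * g a + γ * h a + d
    - (α * f b + β * g b + γ * h b + d)) +_) (lap-lin E α f β g γ h d w))
  (l (ind a w - ind b w) α (f a) (f b) (lap E f w) β (g a) (g b) (lap E g w)
     γ (h a) (h b) (lap E h w) d)
  where
  l : ∀ k α f f′ F β g g′ G γ h h′ H d →
    k * (α * f + β * g + γ * h + d - (α * f′ + β * g′ + γ * h′ + d))
      + (α * F + β * G + γ * H)
    ≡ α * (k * (f - f′) + F) + β * (k * (g - g′) + G) + γ * (k * (h - h′) + H)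
  l = solve-∀ ℚ-ring

-- Resistance networks with two marked vertices

-- R-lap is the matrix identity L R = τ 1ᵀ - 2 I, which determines potentials and is stable under
-- the updates below.
record Net : Set where
  field
    vs     : List ℕ
    E      : List Edge
    R      : ℕ → ℕ → ℚ
    t s    : ℕ
    τ      : ℕ → ℚ
    R-sym  : ∀ x y → R x y ≡ R y x
    R-diag : ∀ x → R x x ≡ 0ℚ
    R-lap  : ∀ {u} → u ∈ vs → ∀ w → lap E (λ x → R x u) w ≡ τ w - 2ℚ * ind u w
    ends   : Allᴸ (Within vs) E
    t∈     : t ∈ vs
    s∈     : s ∈ vs
    t≢s    : t ≢ s
    simple : Simple E

moments : Net → Moments
moments N = mom (sumL vs (λ _ → 1ℚ)) (R t s)
  (sumL vs (λ x → R x t - R x s))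
  (sumL vs (λ x → (R x t - R x s) * (R x t - R x s)))
  (2ℚ * sumL vs (λ x → R x t + R x s))
  (2ℚ * sumL vs (λ x → sumL vs (R x)))
  where open Net N

-- What keeps the edge list `Simple` when the edge between the marked vertices is added.
NonAdj : Net → Set
NonAdj N = mem (Net.E N) (Net.t N) (Net.s N) ≡ false

-- Resistances add in series at the cut vertex `t`.
extend : ℕ → ℕ → (ℕ → ℕ → ℚ) → ℕ → ℕ → ℚ
extend c t R x y =
  if x ≡ᵇ c then (if y ≡ᵇ c then 0ℚ else 1ℚ + R t y)
            else (if y ≡ᵇ c then 1ℚ + R x t else R x y)

module Extend (c t : ℕ) (R : ℕ → ℕ → ℚ) where
  R′ = extend c t R

  new-new : R′ c c ≡ 0ℚ
  new-new rewrite ≡ᵇ-refl c = refl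

  new-old : ∀ {y} → y ≢ c → R′ c y ≡ 1ℚ + R t y
  new-old y≢c rewrite ≡ᵇ-refl c | ≡ᵇ-≢ y≢c = refl

  old-new : ∀ {x} → x ≢ c → R′ x c ≡ 1ℚ + R x t
  old-new x≢c rewrite ≡ᵇ-refl c | ≡ᵇ-≢ x≢c = refl

  old-old : ∀ {x y} → x ≢ c → y ≢ c → R′ x y ≡ R x y
  old-old x≢c y≢c rewrite ≡ᵇ-≢ x≢c | ≡ᵇ-≢ y≢c = refl

  extend-sym : (∀ x y → R x y ≡ R y x) → ∀ x y → R′ x y ≡ R′ y x
  extend-sym h x y with x ≡ᵇ c | y ≡ᵇ c
  ... | true  | true  = refl
  ... | true  | false = cong (1ℚ +_) (h t y)
  ... | false | true  = cong (1ℚ +_) (h x t)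
  ... | false | false = h x y

  extend-diag : (∀ x → R x x ≡ 0ℚ) → ∀ x → R′ x x ≡ 0ℚ
  extend-diag h x with x ≡ᵇ c
  ... | true  = refl
  ... | false = h x

∈⇒≢ : ∀ {x c : ℕ} {vs} → c ∉ vs → x ∈ vs → x ≢ c
∈⇒≢ c∉ x∈ refl = c∉ x∈

-- The edge t₀s₀. Two vertices at resistance 1 make `size - (gap + 1)` zero, which removes the skew
-- of the first polygon from the result.
start : ∀ t s → t ≢ s → Net
start t s t≢s = record
  { vs = t ∷ s ∷ [] ; E = (t , s) ∷ [] ; R = R ; t = t ; s = s
  ; τ = λ w → ind t w + ind s w
  ; R-sym = λ x y → cong (λ b → if b then 0ℚ else 1ℚ) (≡ᵇ-sym x y)
  ; R-diag = R-diag
  ; R-lap = R-lap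
  ; ends = (here refl , there (here refl)) ∷ []
  ; t∈ = here refl ; s∈ = there (here refl) ; t≢s = t≢s
  ; simple = t≢s , refl , tt }
  where
  R : ℕ → ℕ → ℚ
  R x y = if x ≡ᵇ y then 0ℚ else 1ℚ
  ≡ᵇ-sym : ∀ x y → (x ≡ᵇ y) ≡ (y ≡ᵇ x)
  ≡ᵇ-sym zero    zero    = refl
  ≡ᵇ-sym zero    (suc y) = refl
  ≡ᵇ-sym (suc x) zero    = refl
  ≡ᵇ-sym (suc x) (suc y) = ≡ᵇ-sym x y
  R-diag : ∀ x → R x x ≡ 0ℚ
  R-diag x = cong (λ b → if b then 0ℚ else 1ℚ) (≡ᵇ-refl x)
  R-≢ : ∀ {x y} → x ≢ y → R x y ≡ 1ℚ
  R-≢ x≢y = cong (λ b → if b then 0ℚ else 1ℚ) (≡ᵇ-≢ x≢y)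
  at-t : ∀ p q → (p - q) * (0ℚ - 1ℚ) + 0ℚ ≡ p + q - (1ℚ + 1ℚ) * p
  at-t = solve-∀ ℚ-ring
  at-s : ∀ p q → (p - q) * (1ℚ - 0ℚ) + 0ℚ ≡ p + q - (1ℚ + 1ℚ) * q
  at-s = solve-∀ ℚ-ring
  R-lap : ∀ {u} → u ∈ t ∷ s ∷ [] → ∀ w →
    lap ((t , s) ∷ []) (λ x → R x u) w ≡ ind t w + ind s w - 2ℚ * ind u w
  R-lap (here refl) w = trans
    (cong₂ (λ x y → (ind t w - ind s w) * (x - y) + 0ℚ) (R-diag t) (R-≢ (≢-sym t≢s)))
    (at-t (ind t w) (ind s w))
  R-lap (there (here refl)) w = trans
    (cong₂ (λ x y → (ind t w - ind s w) * (x - y) + 0ℚ) (R-≢ t≢s) (R-diag s))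
    (at-s (ind t w) (ind s w))

start-Σψ : ∀ t s t≢s → Σψ (moments (start t s t≢s)) ≡ 0ℚ
start-Σψ t s t≢s
  rewrite ≡ᵇ-refl t | ≡ᵇ-refl s | ≡ᵇ-≢ t≢s | ≡ᵇ-≢ (≢-sym t≢s) = refl

start-gap : ∀ t s t≢s → gap (moments (start t s t≢s)) ≡ 1ℚ
start-gap t s t≢s = cong (λ b → if b then 0ℚ else 1ℚ) (≡ᵇ-≢ t≢s)

-- Reduces attaching at `s` to attaching at `t`.
flip : Net → Net
flip N = record
  { vs = vs ; E = E ; R = R ; t = s ; s = t ; τ = τ ; R-sym = R-sym ; R-diag = R-diag
  ; R-lap = R-lap ; ends = ends ; t∈ = s∈ ; s∈ = t∈ ; t≢s = ≢-sym t≢s ; simple = simple }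
  where open Net N

moments-flip : ∀ N → moments (flip N) ≡ flipM (moments N)
moments-flip N = mom-≡ refl (R-sym s t)
  (trans (sumL-cong vs (λ {x} _ → l₁ (R x s) (R x t)))
    (trans (sumL-lin vs (- 1ℚ) (λ x → R x t - R x s) 0ℚ (λ _ → 0ℚ) 0ℚ (λ _ → 0ℚ) 0ℚ)
      (l₂ (sumL vs (λ x → R x t - R x s)) (sumL vs (λ _ → 0ℚ)) (sumL vs (λ _ → 1ℚ)))))
  (sumL-cong vs (λ {x} _ → l₃ (R x s) (R x t)))
  (cong (2ℚ *_) (sumL-cong vs (λ {x} _ → +-comm (R x s) (R x t))))
  refl
  where
  open Net N
  l₁ : ∀ a b → a - b ≡ - 1ℚ * (b - a) + 0ℚ * 0ℚ + 0ℚ * 0ℚ + 0ℚ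
  l₁ = solve-∀ ℚ-ring
  l₂ : ∀ x y z → - 1ℚ * x + 0ℚ * y + 0ℚ * y + 0ℚ * z ≡ - x
  l₂ = solve-∀ ℚ-ring
  l₃ : ∀ a b → (a - b) * (a - b) ≡ (b - a) * (b - a)
  l₃ = solve-∀ ℚ-ring

-- Column `c` of the new matrix is column `t` shifted by a constant, which the Laplacian kills; an
-- old column gains a unit drop along the new edge. Both changes amount to the same correction
-- `- ind t + ind c` of `τ`.
pend : (N : Net) (c : ℕ) → c ∉ Net.vs N → Net
pend N c c∉ = record
  { vs = c ∷ vs ; E = (t , c) ∷ E ; R = R′ ; t = c ; s = s
  ; τ = λ w → τ w - ind t w + ind c w
  ; R-sym = extend-sym R-sym ; R-diag = extend-diag R-diag
  ; R-lap = R-lap′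
  ; ends = (there t∈ , here refl) ∷ Allᴸ.map (λ (a , b) → there a , there b) ends
  ; t∈ = here refl ; s∈ = there s∈ ; t≢s = ≢-sym (old s∈)
  ; simple = old t∈ , trans (mem-sym E t c) (mem-∉ E ends c∉) , simple }
  where
  open Net N
  open Extend c t R
  old : ∀ {x} → x ∈ vs → x ≢ c
  old = ∈⇒≢ c∉
  at-new : ∀ p q l k → l ≡ k - 2ℚ * p →
    (p - q) * (1ℚ + 0ℚ - 0ℚ) + l ≡ k - p + q - 2ℚ * q
  at-new p q _ k refl = ring p q k
    where
    ring : ∀ p q k → (p - q) * (1ℚ + 0ℚ - 0ℚ) + (k - (1ℚ + 1ℚ) * p) ≡ k - p + q - (1ℚ + 1ℚ) * q
    ring = solve-∀ ℚ-ring
  at-old : ∀ p q x k d → (p - q) * (x - (1ℚ + x)) + (k - d) ≡ k - p + q - d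
  at-old = solve-∀ ℚ-ring
  unit : ∀ x y → 1ℚ + x ≡ 1ℚ * x + 0ℚ * y + 0ℚ * y + 1ℚ
  unit = solve-∀ ℚ-ring
  scaled : ∀ x y → 1ℚ * x + 0ℚ * y + 0ℚ * y ≡ x
  scaled = solve-∀ ℚ-ring
  R-lap′ : ∀ {u} → u ∈ c ∷ vs → ∀ w →
    lap ((t , c) ∷ E) (λ x → R′ x u) w ≡ τ w - ind t w + ind c w - 2ℚ * ind u w
  R-lap′ (here refl) w = trans
    (cong₂ _+_
      (cong₂ (λ x y → (ind t w - ind c w) * (x - y))
        (trans (old-new (old t∈)) (cong (1ℚ +_) (R-diag t))) new-new)
      (trans (lap-cong E ends (λ {x} x∈ → trans (old-new (old x∈)) (unit (R x t) (R x t))) w)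
        (trans (lap-lin E 1ℚ (λ x → R x t) 0ℚ (λ x → R x t) 0ℚ (λ x → R x t) 1ℚ w)
          (scaled (lap E (λ x → R x t) w) (lap E (λ x → R x t) w)))))
    (at-new (ind t w) (ind c w) (lap E (λ x → R x t) w) (τ w) (R-lap t∈ w))
  R-lap′ {u} (there u∈) w = trans
    (cong₂ _+_
      (cong₂ (λ x y → (ind t w - ind c w) * (x - y))
        (old-old (old t∈) (old u∈)) (new-old (old u∈)))
      (trans (lap-cong E ends (λ x∈ → old-old (old x∈) (old u∈)) w) (R-lap u∈ w)))
    (at-old (ind t w) (ind c w) (R t u) (τ w) (2ℚ * ind u w))

pend-nonadj : ∀ N c c∉ → NonAdj (pend N c c∉)
pend-nonadj N c c∉ = cong₂ _∨_
  (cong₂ _∨_ (cong (_∧ (c ≡ᵇ s)) (≡ᵇ-≢ (∈⇒≢ c∉ t∈))) (cong (_∧ (c ≡ᵇ c)) (≡ᵇ-≢ t≢s)))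
  (mem-∉ E ends c∉)
  where open Net N

flip-nonadj : ∀ N → NonAdj N → NonAdj (flip N)
flip-nonadj N h = trans (mem-sym E s t) h
  where open Net N

-- The new row and column need the sum of `R x t` alone. It is recovered from `Σends` and `Σψ`: four
-- times it is `p + 2 x`.
moments-pend : ∀ N c c∉ → moments (pend N c c∉) ≡ pendM 1ℚ (moments N)
moments-pend N c c∉ = mom-≡ (+-comm 1ℚ n)
  (trans (new-old (old s∈)) (+-comm 1ℚ a))
  (trans (cong₂ _+_ (cong₂ _-_ new-new (new-old (old s∈)))
      (trans (sumL-cong vs (λ {x} x∈ → trans
          (cong₂ _-_ (old-new (old x∈)) (old-old (old x∈) (old s∈)))
          (p₁ (R x t) (R x s))))
        (sumL-lin vs 1ℚ (λ x → R x t) (- 1ℚ) (λ x → R x s) 0ℚ (λ x → R x s) 1ℚ)))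
    (trans (l₁ a St Ss n) (cong (λ y → y + 1ℚ * (n - (a + 1ℚ))) (sym x-split))))
  (trans (cong₂ _+_ (cong₂ (λ x y → (x - y) * (x - y)) new-new (new-old (old s∈)))
      (trans (sumL-cong vs (λ {x} x∈ → trans
          (cong₂ (λ y z → (y - z) * (y - z)) (old-new (old x∈)) (old-old (old x∈) (old s∈)))
          (p₂ (R x t) (R x s))))
        (sumL-lin vs 1ℚ (λ x → (R x t - R x s) * (R x t - R x s)) 2ℚ (λ x → R x t - R x s)
          0ℚ (λ x → R x s) 1ℚ)))
    (l₂ a Q X Ss n))
  (trans (cong (2ℚ *_) (cong₂ _+_ (cong₂ _+_ new-new (new-old (old s∈)))
      (trans (sumL-cong vs (λ {x} x∈ → trans
          (cong₂ _+_ (old-new (old x∈)) (old-old (old x∈) (old s∈)))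
          (p₃ (R x t) (R x s))))
        (sumL-lin vs 1ℚ (λ x → R x t + R x s) 0ℚ (λ x → R x s) 0ℚ (λ x → R x s) 1ℚ))))
    (l₃ a Sts Ss n))
  (trans (cong (2ℚ *_) (cong₂ _+_
      (cong₂ _+_ new-new (trans (sumL-cong vs (λ {y} y∈ → trans (new-old (old y∈))
          (trans (cong (1ℚ +_) (R-sym t y)) (p₄ (R y t)))))
        (sumL-lin vs 1ℚ (λ x → R x t) 0ℚ (λ x → R x t) 0ℚ (λ x → R x t) 1ℚ)))
      (trans (sumL-cong vs (λ {x} x∈ → trans
          (cong₂ _+_ (old-new (old x∈))
            (sumL-cong vs (λ y∈ → old-old (old x∈) (old y∈))))
          (p₅ (R x t) (sumL vs (R x)))))
        (sumL-lin vs 1ℚ (λ x → R x t) 1ℚ (λ x → sumL vs (R x)) 0ℚ (λ x → R x t) 1ℚ))))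
    (trans (l₄ St Ss n (sumL vs (λ x → sumL vs (R x))))
      (cong₂ (λ P X → 2ℚ * sumL vs (λ x → sumL vs (R x)) + 4ℚ * n + 2ℚ * P + 2ℚ * (1ℚ * X))
        (sym p-split) (sym x-split))))
  where
  open Net N
  open Extend c t R
  n = sumL vs (λ _ → 1ℚ)
  a = R t s
  St = sumL vs (λ x → R x t)
  Ss = sumL vs (λ x → R x s)
  Sts = sumL vs (λ x → R x t + R x s)
  X = sumL vs (λ x → R x t - R x s)
  Q = sumL vs (λ x → (R x t - R x s) * (R x t - R x s))
  old : ∀ {x} → x ∈ vs → x ≢ c
  old = ∈⇒≢ c∉
  x₁ : ∀ p q → p - q ≡ 1ℚ * p + - 1ℚ * q + 0ℚ * q + 0ℚ
  x₁ = solve-∀ ℚ-ring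
  x₂ : ∀ p q n → 1ℚ * p + - 1ℚ * q + 0ℚ * q + 0ℚ * n ≡ p - q
  x₂ = solve-∀ ℚ-ring
  x-split : X ≡ St - Ss
  x-split = trans (sumL-cong vs (λ {x} _ → x₁ (R x t) (R x s)))
    (trans (sumL-lin vs 1ℚ (λ x → R x t) (- 1ℚ) (λ x → R x s) 0ℚ (λ x → R x s) 0ℚ)
      (x₂ St Ss n))
  y₁ : ∀ p q → p + q ≡ 1ℚ * p + 1ℚ * q + 0ℚ * q + 0ℚ
  y₁ = solve-∀ ℚ-ring
  y₂ : ∀ p q n → 1ℚ * p + 1ℚ * q + 0ℚ * q + 0ℚ * n ≡ p + q
  y₂ = solve-∀ ℚ-ring
  p-split : Sts ≡ St + Ss
  p-split = trans (sumL-cong vs (λ {x} _ → y₁ (R x t) (R x s)))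
    (trans (sumL-lin vs 1ℚ (λ x → R x t) 1ℚ (λ x → R x s) 0ℚ (λ x → R x s) 0ℚ)
      (y₂ St Ss n))
  p₁ : ∀ p q → 1ℚ + p - q ≡ 1ℚ * p + - 1ℚ * q + 0ℚ * q + 1ℚ
  p₁ = solve-∀ ℚ-ring
  p₂ : ∀ p q → (1ℚ + p - q) * (1ℚ + p - q)
    ≡ 1ℚ * ((p - q) * (p - q)) + (1ℚ + 1ℚ) * (p - q) + 0ℚ * q + 1ℚ
  p₂ = solve-∀ ℚ-ring
  p₃ : ∀ p q → 1ℚ + p + q ≡ 1ℚ * (p + q) + 0ℚ * q + 0ℚ * q + 1ℚ
  p₃ = solve-∀ ℚ-ring
  p₄ : ∀ p → 1ℚ + p ≡ 1ℚ * p + 0ℚ * p + 0ℚ * p + 1ℚ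
  p₄ = solve-∀ ℚ-ring
  p₅ : ∀ p S → 1ℚ + p + S ≡ 1ℚ * p + 1ℚ * S + 0ℚ * p + 1ℚ
  p₅ = solve-∀ ℚ-ring
  l₁ : ∀ a p q n → 0ℚ - (1ℚ + a) + (1ℚ * p + - 1ℚ * q + 0ℚ * q + 1ℚ * n)
    ≡ p - q + 1ℚ * (n - (a + 1ℚ))
  l₁ = solve-∀ ℚ-ring
  l₂ : ∀ a Q X q n → (0ℚ - (1ℚ + a)) * (0ℚ - (1ℚ + a))
      + (1ℚ * Q + (1ℚ + 1ℚ) * X + 0ℚ * q + 1ℚ * n)
    ≡ Q + (1ℚ + 1ℚ) * (1ℚ * X) + n + (a + 1ℚ) * (a + 1ℚ)
  l₂ = solve-∀ ℚ-ring
  l₃ : ∀ a S q n →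
    (1ℚ + 1ℚ) * (0ℚ + (1ℚ + a) + (1ℚ * S + 0ℚ * q + 0ℚ * q + 1ℚ * n))
    ≡ (1ℚ + 1ℚ) * S + (1ℚ + 1ℚ) * n + (1ℚ + 1ℚ) * (a + 1ℚ)
  l₃ = solve-∀ ℚ-ring
  l₄ : ∀ p q n S → (1ℚ + 1ℚ) * (0ℚ + (1ℚ * p + 0ℚ * p + 0ℚ * p + 1ℚ * n)
      + (1ℚ * p + 1ℚ * S + 0ℚ * p + 1ℚ * n))
    ≡ (1ℚ + 1ℚ) * S + (1ℚ + 1ℚ + (1ℚ + 1ℚ)) * n + (1ℚ + 1ℚ) * (p + q)
      + (1ℚ + 1ℚ) * (1ℚ * (p - q))
  l₄ = solve-∀ ℚ-ring

-- Adding a unit resistor between the marked vertices is a rank-one update of R.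
module Close (N : Net) (κ : ℚ) (κ-spec : 4ℚ * κ * (1ℚ + Net.R N (Net.t N) (Net.s N)) ≡ 1ℚ) where
  open Net N

  a : ℚ
  a = R t s

  ψ : ℕ → ℚ
  ψ x = R x t - R x s

  -- Sherman-Morrison: `- ψ / 2` is, up to a constant, the potential of a unit current from `t` to
  -- `s`. The resistance between `x` and `y` falls by the squared potential drop divided by `1 + a`,
  -- hence `κ = 1 / (4 (1 + a))`.
  R′ : ℕ → ℕ → ℚ
  R′ x y = R x y - κ * ((ψ x - ψ y) * (ψ x - ψ y))

  ψt : ψ t ≡ 0ℚ - a
  ψt = cong (_- a) (R-diag t)

  ψs : ψ s ≡ a - 0ℚ
  ψs = cong₂ _-_ (R-sym s t) (R-diag s)

  R′-sym : ∀ x y → R′ x y ≡ R′ y x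
  R′-sym x y = trans (cong (λ r → r - κ * ((ψ x - ψ y) * (ψ x - ψ y))) (R-sym x y))
    (l (R y x) κ (ψ x) (ψ y))
    where
    l : ∀ r k p q → r - k * ((p - q) * (p - q)) ≡ r - k * ((q - p) * (q - p))
    l = solve-∀ ℚ-ring

  R′-diag : ∀ x → R′ x x ≡ 0ℚ
  R′-diag x = trans (cong (λ r → r - κ * ((ψ x - ψ x) * (ψ x - ψ x))) (R-diag x)) (l κ (ψ x))
    where
    l : ∀ k p → 0ℚ - k * ((p - p) * (p - p)) ≡ 0ℚ
    l = solve-∀ ℚ-ring

  -- Ring identities cannot use `κ-spec`; they leave a multiple of `4 κ (1 + a) - 1` to be discarded
  -- here.
  residual : ∀ y z → y + z * (4ℚ * κ * (1ℚ + a) - 1ℚ) ≡ y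
  residual y z = trans (cong (λ h → y + z * (h - 1ℚ)) κ-spec) (l y z)
    where
    l : ∀ y z → y + z * (1ℚ - 1ℚ) ≡ y
    l = solve-∀ ℚ-ring

  -- In the expanded square, `ψ x * ψ x` does not depend on `u` and is absorbed into `τ`,
  -- `ψ u * ψ u` is constant in `x`, and the Laplacian of the cross term cancels the current through
  -- the new resistor.
  R′-lap : ∀ {u} → u ∈ vs → ∀ w → lap ((t , s) ∷ E) (λ x → R′ x u) w
    ≡ τ w - κ * lap E (λ x → ψ x * ψ x) w - 2ℚ * ind u w
  R′-lap {u} u∈ w = trans
    (cong₂ (λ x y → (ind t w - ind s w) * x + y)
      (cong₂ _-_
        (cong₂ (λ r p → r - κ * ((p - ψ u) * (p - ψ u))) (R-sym t u) ψt)
        (cong₂ (λ r p → r - κ * ((p - ψ u) * (p - ψ u))) (R-sym s u) ψs))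
      (trans (lap-cong E ends (λ {x} _ → expand (R x u) κ (ψ x) (ψ u)) w)
        (trans (lap-lin E 1ℚ (λ x → R x u) (- κ) (λ x → ψ x * ψ x) (2ℚ * κ * ψ u) ψ
            (- κ * (ψ u * ψ u)) w)
          (cong₂ (λ x y → 1ℚ * x + - κ * lap E (λ x → ψ x * ψ x) w + 2ℚ * κ * ψ u * y)
            (R-lap u∈ w) lap-ψ))))
    (trans (combine (ind t w) (ind s w) (ind u w) (R u t) (R u s) κ a (τ w)
        (lap E (λ x → ψ x * ψ x) w))
      (residual (τ w - κ * lap E (λ x → ψ x * ψ x) w - 2ℚ * ind u w)
        (- ((ind t w - ind s w) * ψ u))))
    where
    expand : ∀ r k p q → r - k * ((p - q) * (p - q))
      ≡ 1ℚ * r + - k * (p * p) + (1ℚ + 1ℚ) * k * q * p + - k * (q * q)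
    expand = solve-∀ ℚ-ring
    l₁ : ∀ p q → p - q ≡ 1ℚ * p + - 1ℚ * q + 0ℚ * q + 0ℚ
    l₁ = solve-∀ ℚ-ring
    l₂ : ∀ k p q r → 1ℚ * (k - (1ℚ + 1ℚ) * p) + - 1ℚ * (k - (1ℚ + 1ℚ) * q) + 0ℚ * r
      ≡ (1ℚ + 1ℚ) * (q - p)
    l₂ = solve-∀ ℚ-ring
    lap-ψ : lap E ψ w ≡ 2ℚ * (ind s w - ind t w)
    lap-ψ = trans (lap-cong E ends (λ {x} _ → l₁ (R x t) (R x s)) w)
      (trans (lap-lin E 1ℚ (λ x → R x t) (- 1ℚ) (λ x → R x s) 0ℚ (λ x → R x s) 0ℚ w)
        (trans (cong₂ (λ x y → 1ℚ * x + - 1ℚ * y + 0ℚ * lap E (λ x → R x s) w)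
            (R-lap t∈ w) (R-lap s∈ w))
          (l₂ (τ w) (ind t w) (ind s w) (lap E (λ x → R x s) w))))
    combine : ∀ p q d x y k a T L →
      (p - q) * (x - k * ((0ℚ - a - (x - y)) * (0ℚ - a - (x - y)))
          - (y - k * ((a - 0ℚ - (x - y)) * (a - 0ℚ - (x - y)))))
        + (1ℚ * (T - (1ℚ + 1ℚ) * d) + - k * L
           + (1ℚ + 1ℚ) * k * (x - y) * ((1ℚ + 1ℚ) * (q - p)))
      ≡ T - k * L - (1ℚ + 1ℚ) * d
        + - ((p - q) * (x - y)) * ((1ℚ + 1ℚ + (1ℚ + 1ℚ)) * k * (1ℚ + a) - 1ℚ)
    combine = solve-∀ ℚ-ring

  close : NonAdj N → Net
  close nonadj = record
    { vs = vs ; E = (t , s) ∷ E ; R = R′ ; t = t ; s = s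
    ; τ = λ w → τ w - κ * lap E (λ x → ψ x * ψ x) w
    ; R-sym = R′-sym ; R-diag = R′-diag ; R-lap = R′-lap
    ; ends = (t∈ , s∈) ∷ ends ; t∈ = t∈ ; s∈ = s∈ ; t≢s = t≢s
    ; simple = t≢s , nonadj , simple }

  private
    n = sumL vs (λ _ → 1ℚ)
    X = sumL vs ψ
    Q = sumL vs (λ x → ψ x * ψ x)
    S = sumL vs (λ x → R x t + R x s)
    ΣR = sumL vs (λ x → sumL vs (R x))

  -- As `ψ` is `- a` at `t` and `a` at `s`, the two squares differ by `4 a ψ x`, and
  -- `1 - 4 κ a = 4 κ`.
  ψ′-scale : ∀ x → R′ x t - R′ x s ≡ 4ℚ * κ * ψ x
  ψ′-scale x = trans
    (cong₂ (λ p q → R x t - κ * ((ψ x - p) * (ψ x - p)) - (R x s - κ * ((ψ x - q) * (ψ x - q)))) ψt ψs)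
    (trans (l (R x t) (R x s) κ a) (residual (4ℚ * κ * ψ x) (- ψ x)))
    where
    l : ∀ x y k a → x - k * ((x - y - (0ℚ - a)) * (x - y - (0ℚ - a)))
        - (y - k * ((x - y - (a - 0ℚ)) * (x - y - (a - 0ℚ))))
      ≡ (1ℚ + 1ℚ + (1ℚ + 1ℚ)) * k * (x - y)
        + - (x - y) * ((1ℚ + 1ℚ + (1ℚ + 1ℚ)) * k * (1ℚ + a) - 1ℚ)
    l = solve-∀ ℚ-ring

  moments-close : ∀ nonadj → moments (close nonadj) ≡ mom n (4ℚ * κ * a) (4ℚ * κ * X)
    (4ℚ * κ * (4ℚ * κ) * Q) (2ℚ * S - 4ℚ * κ * (Q + n * (a * a)))
    (2ℚ * ΣR - 4ℚ * κ * (n * Q - X * X))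
  moments-close nonadj = mom-≡ refl
    (trans (cong₂ (λ p q → a - κ * ((p - q) * (p - q))) ψt ψs)
      (trans (g₁ κ a) (residual (4ℚ * κ * a) (- a))))
    (trans (sumL-cong vs (λ {x} _ → trans (ψ′-scale x) (u₁ κ (ψ x))))
      (trans (sumL-lin vs (4ℚ * κ) ψ 0ℚ ψ 0ℚ ψ 0ℚ) (l₁ κ X n)))
    (trans (sumL-cong vs (λ {x} _ → trans (cong (λ p → p * p) (ψ′-scale x)) (u₂ κ (ψ x))))
      (trans (sumL-lin vs (4ℚ * κ * (4ℚ * κ)) (λ x → ψ x * ψ x) 0ℚ ψ 0ℚ ψ 0ℚ)
        (l₂ κ Q X n)))
    (trans (cong (2ℚ *_) (trans (sumL-cong vs (λ {x} _ → trans
          (cong₂ (λ p q → R x t - κ * ((ψ x - p) * (ψ x - p)) + (R x s - κ * ((ψ x - q) * (ψ x - q)))) ψt ψs)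
          (u₃ κ a (R x t) (R x s))))
        (sumL-lin vs 1ℚ (λ x → R x t + R x s) (- (2ℚ * κ)) (λ x → ψ x * ψ x) 0ℚ ψ
          (- (2ℚ * κ) * (a * a)))))
      (l₃ κ a S Q X n))
    (trans (cong (2ℚ *_) (trans (sumL-cong vs (λ {x} _ → trans
          (trans (sumL-cong vs (λ {y} _ → u₄ κ (R x y) (ψ x) (ψ y)))
            (sumL-lin vs 1ℚ (R x) (2ℚ * κ * ψ x) ψ (- κ) (λ y → ψ y * ψ y) (- κ * (ψ x * ψ x))))
          (u₅ κ (sumL vs (R x)) (ψ x) X Q n)))
        (sumL-lin vs 1ℚ (λ x → sumL vs (R x)) (2ℚ * κ * X) ψ (- κ * n) (λ x → ψ x * ψ x) (- κ * Q))))
      (l₅ κ ΣR X Q n))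
    where
    g₁ : ∀ k a → a - k * ((0ℚ - a - (a - 0ℚ)) * (0ℚ - a - (a - 0ℚ)))
      ≡ (1ℚ + 1ℚ + (1ℚ + 1ℚ)) * k * a
        + - a * ((1ℚ + 1ℚ + (1ℚ + 1ℚ)) * k * (1ℚ + a) - 1ℚ)
    g₁ = solve-∀ ℚ-ring
    u₁ : ∀ k p → (1ℚ + 1ℚ + (1ℚ + 1ℚ)) * k * p
      ≡ (1ℚ + 1ℚ + (1ℚ + 1ℚ)) * k * p + 0ℚ * p + 0ℚ * p + 0ℚ
    u₁ = solve-∀ ℚ-ring
    l₁ : ∀ k X n → (1ℚ + 1ℚ + (1ℚ + 1ℚ)) * k * X + 0ℚ * X + 0ℚ * X + 0ℚ * n
      ≡ (1ℚ + 1ℚ + (1ℚ + 1ℚ)) * k * X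
    l₁ = solve-∀ ℚ-ring
    u₂ : ∀ k p → (1ℚ + 1ℚ + (1ℚ + 1ℚ)) * k * p * ((1ℚ + 1ℚ + (1ℚ + 1ℚ)) * k * p)
      ≡ (1ℚ + 1ℚ + (1ℚ + 1ℚ)) * k * ((1ℚ + 1ℚ + (1ℚ + 1ℚ)) * k) * (p * p)
        + 0ℚ * p + 0ℚ * p + 0ℚ
    u₂ = solve-∀ ℚ-ring
    l₂ : ∀ k Q X n →
      (1ℚ + 1ℚ + (1ℚ + 1ℚ)) * k * ((1ℚ + 1ℚ + (1ℚ + 1ℚ)) * k) * Q
        + 0ℚ * X + 0ℚ * X + 0ℚ * n
      ≡ (1ℚ + 1ℚ + (1ℚ + 1ℚ)) * k * ((1ℚ + 1ℚ + (1ℚ + 1ℚ)) * k) * Q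
    l₂ = solve-∀ ℚ-ring
    u₃ : ∀ k a x y → x - k * ((x - y - (0ℚ - a)) * (x - y - (0ℚ - a)))
        + (y - k * ((x - y - (a - 0ℚ)) * (x - y - (a - 0ℚ))))
      ≡ 1ℚ * (x + y) + - ((1ℚ + 1ℚ) * k) * ((x - y) * (x - y)) + 0ℚ * (x - y)
        + - ((1ℚ + 1ℚ) * k) * (a * a)
    u₃ = solve-∀ ℚ-ring
    l₃ : ∀ k a S Q X n → (1ℚ + 1ℚ) * (1ℚ * S + - ((1ℚ + 1ℚ) * k) * Q + 0ℚ * X
        + - ((1ℚ + 1ℚ) * k) * (a * a) * n)
      ≡ (1ℚ + 1ℚ) * S - (1ℚ + 1ℚ + (1ℚ + 1ℚ)) * k * (Q + n * (a * a))
    l₃ = solve-∀ ℚ-ring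
    u₄ : ∀ k r p q → r - k * ((p - q) * (p - q))
      ≡ 1ℚ * r + (1ℚ + 1ℚ) * k * p * q + - k * (q * q) + - k * (p * p)
    u₄ = solve-∀ ℚ-ring
    u₅ : ∀ k r p X Q n → 1ℚ * r + (1ℚ + 1ℚ) * k * p * X + - k * Q + - k * (p * p) * n
      ≡ 1ℚ * r + (1ℚ + 1ℚ) * k * X * p + - k * n * (p * p) + - k * Q
    u₅ = solve-∀ ℚ-ring
    l₅ : ∀ k T X Q n → (1ℚ + 1ℚ) * (1ℚ * T + (1ℚ + 1ℚ) * k * X * X + - k * n * Q + - k * Q * n)
      ≡ (1ℚ + 1ℚ) * T - (1ℚ + 1ℚ + (1ℚ + 1ℚ)) * k * (n * Q - X * X)
    l₅ = solve-∀ ℚ-ring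

module _ (N : Net) (a≥0 : 0ℚ ≤ℚ gap (moments N)) where
  private
    i : ℚ
    i = recip (1ℚ + gap (moments N))
    ¼ : ℚ
    ¼ = ½ * ½
    4κ≡i : 4ℚ * (i * ¼) ≡ i
    4κ≡i = trans (l i ¼) (trans (cong (i *_) {4ℚ * ¼} {1ℚ} refl) (*-identityʳ i))
      where
      l : ∀ i q → (1ℚ + 1ℚ + (1ℚ + 1ℚ)) * (i * q) ≡ i * ((1ℚ + 1ℚ + (1ℚ + 1ℚ)) * q)
      l = solve-∀ ℚ-ring
    module C = Close N (i * ¼)
      (trans (cong (_* (1ℚ + gap (moments N))) 4κ≡i) (recip-inverse (+-pos-nonneg 0<1 a≥0)))

  close : NonAdj N → Net
  close = C.close

  moments-close : ∀ nonadj → moments (close nonadj) ≡ closeM (moments N)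
  moments-close nonadj = trans (C.moments-close nonadj)
    (cong (λ i → mom (size M) (i * gap M) (i * Σψ M) (i * i * Σψ² M)
      (Σends M - i * (Σψ² M + size M * (gap M * gap M)))
      (total M - i * (size M * Σψ² M - Σψ M * Σψ M))) 4κ≡i)
    where M = moments N

-- Sums over `Fin` and the Laplacian of an adjacency relation

sumFin≡sum : ∀ {n} (f : Fin n → ℚ) → sumFin f ≡ Σ-Props.sum f
sumFin≡sum {zero}  f = refl
sumFin≡sum {suc n} f = cong (f zero +_) (sumFin≡sum (f ∘ suc))

sumFin-cong : ∀ {n} {f g : Fin n → ℚ} → (∀ i → f i ≡ g i) → sumFin f ≡ sumFin g
sumFin-cong {zero}  h = refl
sumFin-cong {suc n} h = cong₂ _+_ (h zero) (sumFin-cong (h ∘ suc))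

sumFin-lin : ∀ {n} α (f : Fin n → ℚ) β g →
  sumFin (λ i → α * f i + β * g i) ≡ α * sumFin f + β * sumFin g
sumFin-lin {zero}  α f β g = l α β
  where
  l : ∀ α β → 0ℚ ≡ α * 0ℚ + β * 0ℚ
  l = solve-∀ ℚ-ring
sumFin-lin {suc n} α f β g = trans
  (cong (α * f zero + β * g zero +_) (sumFin-lin α (f ∘ suc) β (g ∘ suc)))
  (l α (f zero) (sumFin (f ∘ suc)) β (g zero) (sumFin (g ∘ suc)))
  where
  l : ∀ α f F β g G → α * f + β * g + (α * F + β * G) ≡ α * (f + F) + β * (g + G)
  l = solve-∀ ℚ-ring

sumFin-+ : ∀ {n} (f g : Fin n → ℚ) → sumFin (λ i → f i + g i) ≡ sumFin f + sumFin g
sumFin-+ f g = trans (sumFin-cong (λ i → cong₂ _+_ (sym (*-identityˡ (f i))) (sym (*-identityˡ (g i)))))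
  (trans (sumFin-lin 1ℚ f 1ℚ g) (cong₂ _+_ (*-identityˡ (sumFin f)) (*-identityˡ (sumFin g))))

sumFin-swap : ∀ {m n} (f : Fin m → Fin n → ℚ) →
  sumFin (λ i → sumFin (f i)) ≡ sumFin (λ j → sumFin (λ i → f i j))
sumFin-swap f = trans (double f) (trans (Σ-Props.∑-comm f) (sym (double (λ j i → f i j))))
  where
  double : ∀ {m n} (f : Fin m → Fin n → ℚ) →
    sumFin (λ i → sumFin (f i)) ≡ Σ-Props.sum (λ i → Σ-Props.sum (f i))
  double f = trans (sumFin-cong (λ i → sumFin≡sum (f i))) (sumFin≡sum (λ i → Σ-Props.sum (f i)))

sumFin-permute : ∀ {m n} (π : Fin m ↔ Fin n) (f : Fin n → ℚ) →
  sumFin f ≡ sumFin (f ∘ Inverse.to π)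
sumFin-permute π f = trans (sumFin≡sum f)
  (trans (Σ-Props.sum-permute f π) (sym (sumFin≡sum (f ∘ Inverse.to π))))

sumFin-zero : ∀ n → sumFin {n} (λ _ → 0ℚ) ≡ 0ℚ
sumFin-zero zero    = refl
sumFin-zero (suc n) = trans (+-identityˡ (sumFin {n} (λ _ → 0ℚ))) (sumFin-zero n)

sumFin-ind : ∀ {n a} → a < n → sumFin {n} (λ z → ind a (toℕ z)) ≡ 1ℚ
sumFin-ind {suc n} {zero}  _   = trans (cong (1ℚ +_) (sumFin-zero n)) (+-identityʳ 1ℚ)
sumFin-ind {suc n} {suc a} a<n = trans (+-identityˡ (sumFin {n} (λ z → ind a (toℕ z))))
  (sumFin-ind (s<s⁻¹ a<n))

sumFin-ind-≥ : ∀ {n a} → n ≤ a → sumFin {n} (λ z → ind a (toℕ z)) ≡ 0ℚ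
sumFin-ind-≥ {n} {a} n≤a = trans
  (sumFin-cong {n} (λ z → ind-≢ λ a≡z → ℕₚ.<-irrefl (sym a≡z) (ℕₚ.<-≤-trans (toℕ<n z) n≤a)))
  (sumFin-zero n)

δ≡ind : ∀ {n} (u w : Fin n) → δ u w ≡ ind (toℕ u) (toℕ w)
δ≡ind u w with u ≟F w
... | yes refl = sym (ind-refl (toℕ u))
... | no u≢w   = sym (ind-≢ (u≢w ∘ toℕ-injective))

sumFin-δ : ∀ {n} (y : Fin n → ℚ) u → sumFin (λ w → y w * δ u w) ≡ y u
sumFin-δ {n} y u = trans (sumFin-cong (λ w → trans (localise w) (l (y u) (ind (toℕ u) (toℕ w)))))
  (trans (sumFin-lin {n} (y u) (λ w → ind (toℕ u) (toℕ w)) 0ℚ (λ w → ind (toℕ u) (toℕ w)))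
    (trans (cong (λ t → y u * t + 0ℚ * t) (sumFin-ind (toℕ<n u))) (l′ (y u))))
  where
  localise : ∀ w → y w * δ u w ≡ y u * ind (toℕ u) (toℕ w)
  localise w with u ≟F w
  ... | yes refl = cong (y u *_) (sym (ind-refl (toℕ u)))
  ... | no u≢w   = trans (*-zeroʳ (y w)) (sym (trans
    (cong (y u *_) (ind-≢ (u≢w ∘ toℕ-injective))) (*-zeroʳ (y u))))
  l : ∀ y i → y * i ≡ y * i + 0ℚ * i
  l = solve-∀ ℚ-ring
  l′ : ∀ y → y * 1ℚ + 0ℚ * 1ℚ ≡ y
  l′ = solve-∀ ℚ-ring

-- Makes adjacency linear in indicators of `z`, ready for summation. The two products are never both
-- nonzero, since `a ≢ b`.
edge-term : ∀ (f : ℕ → ℚ) {a b} → a ≢ b → ∀ w z →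
  (if joins w z (a , b) then f w - f z else 0ℚ)
  ≡ (ind a w * (f a - f b)) * ind b z + (ind b w * (f b - f a)) * ind a z
edge-term f {a} {b} a≢b w z = cases (a ≡ᵇ w) refl (b ≡ᵇ z) refl (a ≡ᵇ z) refl (b ≡ᵇ w) refl
  where
  l₀ : ∀ p q → 0ℚ ≡ 0ℚ * p * 0ℚ + 0ℚ * q * 0ℚ
  l₀ = solve-∀ ℚ-ring
  l₁ : ∀ p q → 0ℚ ≡ 0ℚ * p * 0ℚ + 0ℚ * q * 1ℚ
  l₁ = solve-∀ ℚ-ring
  l₂ : ∀ p q → 0ℚ ≡ 0ℚ * p * 1ℚ + 0ℚ * q * 0ℚ
  l₂ = solve-∀ ℚ-ring
  l₃ : ∀ p q → 0ℚ ≡ 0ℚ * p * 0ℚ + 1ℚ * q * 0ℚ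
  l₃ = solve-∀ ℚ-ring
  l₄ : ∀ p q → 0ℚ ≡ 1ℚ * p * 0ℚ + 0ℚ * q * 0ℚ
  l₄ = solve-∀ ℚ-ring
  r₁ : ∀ p q → p - q ≡ 1ℚ * (p - q) * 1ℚ + 0ℚ * (q - p) * 0ℚ
  r₁ = solve-∀ ℚ-ring
  r₂ : ∀ p q → q - p ≡ 0ℚ * (p - q) * 0ℚ + 1ℚ * (q - p) * 1ℚ
  r₂ = solve-∀ ℚ-ring
  val : Bool → ℚ
  val b = if b then 1ℚ else 0ℚ
  cases : ∀ aw → (a ≡ᵇ w) ≡ aw → ∀ bz → (b ≡ᵇ z) ≡ bz → ∀ az → (a ≡ᵇ z) ≡ az →
    ∀ bw → (b ≡ᵇ w) ≡ bw →
    (if (aw ∧ bz) ∨ (az ∧ bw) then f w - f z else 0ℚ)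
    ≡ (val aw * (f a - f b)) * val bz + (val bw * (f b - f a)) * val az
  cases true p _ _ _ _ true q = contradiction (trans (≡ᵇ-true p) (sym (≡ᵇ-true q))) a≢b
  cases _ _ true p true q _ _ = contradiction (trans (≡ᵇ-true q) (sym (≡ᵇ-true p))) a≢b
  cases true p true q false _ false _ =
    trans (cong₂ (λ x y → f x - f y) (sym (≡ᵇ-true p)) (sym (≡ᵇ-true q))) (r₁ (f a) (f b))
  cases false _ false _ true p true q =
    trans (cong₂ (λ x y → f x - f y) (sym (≡ᵇ-true q)) (sym (≡ᵇ-true p))) (r₂ (f a) (f b))
  cases true _ false _ true _ false _ = l₅ (f a - f b) (f b - f a)
    where
    l₅ : ∀ p q → 0ℚ ≡ 1ℚ * p * 0ℚ + 0ℚ * q * 1ℚ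
    l₅ = solve-∀ ℚ-ring
  cases true _ false _ false _ false _ = l₄ (f a - f b) (f b - f a)
  cases false _ true _ false _ true _ = l₆ (f a - f b) (f b - f a)
    where
    l₆ : ∀ p q → 0ℚ ≡ 0ℚ * p * 1ℚ + 1ℚ * q * 0ℚ
    l₆ = solve-∀ ℚ-ring
  cases false _ true _ false _ false _ = l₂ (f a - f b) (f b - f a)
  cases false _ false _ true _ false _ = l₁ (f a - f b) (f b - f a)
  cases false _ false _ false _ true _ = l₃ (f a - f b) (f b - f a)
  cases false _ false _ false _ false _ = l₀ (f a - f b) (f b - f a)

-- A pair joined by the head of a `Simple` list is not joined by its tail, so the Boolean
-- disjunction splits into a sum.
laplacian-mem : ∀ {n} E → Simple E → Allᴸ (λ e → proj₁ e < n × proj₂ e < n) E →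
  ∀ (f : ℕ → ℚ) (w : Fin n) →
  sumFin {n} (λ z → if mem E (toℕ w) (toℕ z) then f (toℕ w) - f (toℕ z) else 0ℚ)
  ≡ lap E f (toℕ w)
laplacian-mem {n} []            _                       _                     f w = sumFin-zero n
laplacian-mem {n} ((a , b) ∷ E) (a≢b , fresh , simple) ((a<n , b<n) ∷ bounds) f w = trans
  (sumFin-cong {n} (λ z → split (toℕ w) (toℕ z)))
  (trans (sumFin-+ {n} (λ z → if joins (toℕ w) (toℕ z) (a , b) then f (toℕ w) - f (toℕ z) else 0ℚ)
                   (λ z → if mem E (toℕ w) (toℕ z) then f (toℕ w) - f (toℕ z) else 0ℚ))
    (cong₂ _+_
      (trans (sumFin-cong {n} (λ z → edge-term f a≢b (toℕ w) (toℕ z)))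
        (trans (sumFin-lin {n} (ind a (toℕ w) * (f a - f b)) (λ z → ind b (toℕ z))
                           (ind b (toℕ w) * (f b - f a)) (λ z → ind a (toℕ z)))
          (trans (cong₂ (λ x y → ind a (toℕ w) * (f a - f b) * x + ind b (toℕ w) * (f b - f a) * y)
                    (sumFin-ind b<n) (sumFin-ind a<n))
            (l (ind a (toℕ w)) (ind b (toℕ w)) (f a) (f b)))))
      (laplacian-mem E simple bounds f w)))
  where
  l : ∀ p q x y → p * (x - y) * 1ℚ + q * (y - x) * 1ℚ ≡ (p - q) * (x - y)
  l = solve-∀ ℚ-ring
  disjoint : ∀ u v → joins u v (a , b) ≡ true → mem E u v ≡ false
  disjoint u v j with joins-true a b j
  ... | inj₁ (refl , refl) = fresh
  ... | inj₂ (refl , refl) = trans (mem-sym E b a) fresh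
  split : ∀ u v → (if joins u v (a , b) ∨ mem E u v then f u - f v else 0ℚ)
    ≡ (if joins u v (a , b) then f u - f v else 0ℚ) + (if mem E u v then f u - f v else 0ℚ)
  split u v = cases (joins u v (a , b)) refl
    where
    cases : ∀ j → joins u v (a , b) ≡ j → (if j ∨ mem E u v then f u - f v else 0ℚ)
      ≡ (if j then f u - f v else 0ℚ) + (if mem E u v then f u - f v else 0ℚ)
    cases true  j = sym (trans
      (cong (λ b → f u - f v + (if b then f u - f v else 0ℚ)) (disjoint u v j))
      (+-identityʳ (f u - f v)))
    cases false _ = sym (+-identityˡ (if mem E u v then f u - f v else 0ℚ))

-- Uniqueness and invariance of resistances

double-injective : ∀ {x y} → x + x ≡ y + y → x ≡ y
double-injective {x} {y} eq = -≡0⇒≡ (*-cancel-≡0 {2ℚ} (λ ())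
  (trans (l x y) (trans (cong (_- (x + x)) (sym eq)) (+-inverseʳ (x + x)))))
  where
  l : ∀ x y → (1ℚ + 1ℚ) * (y - x) ≡ y + y - (x + x)
  l = solve-∀ ℚ-ring

module _ {n : ℕ} (A : Graph n) (A-sym : ∀ u v → A u v ≡ A v u) where

  dirichlet : (Fin n → ℚ) → (Fin n → ℚ) → ℚ
  dirichlet y x = sumFin λ w → sumFin λ z → if A w z then (y w - y z) * (x w - x z) else 0ℚ

  weighted : ∀ (y x : Fin n → ℚ) → sumFin (λ w → y w * laplacian A x w)
    ≡ sumFin (λ w → sumFin (λ z → if A w z then y w * (x w - x z) else 0ℚ))
  weighted y x = sumFin-cong λ w → trans (sym (trans
    (sumFin-lin (y w) (λ z → if A w z then x w - x z else 0ℚ) 0ℚ (λ _ → 0ℚ))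
      (l (y w * laplacian A x w) (sumFin {n} (λ _ → 0ℚ)))))
    (sumFin-cong λ z → push (A w z) (y w) (x w - x z))
    where
    l : ∀ p q → p + 0ℚ * q ≡ p
    l = solve-∀ ℚ-ring
    push : ∀ b y d → y * (if b then d else 0ℚ) + 0ℚ * 0ℚ ≡ (if b then y * d else 0ℚ)
    push true  y d = +-identityʳ (y * d)
    push false y d = trans (+-identityʳ (y * 0ℚ)) (*-zeroʳ y)

  -- One of the two copies has its summation variables exchanged, so that each ordered pair collects
  -- a symmetric term.
  green : ∀ (y x : Fin n → ℚ) → sumFin (λ w → y w * laplacian A x w) + sumFin (λ w → y w * laplacian A x w)
    ≡ dirichlet y x
  green y x = trans
    (cong₂ _+_ {W} {V} {W} {V′} (weighted y x) (trans (weighted y x) (sumFin-swap {n} {n}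
      (λ w z → if A w z then y w * (x w - x z) else 0ℚ))))
    (trans (sym (sumFin-+
        (λ w → sumFin (λ z → if A w z then y w * (x w - x z) else 0ℚ))
        (λ w → sumFin (λ z → if A z w then y z * (x z - x w) else 0ℚ))))
      (sumFin-cong λ w → trans (sym (sumFin-+
          (λ z → if A w z then y w * (x w - x z) else 0ℚ)
          (λ z → if A z w then y z * (x z - x w) else 0ℚ)))
        (sumFin-cong λ z → trans
          (cong (λ b → (if A w z then y w * (x w - x z) else 0ℚ)
                     + (if b then y z * (x z - x w) else 0ℚ)) (A-sym z w))
          (merge (A w z) (y w) (y z) (x w) (x z)))))
    where
    W = sumFin {n} (λ w → y w * laplacian A x w)
    V = sumFin {n} (λ w → sumFin {n} (λ z → if A w z then y w * (x w - x z) else 0ℚ))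
    V′ = sumFin {n} (λ w → sumFin {n} (λ z → if A z w then y z * (x z - x w) else 0ℚ))
    l : ∀ y y′ x x′ → y * (x - x′) + y′ * (x′ - x) ≡ (y - y′) * (x - x′)
    l = solve-∀ ℚ-ring
    merge : ∀ b y y′ x x′ → (if b then y * (x - x′) else 0ℚ) + (if b then y′ * (x′ - x) else 0ℚ)
      ≡ (if b then (y - y′) * (x - x′) else 0ℚ)
    merge true  = l
    merge false _ _ _ _ = refl

  dirichlet-sym : ∀ (y x : Fin n → ℚ) → dirichlet y x ≡ dirichlet x y
  dirichlet-sym y x = sumFin-cong λ w → sumFin-cong λ z →
    cong (λ t → if A w z then t else 0ℚ) (*-comm (y w - y z) (x w - x z))

  pairing : ∀ u v y {x} → (∀ w → laplacian A x w ≡ δ u w - δ v w) →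
    sumFin (λ w → y w * laplacian A x w) ≡ y u - y v
  pairing u v y {x} h = trans
    (sumFin-cong λ w → trans (cong (y w *_) (h w)) (l (y w) (δ u w) (δ v w)))
    (trans (sumFin-lin 1ℚ (λ w → y w * δ u w) (- 1ℚ) (λ w → y w * δ v w))
      (trans (cong₂ (λ p q → 1ℚ * p + - 1ℚ * q) (sumFin-δ y u) (sumFin-δ y v)) (l′ (y u) (y v))))
    where
    l : ∀ y p q → y * (p - q) ≡ 1ℚ * (y * p) + - 1ℚ * (y * q)
    l = solve-∀ ℚ-ring
    l′ : ∀ p q → 1ℚ * p + - 1ℚ * q ≡ p - q
    l′ = solve-∀ ℚ-ring

  -- Reciprocity: if `x` and `y` solve the same equation, then `x u - x v` is the pairing of `x`
  -- with the Laplacian of `y`, which by symmetry is that of `y` with the Laplacian of `x`, that is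
  -- `y u - y v`.
  resistance-unique : ∀ {u v r r′} → IsResistance A u v r → IsResistance A u v r′ → r ≡ r′
  resistance-unique {u} {v} (x , hx , rx) (y , hy , ry) = trans rx (trans (double-injective
    (trans (sym (cong₂ _+_ (pairing u v x {y} hy) (pairing u v x {y} hy)))
      (trans (green x y) (trans (dirichlet-sym x y)
        (trans (sym (green y x)) (cong₂ _+_ (pairing u v y {x} hx) (pairing u v y {x} hx)))))))
    (sym ry))

module _ {m n : ℕ} {G : Graph m} {H : Graph n} (iso : G ≅ H) where
  private
    π = proj₁ iso
    open Inverse π using (to; from; inverseˡ; inverseʳ)

  δ-to : ∀ u w → δ (to u) (to w) ≡ δ u w
  δ-to u w with u ≟F w | to u ≟F to w
  ... | yes _  | yes _ = refl
  ... | no _   | no _  = refl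
  ... | yes eq | no ne = contradiction (cong to eq) ne
  ... | no ne  | yes eq =
    contradiction (trans (sym (inverseʳ refl)) (trans (cong from eq) (inverseʳ refl))) ne

  resistance-transport : ∀ {u v r} → IsResistance G u v r → IsResistance H (to u) (to v) r
  resistance-transport {u} {v} {r} (x , h , rx) = x ∘ from , h′ ,
    trans rx (cong₂ (λ p q → x p - x q) (sym (inverseʳ refl)) (sym (inverseʳ refl)))
    where
    h″ : ∀ w → laplacian H (x ∘ from) (to w) ≡ δ (to u) (to w) - δ (to v) (to w)
    h″ w = trans (sumFin-permute π (λ z → if H (to w) z then x (from (to w)) - x (from z) else 0ℚ))
      (trans (sumFin-cong λ z → cong₂ (λ b t → if b then t else 0ℚ) (sym (proj₂ iso w z))
          (cong₂ (λ p q → x p - x q) (inverseʳ refl) (inverseʳ refl)))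
        (trans (h w) (cong₂ _-_ (sym (δ-to u w)) (sym (δ-to v w)))))
    h′ : ∀ w → laplacian H (x ∘ from) w ≡ δ (to u) w - δ (to v) w
    h′ w = subst (λ w → laplacian H (x ∘ from) w ≡ δ (to u) w - δ (to v) w)
      (inverseˡ {x = w} refl) (h″ (from w))

half-sum : ∀ {n} (S : Fin n → Fin n → ℚ) → (∀ u v → S u v ≡ S v u) → (∀ u → S u u ≡ 0ℚ) →
  let U = sumFin λ u → sumFin λ v → if toℕ u <ᵇ toℕ v then S u v else 0ℚ in
  U + U ≡ sumFin λ u → sumFin (S u)
half-sum S S-sym S-diag = trans
  (cong (sumFin (λ u → sumFin λ v → if toℕ u <ᵇ toℕ v then S u v else 0ℚ) +_)
    (sumFin-swap (λ u v → if toℕ u <ᵇ toℕ v then S u v else 0ℚ)))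
  (trans (sym (sumFin-+ (λ u → sumFin λ v → if toℕ u <ᵇ toℕ v then S u v else 0ℚ)
                        (λ u → sumFin λ v → if toℕ v <ᵇ toℕ u then S v u else 0ℚ)))
    (sumFin-cong λ u → trans (sym (sumFin-+ (λ v → if toℕ u <ᵇ toℕ v then S u v else 0ℚ)
                                           (λ v → if toℕ v <ᵇ toℕ u then S v u else 0ℚ)))
      (sumFin-cong λ v → trichotomy u v)))
  where
  tri : ∀ m n {p q} → p ≡ q → (m ≡ n → p ≡ 0ℚ) →
    (if m <ᵇ n then p else 0ℚ) + (if n <ᵇ m then q else 0ℚ) ≡ p
  tri zero    zero    refl d = sym (d refl)
  tri zero    (suc n) {p} refl d = +-identityʳ p
  tri (suc m) zero    {p} refl d = +-identityˡ p
  tri (suc m) (suc n) e    d = tri m n e (d ∘ cong suc)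
  trichotomy : ∀ u v → (if toℕ u <ᵇ toℕ v then S u v else 0ℚ)
    + (if toℕ v <ᵇ toℕ u then S v u else 0ℚ) ≡ S u v
  trichotomy u v = tri (toℕ u) (toℕ v) (S-sym u v)
    (λ eq → trans (cong (S u) (sym (toℕ-injective eq))) (S-diag u))

-- `IsKf` only asserts that some matrix of resistances has sum `r`; uniqueness identifies it with
-- `S` pulled back along the isomorphism.
Kf-double : ∀ {m n} {G : Graph m} {H : Graph n} → (∀ u v → H u v ≡ H v u) → G ≅ H →
  (S : Fin n → Fin n → ℚ) → (∀ u v → IsResistance H u v (S u v)) →
  (∀ u v → S u v ≡ S v u) → (∀ u → S u u ≡ 0ℚ) →
  ∀ {r} → IsKf G r → r + r ≡ sumFin λ u → sumFin (S u)
Kf-double {G = G} {H} H-sym iso S S-res S-sym S-diag {r} (R , R-res , r≡) = trans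
  (cong₂ _+_ r≡S r≡S)
  (trans (half-sum (λ u v → S (to u) (to v)) (λ u v → S-sym (to u) (to v)) (λ u → S-diag (to u)))
    (trans (sumFin-cong (λ u → sym (sumFin-permute π (S (to u)))))
      (sym (sumFin-permute π (λ u → sumFin (S u))))))
  where
  π = proj₁ iso
  open Inverse π using (to)
  R≡S : ∀ u v → R u v ≡ S (to u) (to v)
  R≡S u v = resistance-unique H H-sym (resistance-transport {G = G} {H} iso (R-res u v)) (S-res (to u) (to v))
  r≡S : r ≡ sumFin λ u → sumFin λ v → if toℕ u <ᵇ toℕ v then S (to u) (to v) else 0ℚ
  r≡S = trans r≡ (sumFin-cong λ u → sumFin-cong λ v →
    cong (λ t → if toℕ u <ᵇ toℕ v then t else 0ℚ) (R≡S u v))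

-- vs is a rearrangement of 0, …, n - 1.
Covers : ℕ → List ℕ → Set
Covers n vs = ∀ g → sumL vs g ≡ sumFin {n} (g ∘ toℕ)

sumL-ind-∉ : ∀ {x} vs → x ∉ vs → sumL vs (ind x) ≡ 0ℚ
sumL-ind-∉ []       _ = refl
sumL-ind-∉ {x} (y ∷ vs) h = trans
  (cong₂ _+_ (ind-≢ {x} {y} (λ e → h (here e))) (sumL-ind-∉ vs (λ x∈ → h (there x∈))))
  (+-identityˡ 0ℚ)

ind-nonneg : ∀ x y → 0ℚ ≤ℚ ind x y
ind-nonneg x y with x ≡ᵇ y
... | true  = 0≤1
... | false = ≤-refl

sumL-ind-nonneg : ∀ x vs → 0ℚ ≤ℚ sumL vs (ind x)
sumL-ind-nonneg x []       = ≤-refl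
sumL-ind-nonneg x (y ∷ vs) = +-nonneg (ind-nonneg x y) (sumL-ind-nonneg x vs)

sumL-ind-∈ : ∀ {x} vs → x ∈ vs → 0ℚ <ℚ sumL vs (ind x)
sumL-ind-∈ {x} (y ∷ vs) (here refl) = +-pos-nonneg (subst (0ℚ <ℚ_) (sym (ind-refl x)) 0<1)
  (sumL-ind-nonneg x vs)
sumL-ind-∈ {x} (y ∷ vs) (there x∈) = subst (0ℚ <ℚ_) (+-comm (sumL vs (ind x)) (ind x y))
  (+-pos-nonneg (sumL-ind-∈ vs x∈) (ind-nonneg x y))

module _ {n : ℕ} {vs : List ℕ} (cov : Covers n vs) where

  -- The indicator of `x`, used as a test function, counts the occurrences of `x`.
  covers-∈ : ∀ {x} → x < n → x ∈ vs
  covers-∈ {x} x<n with x ∈? vs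
  ... | yes x∈ = x∈
  ... | no x∉  = contradiction
    (trans (sym (sumFin-ind x<n)) (trans (sym (cov (ind x))) (sumL-ind-∉ vs x∉))) (λ ())

  covers-< : ∀ {x} → x ∈ vs → x < n
  covers-< {x} x∈ with x ℕₚ.<? n
  ... | yes x<n = x<n
  ... | no x≮n  = contradiction (trans (cov (ind x)) (sumFin-ind-≥ (ℕₚ.≮⇒≥ x≮n)))
    (pos⇒≢0 (sumL-ind-∈ vs x∈))

module _ (N : Net) {n : ℕ} (H : Graph n) (cov : Covers n (Net.vs N))
  (H≡mem : ∀ u v → H u v ≡ mem (Net.E N) (toℕ u) (toℕ v)) where
  open Net N

  net-resistance : ∀ u v → IsResistance H u v (R (toℕ u) (toℕ v))
  net-resistance u v = x ∘ toℕ , potential , drop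
    where
    -- Half the difference of columns `v` and `u` of `R`: `τ` cancels in `R-lap`, and a unit source
    -- at `u` and sink at `v` remain.
    x : ℕ → ℚ
    x z = ½ * R z (toℕ v) + - ½ * R z (toℕ u) + 0ℚ * R z (toℕ u) + 0ℚ
    l : ∀ h k p q r → h * (k - (1ℚ + 1ℚ) * q) + - h * (k - (1ℚ + 1ℚ) * p) + 0ℚ * r
      ≡ (h + h) * (p - q)
    l = solve-∀ ℚ-ring
    potential : ∀ w → laplacian H (x ∘ toℕ) w ≡ δ u w - δ v w
    potential w = trans
      (sumFin-cong {n} (λ z → cong (λ b → if b then x (toℕ w) - x (toℕ z) else 0ℚ) (H≡mem w z)))
      (trans (laplacian-mem {n} E simple
          (Allᴸ.map (λ (a∈ , b∈) → covers-< cov a∈ , covers-< cov b∈) ends) x w)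
        (trans (lap-lin E ½ (λ z → R z (toℕ v)) (- ½) (λ z → R z (toℕ u)) 0ℚ
            (λ z → R z (toℕ u)) 0ℚ (toℕ w))
          (trans (cong₂ (λ p q → ½ * p + - ½ * q + 0ℚ * lap E (λ z → R z (toℕ u)) (toℕ w))
              (R-lap (covers-∈ cov (toℕ<n v)) (toℕ w)) (R-lap (covers-∈ cov (toℕ<n u)) (toℕ w)))
            (trans (l ½ (τ (toℕ w)) (ind (toℕ u) (toℕ w)) (ind (toℕ v) (toℕ w))
                (lap E (λ z → R z (toℕ u)) (toℕ w)))
              (trans (*-identityˡ (ind (toℕ u) (toℕ w) - ind (toℕ v) (toℕ w)))
                (sym (cong₂ _-_ (δ≡ind u w) (δ≡ind v w))))))))
    l′ : ∀ h r → (h + h) * r ≡ h * r + - h * 0ℚ + 0ℚ * 0ℚ + 0ℚ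
      - (h * 0ℚ + - h * r + 0ℚ * r + 0ℚ)
    l′ = solve-∀ ℚ-ring
    drop : R (toℕ u) (toℕ v) ≡ x (toℕ u) - x (toℕ v)
    drop = sym (trans
      (cong₂ (λ p q → ½ * R (toℕ u) (toℕ v) + - ½ * p + 0ℚ * p + 0ℚ
          - (½ * q + - ½ * R (toℕ v) (toℕ u) + 0ℚ * R (toℕ v) (toℕ u) + 0ℚ))
        (R-diag (toℕ u)) (R-diag (toℕ v)))
      (trans (cong (λ r → ½ * R (toℕ u) (toℕ v) + - ½ * 0ℚ + 0ℚ * 0ℚ + 0ℚ
          - (½ * 0ℚ + - ½ * r + 0ℚ * r + 0ℚ)) (R-sym (toℕ v) (toℕ u)))
        (trans (sym (l′ ½ (R (toℕ u) (toℕ v)))) (*-identityˡ (R (toℕ u) (toℕ v))))))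

  net-Kf : ∀ {m} {G : Graph m} → G ≅ H → ∀ {r} → IsKf G r → total (moments N) ≡ 2ℚ * (r + r)
  net-Kf {G = G} iso {r} kf = sym (cong (2ℚ *_) (trans
    (Kf-double {G = G} {H} H-sym iso (λ u v → R (toℕ u) (toℕ v)) net-resistance
      (λ u v → R-sym (toℕ u) (toℕ v)) (λ u → R-diag (toℕ u)) kf)
    (sym (trans (sumL-cong vs (λ {x} _ → cov (R x))) (cov (λ x → sumFin {n} (λ v → R x (toℕ v))))))))
    where
    H-sym : ∀ u v → H u v ≡ H v u
    H-sym u v = trans (H≡mem u v) (trans (mem-sym E (toℕ u) (toℕ v)) (sym (H≡mem v u)))

-- Runs of pendant vertices and the moments of one polygon

sumR : ℕ → ℕ → (ℕ → ℚ) → ℚ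
sumR c zero    g = 0ℚ
sumR c (suc m) g = g c + sumR (suc c) m g

sumR-++ : ∀ c m n g → sumR c (m ℕ.+ n) g ≡ sumR c m g + sumR (c ℕ.+ m) n g
sumR-++ c zero    n g = trans (cong (λ c → sumR c n g) (sym (ℕₚ.+-identityʳ c)))
  (sym (+-identityˡ (sumR (c ℕ.+ 0) n g)))
sumR-++ c (suc m) n g = trans
  (cong (g c +_) (trans (sumR-++ (suc c) m n g)
    (cong (λ d → sumR (suc c) m g + sumR d n g) (sym (ℕₚ.+-suc c m)))))
  (sym (+-assoc (g c) (sumR (suc c) m g) (sumR (c ℕ.+ suc m) n g)))

sumR-suc : ∀ c m g → sumR c (suc m) g ≡ sumR c m g + g (c ℕ.+ m)
sumR-suc c m g = trans (cong (λ n → sumR c n g) (ℕₚ.+-comm 1 m))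
  (trans (sumR-++ c m 1 g) (cong (sumR c m g +_) (+-identityʳ (g (c ℕ.+ m)))))

sumFin-toℕ : ∀ n c g → sumFin {n} (λ i → g (c ℕ.+ toℕ i)) ≡ sumR c n g
sumFin-toℕ zero    c g = refl
sumFin-toℕ (suc n) c g = cong₂ _+_ (cong g (ℕₚ.+-identityʳ c))
  (trans (sumFin-cong {n} (λ i → cong g (ℕₚ.+-suc c (toℕ i)))) (sumFin-toℕ n (suc c) g))

iter : ∀ {A : Set} → ℕ → (A → A) → A → A
iter zero    f x = x
iter (suc n) f x = iter n f (f x)

iter-pendM : ∀ ε n σ N M → ε * ε ≡ 1ℚ →
  iter n (pendM ε) (pendsM σ N M) ≡ pendsM (ι n * ε + σ) (n ℕ.+ N) M
iter-pendM ε zero    σ N M _  = cong (λ σ → pendsM σ N M) (l σ ε)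
  where
  l : ∀ σ ε → σ ≡ 0ℚ * ε + σ
  l = solve-∀ ℚ-ring
iter-pendM ε (suc n) σ N M εε = trans
  (cong (iter n (pendM ε)) (pendM-pendsM ε σ N M εε))
  (trans (iter-pendM ε n (ε + σ) (suc N) M εε)
    (cong₂ (λ σ N → pendsM σ N M) (l (ι n) ε σ) (ℕₚ.+-suc n N)))
  where
  l : ∀ n ε σ → n * ε + (ε + σ) ≡ (1ℚ + n) * ε + σ
  l = solve-∀ ℚ-ring

iter-flipM : ∀ n M → iter n (pendM 1ℚ) (flipM M) ≡ flipM (iter n (pendM (- 1ℚ)) M)
iter-flipM zero    M = refl
iter-flipM (suc n) M@(mom N a x q p f) = trans
  (cong (iter n (pendM 1ℚ)) (mom-≡ refl refl (l₁ N a x) (l₂ N a x q) refl (l₃ N p f x)))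
  (iter-flipM n (pendM (- 1ℚ) M))
  where
  l₁ : ∀ N a x → - x + 1ℚ * (N - (a + 1ℚ)) ≡ - (x + - 1ℚ * (N - (a + 1ℚ)))
  l₁ = solve-∀ ℚ-ring
  l₂ : ∀ N a x q → q + (1ℚ + 1ℚ) * (1ℚ * - x) + N + (a + 1ℚ) * (a + 1ℚ)
    ≡ q + (1ℚ + 1ℚ) * (- 1ℚ * x) + N + (a + 1ℚ) * (a + 1ℚ)
  l₂ = solve-∀ ℚ-ring
  l₃ : ∀ N p f x → f + (1ℚ + 1ℚ + (1ℚ + 1ℚ)) * N + p + (1ℚ + 1ℚ) * (1ℚ * - x)
    ≡ f + (1ℚ + 1ℚ + (1ℚ + 1ℚ)) * N + p + (1ℚ + 1ℚ) * (- 1ℚ * x)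
  l₃ = solve-∀ ℚ-ring

flipM-flipM : ∀ M → flipM (flipM M) ≡ M
flipM-flipM (mom n a x q p f) = mom-≡ refl refl (l x) refl refl refl
  where
  l : ∀ x → - - x ≡ x
  l = solve-∀ ℚ-ring

-- A side with `p` subdivision vertices takes `p + 1` pendant steps, the last one placing the next
-- end of the chain. The extra steps of the two sides cancel in the skew and add 2 to the count.
block-moments : ∀ p q M →
  flipM (iter (suc q) (pendM 1ℚ) (flipM (iter (suc p) (pendM 1ℚ) M)))
  ≡ pendsM (skew (p , q)) (suc (suc (p ℕ.+ q))) M
block-moments p q M = trans
  (cong flipM (iter-flipM (suc q) (iter (suc p) (pendM 1ℚ) M)))
  (trans (flipM-flipM _)
    (trans (cong (λ M → iter (suc q) (pendM (- 1ℚ)) (iter (suc p) (pendM 1ℚ) M))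
             (sym (pendsM-zero M)))
      (trans (cong (iter (suc q) (pendM (- 1ℚ))) (iter-pendM 1ℚ (suc p) 0ℚ 0 M refl))
        (trans (iter-pendM (- 1ℚ) (suc q) (ι (suc p) * 1ℚ + 0ℚ) (suc p ℕ.+ 0) M refl)
          (cong₂ (λ σ N → pendsM σ N M) (l (ι p) (ι q)) (l′ p q))))))
  where
  l : ∀ p q → (1ℚ + q) * - 1ℚ + ((1ℚ + p) * 1ℚ + 0ℚ) ≡ p - q
  l = solve-∀ ℚ-ring
  l′ : ∀ p q → suc q ℕ.+ (suc p ℕ.+ 0) ≡ suc (suc (p ℕ.+ q))
  l′ = solveℕ-∀

-- Attaching a path from `t` through `c`, ..., `c + m - 1` to `y`, which becomes the marked vertex.
-- `new` is kept for later freshness proofs.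
record Path (N : Net) (c m y : ℕ) : Set where
  open Net N
  field
    net : Net
    t≡  : Net.t net ≡ y
    s≡  : Net.s net ≡ s
    mem≡ : ∀ u v → mem (Net.E net) u v ≡ mem (pathEdges t y c m) u v ∨ mem E u v
    sum≡ : ∀ g → sumL (Net.vs net) g ≡ sumR c m g + g y + sumL vs g
    new  : ∀ {z} → z ∈ Net.vs net → z ∈ vs ⊎ z ≡ y ⊎ (c ≤ z × z < c ℕ.+ m)
    nonadj : NonAdj net
    moments≡ : moments net ≡ iter (suc m) (pendM 1ℚ) (moments N)

-- The bound makes `c` and all later numbers fresh; the endpoint `y` lies below `c` and needs its
-- own freshness hypothesis.
path : ∀ N c m y → (∀ {z} → z ∈ Net.vs N → z < c) → y ∉ Net.vs N → y < c → Path N c m y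
path N c zero y _ y∉ y<c = record
  { net = pend N y y∉ ; t≡ = refl ; s≡ = refl
  ; mem≡ = λ u v → cong (_∨ mem E u v) (sym (∨-identityʳ (joins u v (t , y))))
  ; sum≡ = λ g → cong (_+ sumL vs g) (sym (+-identityˡ (g y)))
  ; new = λ { (here refl) → inj₂ (inj₁ refl) ; (there z∈) → inj₁ z∈ }
  ; nonadj = pend-nonadj N y y∉ ; moments≡ = moments-pend N y y∉ }
  where open Net N
path N c (suc m) y bound y∉ y<c = record
  { net = net ; t≡ = t≡ ; s≡ = s≡
  ; mem≡ = λ u v → trans (mem≡ u v) (l (joins u v (t , c)) (mem (pathEdges c y (suc c) m) u v) (mem E u v))
  ; sum≡ = λ g → trans (sum≡ g) (l′ (sumR (suc c) m g) (g y) (g c) (sumL vs g))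
  ; new = λ z∈ → widen (new z∈)
  ; nonadj = nonadj
  ; moments≡ = trans moments≡ (cong (iter (suc m) (pendM 1ℚ)) (moments-pend N c c∉)) }
  where
  open Net N using (t; E; vs)
  c∉ : c ∉ vs
  c∉ c∈ = ℕₚ.<-irrefl refl (bound c∈)
  bound′ : ∀ {z} → z ∈ c ∷ vs → z < suc c
  bound′ (here refl) = ℕₚ.≤-refl
  bound′ (there z∈)  = ℕₚ.m≤n⇒m≤1+n (bound z∈)
  y∉′ : y ∉ c ∷ vs
  y∉′ (here refl) = ℕₚ.<-irrefl refl y<c
  y∉′ (there y∈)  = y∉ y∈
  open Path (path (pend N c c∉) (suc c) m y bound′ y∉′ (ℕₚ.m≤n⇒m≤1+n y<c))
  l : ∀ p q r → q ∨ (p ∨ r) ≡ (p ∨ q) ∨ r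
  l = ∨-Solver.solve 3 (λ p q r → q ⊕ (p ⊕ r) ⊜ (p ⊕ q) ⊕ r) refl
  l′ : ∀ a b c d → a + b + (c + d) ≡ c + a + b + d
  l′ = solve-∀ ℚ-ring
  widen : ∀ {z} → z ∈ c ∷ vs ⊎ z ≡ y ⊎ (suc c ≤ z × z < suc c ℕ.+ m) →
    z ∈ vs ⊎ z ≡ y ⊎ (c ≤ z × z < c ℕ.+ suc m)
  widen (inj₁ (here refl)) = inj₂ (inj₂ (ℕₚ.≤-refl , ℕₚ.m<m+n c (s≤s z≤n)))
  widen (inj₁ (there z∈))  = inj₁ z∈
  widen (inj₂ (inj₁ z≡y))  = inj₂ (inj₁ z≡y)
  widen (inj₂ (inj₂ (p , q))) = inj₂ (inj₂ (ℕₚ.≤-trans (ℕₚ.n≤1+n c) p ,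
    ℕₚ.≤-trans q (ℕₚ.≤-reflexive (sym (ℕₚ.+-suc c m)))))

-- Building the chain square by square

module Build (h K : ℕ) where

  B : ℕ
  B = 2 ℕ.* h ℕ.+ 2

  sV : ℕ → ℕ
  sV j = h ℕ.+ 1 ℕ.+ j

  B≡ : B ≡ h ℕ.+ 1 ℕ.+ suc h
  B≡ = l h
    where
    l : ∀ h → 2 ℕ.* h ℕ.+ 2 ≡ h ℕ.+ 1 ℕ.+ suc h
    l = solveℕ-∀

  sV<B : ∀ {j} → j ≤ h → sV j < B
  sV<B {j} j≤h = subst (sV j <_) (sym B≡) (ℕₚ.+-monoʳ-< (h ℕ.+ 1) (s≤s j≤h))

  tV<sV : ∀ {i} j → i ≤ h → i < sV j
  tV<sV {i} j i≤h = ℕₚ.<-≤-trans (ℕₚ.≤-<-trans i≤h (ℕₚ.m<m+n h (s≤s z≤n)))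
    (ℕₚ.m≤m+n (h ℕ.+ 1) j)

  -- The network after `j` polygons, with the edge t_j s_j marked. `old` separates the three ranges
  -- of numbers in use, top, bottom and subdivision vertices, so that the next `t` and `s` can be
  -- seen to be new.
  record Stage (j c m : ℕ) (N : Net) : Set where
    open Net N
    field
      t≡   : t ≡ j
      s≡   : s ≡ sV j
      c≡   : c ≡ B ℕ.+ m
      <c   : ∀ {z} → z ∈ vs → z < c
      old  : ∀ {z} → z ∈ vs → z ≤ j ⊎ (h < z × z ≤ sV j) ⊎ B ≤ z
      sum≡ : ∀ g → sumL vs g ≡ sumR 0 (suc j) g + sumR (h ℕ.+ 1) (suc j) g + sumR B m g
      gap≥0 : 0ℚ ≤ℚ gap (moments N)

  -- Rungs in the order in which polygons are closed, opposite to that of `rungs`; the rung at 0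
  -- belongs to `start`.
  upRungs : ℕ → ℕ → List Edge
  upRungs j zero    = []
  upRungs j (suc r) = (suc j , sV (suc j)) ∷ upRungs (suc j) r

  -- Top path, bottom path on the flipped network, and the rung as closing resistor.
  step : ∀ {j c m N} a b → a ℕ.+ b ≡ K → j < h → Stage j c m N →
    Σ Net λ N′ → Stage (suc j) (c ℕ.+ a ℕ.+ b) (m ℕ.+ K) N′
      × (∀ u v → mem (Net.E N′) u v ≡ joins u v (suc j , sV (suc j))
          ∨ (mem (pathEdges (sV j) (sV (suc j)) (c ℕ.+ a) b) u v
          ∨ (mem (pathEdges j (suc j) c a) u v ∨ mem (Net.E N) u v)))
      × moments N′ ≡ closeM (pendsM (skew (a , b)) (suc (suc K)) (moments N))
  step {j} {c} {m} {N} a b a+b≡K j<h st = N′ , stage , mem′ , moments′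
    where
    open Stage st
    B≤c : B ≤ c
    B≤c = subst (B ≤_) (sym c≡) (ℕₚ.m≤m+n B m)
    y₁∉ : suc j ∉ Net.vs N
    y₁∉ y∈ with old y∈
    ... | inj₁ p = ℕₚ.<-irrefl refl p
    ... | inj₂ (inj₁ (p , _)) = ℕₚ.<-irrefl refl (ℕₚ.<-≤-trans p j<h)
    ... | inj₂ (inj₂ p) = ℕₚ.<-irrefl refl (ℕₚ.<-≤-trans (ℕₚ.<-trans (tV<sV h j<h) (sV<B ℕₚ.≤-refl)) p)
    y₁<c : suc j < c
    y₁<c = ℕₚ.<-≤-trans (ℕₚ.<-trans (tV<sV h j<h) (sV<B ℕₚ.≤-refl)) B≤c
    P₁ = path N c a (suc j) <c y₁∉ y₁<c
    module P₁ = Path P₁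
    N₂ = flip P₁.net
    <c₂ : ∀ {z} → z ∈ Net.vs N₂ → z < c ℕ.+ a
    <c₂ z∈ with P₁.new z∈
    ... | inj₁ p = ℕₚ.<-≤-trans (<c p) (ℕₚ.m≤m+n c a)
    ... | inj₂ (inj₁ refl) = ℕₚ.<-≤-trans y₁<c (ℕₚ.m≤m+n c a)
    ... | inj₂ (inj₂ (_ , p)) = p
    y₂<c : sV (suc j) < c
    y₂<c = ℕₚ.<-≤-trans (sV<B j<h) B≤c
    y₂∉ : sV (suc j) ∉ Net.vs N₂
    y₂∉ y∈ with P₁.new y∈
    ... | inj₂ (inj₁ p) = ℕₚ.<-irrefl (sym p) (tV<sV (suc j) j<h)
    ... | inj₂ (inj₂ (p , _)) = ℕₚ.<-irrefl refl (ℕₚ.<-≤-trans y₂<c p)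
    ... | inj₁ p with old p
    ...   | inj₁ q = ℕₚ.<-irrefl refl (ℕₚ.<-≤-trans (tV<sV (suc j) (ℕₚ.<⇒≤ j<h)) q)
    ...   | inj₂ (inj₁ (_ , q)) = ℕₚ.<-irrefl refl (ℕₚ.≤-trans (ℕₚ.≤-reflexive (sym (ℕₚ.+-suc (h ℕ.+ 1) j))) q)
    ...   | inj₂ (inj₂ q) = ℕₚ.<-irrefl refl (ℕₚ.<-≤-trans (sV<B j<h) q)
    P₂ = path N₂ (c ℕ.+ a) b (sV (suc j)) <c₂ y₂∉ (ℕₚ.<-≤-trans y₂<c (ℕₚ.m≤m+n c a))
    module P₂ = Path P₂
    N₃ = flip P₂.net
    moments₃ : moments N₃ ≡ pendsM (skew (a , b)) (suc (suc K)) (moments N)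
    moments₃ = trans (moments-flip P₂.net) (trans (cong flipM (trans P₂.moments≡
        (cong (iter (suc b) (pendM 1ℚ)) (trans (moments-flip P₁.net) (cong flipM P₁.moments≡)))))
      (trans (block-moments a b (moments N))
        (cong (λ K → pendsM (skew (a , b)) (suc (suc K)) (moments N)) a+b≡K)))
    gap₃≥0 : 0ℚ ≤ℚ gap (moments N₃)
    gap₃≥0 = subst (λ M → 0ℚ ≤ℚ gap M) (sym moments₃) (+-nonneg gap≥0 (ι-nonneg (suc (suc K))))
    N′ = close N₃ gap₃≥0 (flip-nonadj P₂.net P₂.nonadj)
    moments′ : moments N′ ≡ closeM (pendsM (skew (a , b)) (suc (suc K)) (moments N))
    moments′ = trans (moments-close N₃ gap₃≥0 (flip-nonadj P₂.net P₂.nonadj)) (cong closeM moments₃)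
    mem′ : ∀ u v → mem (Net.E N′) u v ≡ joins u v (suc j , sV (suc j))
          ∨ (mem (pathEdges (sV j) (sV (suc j)) (c ℕ.+ a) b) u v
          ∨ (mem (pathEdges j (suc j) c a) u v ∨ mem (Net.E N) u v))
    mem′ u v = cong₂ _∨_
      (cong₂ (λ x y → joins u v (x , y)) (trans P₂.s≡ P₁.t≡) P₂.t≡)
      (trans (P₂.mem≡ u v) (cong₂ _∨_
        (cong (λ x → mem (pathEdges x (sV (suc j)) (c ℕ.+ a) b) u v) (trans P₁.s≡ s≡))
        (trans (P₁.mem≡ u v) (cong
          (λ x → mem (pathEdges x (suc j) c a) u v ∨ mem (Net.E N) u v) t≡))))
    <c′ : ∀ {z} → z ∈ Net.vs N′ → z < c ℕ.+ a ℕ.+ b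
    <c′ z∈ with P₂.new z∈
    ... | inj₁ p = ℕₚ.<-≤-trans (<c₂ p) (ℕₚ.m≤m+n (c ℕ.+ a) b)
    ... | inj₂ (inj₁ refl) = ℕₚ.<-≤-trans y₂<c (ℕₚ.≤-trans (ℕₚ.m≤m+n c a) (ℕₚ.m≤m+n (c ℕ.+ a) b))
    ... | inj₂ (inj₂ (_ , p)) = p
    old′ : ∀ {z} → z ∈ Net.vs N′ → z ≤ suc j ⊎ (h < z × z ≤ sV (suc j)) ⊎ B ≤ z
    old′ z∈ with P₂.new z∈
    ... | inj₂ (inj₁ refl) = inj₂ (inj₁ (tV<sV (suc j) ℕₚ.≤-refl , ℕₚ.≤-refl))
    ... | inj₂ (inj₂ (p , _)) = inj₂ (inj₂ (ℕₚ.≤-trans B≤c (ℕₚ.≤-trans (ℕₚ.m≤m+n c a) p)))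
    ... | inj₁ p with P₁.new p
    ...   | inj₂ (inj₁ refl) = inj₁ ℕₚ.≤-refl
    ...   | inj₂ (inj₂ (q , _)) = inj₂ (inj₂ (ℕₚ.≤-trans B≤c q))
    ...   | inj₁ q with old q
    ...     | inj₁ r = inj₁ (ℕₚ.m≤n⇒m≤1+n r)
    ...     | inj₂ (inj₁ (r , r′)) = inj₂ (inj₁ (r , ℕₚ.≤-trans r′ (ℕₚ.+-monoʳ-≤ (h ℕ.+ 1) (ℕₚ.n≤1+n j))))
    ...     | inj₂ (inj₂ r) = inj₂ (inj₂ r)
    sum′ : ∀ g → sumL (Net.vs N′) g
      ≡ sumR 0 (suc (suc j)) g + sumR (h ℕ.+ 1) (suc (suc j)) g + sumR B (m ℕ.+ K) g
    sum′ g = trans (P₂.sum≡ g) (trans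
      (cong (sumR (c ℕ.+ a) b g + g (sV (suc j)) +_) (trans (P₁.sum≡ g)
        (cong (sumR c a g + g (suc j) +_) (sum≡ g))))
      (trans (l (sumR (c ℕ.+ a) b g) (g (sV (suc j))) (sumR c a g) (g (suc j))
          (sumR 0 (suc j) g) (sumR (h ℕ.+ 1) (suc j) g) (sumR B m g))
        (sym (cong₂ _+_ (cong₂ _+_ (sumR-suc 0 (suc j) g) (sumR-suc (h ℕ.+ 1) (suc j) g))
          (trans (sumR-++ B m K g) (cong (sumR B m g +_)
            (trans (cong₂ (λ c n → sumR c n g) (sym c≡) (sym a+b≡K)) (sumR-++ c a b g))))))))
      where
      l : ∀ cb y₂ ca y₁ T S M → cb + y₂ + (ca + y₁ + (T + S + M))
        ≡ T + y₁ + (S + y₂) + (M + (ca + cb))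
      l = solve-∀ ℚ-ring
    gap′≥0 : 0ℚ ≤ℚ gap (moments N′)
    gap′≥0 = subst (λ M → 0ℚ ≤ℚ gap M)
      (sym (moments-close N₃ gap₃≥0 (flip-nonadj P₂.net P₂.nonadj)))
      (*-nonneg (<⇒≤ (recip-pos (+-pos-nonneg 0<1 gap₃≥0))) gap₃≥0)
    stage : Stage (suc j) (c ℕ.+ a ℕ.+ b) (m ℕ.+ K) N′
    stage = record
      { t≡ = trans P₂.s≡ P₁.t≡ ; s≡ = P₂.t≡
      ; c≡ = trans (ℕₚ.+-assoc c a b) (trans (cong₂ ℕ._+_ c≡ a+b≡K) (ℕₚ.+-assoc B m K))
      ; <c = <c′ ; old = old′ ; sum≡ = sum′ ; gap≥0 = gap′≥0 }

  open Value (suc (suc K)) using (runM)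

  build : ∀ ws → Allᴸ (λ w → proj₁ w ℕ.+ proj₂ w ≡ K) ws →
    ∀ {j c m N} → Stage j c m N → length ws ℕ.+ j ≡ h →
    Σ Net λ N′ → (∀ g → sumL (Net.vs N′) g
        ≡ sumR 0 (suc h) g + sumR (h ℕ.+ 1) (suc h) g + sumR B (m ℕ.+ length ws ℕ.* K) g)
      × (∀ u v → mem (Net.E N′) u v
          ≡ mem (Net.E N) u v ∨ (mem (upRungs j (length ws)) u v ∨ mem (squareEdges h j c ws) u v))
      × moments N′ ≡ runM (map skew ws) (moments N)
  build [] [] {j} {c} {m} {N} st refl = N ,
    (λ g → trans (Stage.sum≡ st g)
      (cong (λ m → sumR 0 (suc j) g + sumR (h ℕ.+ 1) (suc j) g + sumR B m g) (sym (ℕₚ.+-identityʳ m)))) ,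
    (λ u v → sym (∨-identityʳ (mem (Net.E N) u v))) , refl
  build ((a , b) ∷ ws) (eq ∷ eqs) {j} {c} {m} {N} st len =
    let N₁ , st₁ , mem₁ , mom₁ = step a b eq (subst (j <_) len (s≤s (ℕₚ.m≤n+m j (length ws)))) st
        N₂ , sum₂ , mem₂ , mom₂ = build ws eqs st₁ (trans (ℕₚ.+-suc (length ws) j) len)
    in N₂ ,
      (λ g → trans (sum₂ g) (cong (λ m → sumR 0 (suc h) g + sumR (h ℕ.+ 1) (suc h) g + sumR B m g)
        (ℕₚ.+-assoc m K (length ws ℕ.* K)))) ,
      (λ u v → trans (mem₂ u v) (trans
        (cong (_∨ (mem (upRungs (suc j) (length ws)) u v ∨ mem (squareEdges h (suc j) (c ℕ.+ a ℕ.+ b) ws) u v)) (mem₁ u v))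
        (trans (l (joins u v (suc j , sV (suc j)))
            (mem (pathEdges (sV j) (sV (suc j)) (c ℕ.+ a) b) u v)
            (mem (pathEdges j (suc j) c a) u v)
            (mem (Net.E N) u v) (mem (upRungs (suc j) (length ws)) u v)
            (mem (squareEdges h (suc j) (c ℕ.+ a ℕ.+ b) ws) u v))
          (cong (λ s → mem (Net.E N) u v ∨ (mem (upRungs j (suc (length ws))) u v ∨ s))
            (sym (trans (mem-++ (pathEdges j (suc j) c a) _ u v)
              (cong (mem (pathEdges j (suc j) c a) u v ∨_)
                (mem-++ (pathEdges (sV j) (sV (suc j)) (c ℕ.+ a) b) _ u v)))))))) ,
      trans mom₂ (cong (runM (map skew ws)) mom₁)
    where
    l : ∀ r p₂ p₁ e ur sq → (r ∨ (p₂ ∨ (p₁ ∨ e))) ∨ (ur ∨ sq) ≡ e ∨ ((r ∨ ur) ∨ (p₁ ∨ (p₂ ∨ sq)))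
    l = ∨-Solver.solve 6 (λ r p₂ p₁ e ur sq →
      (r ⊕ (p₂ ⊕ (p₁ ⊕ e))) ⊕ (ur ⊕ sq) ⊜ e ⊕ ((r ⊕ ur) ⊕ (p₁ ⊕ (p₂ ⊕ sq)))) refl

  0≢sV : 0 ≢ sV 0
  0≢sV e = ℕₚ.<-irrefl e (tV<sV 0 z≤n)

  N₀ : Net
  N₀ = start 0 (sV 0) 0≢sV

  stage₀ : Stage 0 B 0 N₀
  stage₀ = record
    { t≡ = refl ; s≡ = refl ; c≡ = sym (ℕₚ.+-identityʳ B)
    ; <c = λ { (here refl) → ℕₚ.<-trans (tV<sV 0 z≤n) (sV<B z≤n)
             ; (there (here refl)) → sV<B z≤n }
    ; old = λ { (here refl) → inj₁ z≤n
              ; (there (here refl)) → inj₂ (inj₁ (tV<sV 0 ℕₚ.≤-refl , ℕₚ.≤-refl)) }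
    ; sum≡ = λ g → trans (cong (λ x → g 0 + (g x + 0ℚ)) (ℕₚ.+-identityʳ (h ℕ.+ 1)))
        (l (g 0) (g (h ℕ.+ 1)))
    ; gap≥0 = ≤-trans 0≤1 (≤-reflexive (sym (start-gap 0 (sV 0) 0≢sV))) }
    where
    l : ∀ x y → x + (y + 0ℚ) ≡ x + 0ℚ + (y + 0ℚ) + 0ℚ
    l = solve-∀ ℚ-ring

-- Agreement of the rungs with the prescribed chain

rungsFrom : ℕ → ℕ → List Edge
rungsFrom h zero    = []
rungsFrom h (suc j) = (j , h ℕ.+ 1 ℕ.+ j) ∷ rungsFrom h j

-- The local function of rungs has no name outside of Defs: it is recovered by unification,
-- which needs its two arguments to be distinct variables.
mutual
  rungsGo : ℕ → ℕ → List Edge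
  rungsGo = _

  rungs-unfold : ∀ h → rungs (suc h)
    ≡ (suc h , suc h ℕ.+ 1 ℕ.+ suc h) ∷ (h , suc h ℕ.+ 1 ℕ.+ h) ∷ rungsGo (suc h) h
  rungs-unfold h with suc h
  ... | _ = refl

rungsGo≡ : ∀ h j → rungsGo h j ≡ rungsFrom h j
rungsGo≡ h zero    = refl
rungsGo≡ h (suc j) = cong ((j , h ℕ.+ 1 ℕ.+ j) ∷_) (rungsGo≡ h j)

rungs≡ : ∀ h → rungs (suc h) ≡ rungsFrom (suc h) (suc (suc h))
rungs≡ h = trans (rungs-unfold h)
  (cong (λ es → (suc h , suc h ℕ.+ 1 ℕ.+ suc h) ∷ (h , suc h ℕ.+ 1 ℕ.+ h) ∷ es) (rungsGo≡ (suc h) h))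

module _ (h K : ℕ) where
  open Build h K

  mem-rungsFrom : ∀ r j u v → mem (rungsFrom h (suc (r ℕ.+ j))) u v
    ≡ mem (upRungs j r) u v ∨ mem (rungsFrom h (suc j)) u v
  mem-rungsFrom zero    j u v = refl
  mem-rungsFrom (suc r) j u v = trans
    (cong (λ n → mem (rungsFrom h (suc n)) u v) (sym (ℕₚ.+-suc r j)))
    (trans (mem-rungsFrom r (suc j) u v)
      (l (mem (upRungs (suc j) r) u v) (joins u v (suc j , sV (suc j)))
        (mem (rungsFrom h (suc j)) u v)))
    where
    l : ∀ p q r → p ∨ (q ∨ r) ≡ (q ∨ p) ∨ r
    l = ∨-Solver.solve 3 (λ p q r → p ⊕ (q ⊕ r) ⊜ (q ⊕ p) ⊕ r) refl

-- Comparison of the Kirchhoff indices of chains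

mids : ∀ {n} → ℕ → Vec ℕ n → List (ℕ × ℕ)
mids K w = map (λ a → a , K ∸ a) (toList w)

mids-split : ∀ {n} K (w : Vec ℕ n) → All (_≤ K) w →
  Allᴸ (λ w → proj₁ w ℕ.+ proj₂ w ≡ K) (mids K w)
mids-split K []      []       = []
mids-split K (a ∷ w) (p ∷ ps) = ℕₚ.m+[n∸m]≡n p ∷ mids-split K w ps

length-mids : ∀ {n} K (w : Vec ℕ n) → length (mids K w) ≡ n
length-mids K w = trans (length-map (λ a → a , K ∸ a) (toList w)) (length-toList w)

module Chain (K′ h′ : ℕ) where
  K k h : ℕ
  K = suc K′
  k = suc (suc (suc (suc K)))
  h = suc (suc h′)
  open Build h K
  -- `Extremal` takes predecessors: a polygon adds `suc (suc K)`, that is `k - 2`, vertices.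
  open Extremal (suc K) K′ using (skews; run-total; run-total-min; run-total-unique; Split)
  open Value (suc (suc K)) using (runM)

  end : ℕ × ℕ
  end = ⌈ K /2⌉ , ⌊ K /2⌋

  end-split : ⌈ K /2⌉ ℕ.+ ⌊ K /2⌋ ≡ K
  end-split = trans (ℕₚ.+-comm ⌈ K /2⌉ ⌊ K /2⌋) (ℕₚ.⌊n/2⌋+⌈n/2⌉≡n K)

  M₀ : Moments
  M₀ = moments N₀

  gap₀≥0 : 0ℚ ≤ℚ gap M₀
  gap₀≥0 = Stage.gap≥0 stage₀

  excess₀ : size M₀ - (gap M₀ + 1ℚ) ≡ 0ℚ
  excess₀ = cong (λ a → size M₀ - (a + 1ℚ)) (start-gap 0 (sV 0) 0≢sV)

  M₀≡ : M₀ ≡ mom (size M₀) (gap M₀) 0ℚ (Σψ² M₀) (Σends M₀) (total M₀)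
  M₀≡ = cong (λ x → mom (size M₀) (gap M₀) x (Σψ² M₀) (Σends M₀) (total M₀))
    (start-Σψ 0 (sV 0) 0≢sV)

  value : List (ℕ × ℕ) → ℚ
  value = run-total (skew end) (size M₀) (gap M₀) (Σψ² M₀) (Σends M₀) (total M₀) gap₀≥0 excess₀

  module _ (w : Vec ℕ h′) (w≤ : All (_≤ K) w) where

    length-subdivs : length (subdivs k w) ≡ h
    length-subdivs = cong suc (trans (length-++ (mids K w))
      (trans (ℕₚ.+-comm (length (mids K w)) 1) (cong suc (length-mids K w))))

    built = build (subdivs k w) (end-split ∷ ++⁺ (mids-split K w w≤) (end-split ∷ []))
      stage₀ (trans (ℕₚ.+-identityʳ (length (subdivs k w))) length-subdivs)

    chainNet : Net
    chainNet = proj₁ built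

    chainNet-covers : Covers (numV k h) (Net.vs chainNet)
    chainNet-covers g = trans (proj₁ (proj₂ built) g)
      (trans (cong (λ n → sumR 0 (suc h) g + sumR (h ℕ.+ 1) (suc h) g + sumR B (n ℕ.* K) g) length-subdivs)
      (sym (trans (sumFin-toℕ (numV k h) 0 g)
        (trans (cong (λ n → sumR 0 n g) (count h K))
          (trans (sumR-++ 0 (suc h ℕ.+ suc h) (h ℕ.* K) g) (cong₂ _+_
            (trans (sumR-++ 0 (suc h) (suc h) g)
              (cong (λ c → sumR 0 (suc h) g + sumR c (suc h) g) (ℕₚ.+-comm 1 h)))
            (cong (λ c → sumR c (h ℕ.* K) g) (top h))))))))
      where
      count : ∀ h K → h ℕ.* suc (suc K) ℕ.+ 2 ≡ suc h ℕ.+ suc h ℕ.+ h ℕ.* K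
      count = solveℕ-∀
      top : ∀ h → suc h ℕ.+ suc h ≡ 2 ℕ.* h ℕ.+ 2
      top = solveℕ-∀

    chainNet-mem : ∀ u v → P k h w u v ≡ mem (Net.E chainNet) (toℕ u) (toℕ v)
    chainNet-mem u v = trans (mem-++ (rungs h) squares (toℕ u) (toℕ v))
      (trans (cong (_∨ mem squares (toℕ u) (toℕ v))
        (trans (cong (λ es → mem es (toℕ u) (toℕ v)) (rungs≡ (suc h′)))
          (trans (cong (λ n → mem (rungsFrom h (suc n)) (toℕ u) (toℕ v)) (sym (ℕₚ.+-identityʳ h)))
            (mem-rungsFrom h K h 0 (toℕ u) (toℕ v)))))
      (trans (l (mem (upRungs 0 h) (toℕ u) (toℕ v)) (mem (rungsFrom h 1) (toℕ u) (toℕ v))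
          (mem squares (toℕ u) (toℕ v)))
        (trans (cong (λ n → mem (Net.E N₀) (toℕ u) (toℕ v)
              ∨ (mem (upRungs 0 n) (toℕ u) (toℕ v) ∨ mem squares (toℕ u) (toℕ v)))
            (sym length-subdivs))
          (sym (proj₁ (proj₂ (proj₂ built)) (toℕ u) (toℕ v))))))
      where
      squares = squareEdges h 0 B (subdivs k w)
      l : ∀ p q r → (p ∨ q) ∨ r ≡ q ∨ (p ∨ r)
      l = ∨-Solver.solve 3 (λ p q r → (p ⊕ q) ⊕ r ⊜ q ⊕ (p ⊕ r)) refl

    chainNet-total : total (moments chainNet)
      ≡ value (mids K w)
    chainNet-total = trans (cong total (proj₂ (proj₂ (proj₂ built))))
      (cong₂ (λ σs M → total (runM σs M))
        (cong (skew end ∷_) (map-++ skew (mids K w) (end ∷ []))) M₀≡)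

    Kf≡ : ∀ {n} {G : Graph n} → G ≅ P k h w → ∀ {r} → IsKf G r →
      value (mids K w)
        ≡ 2ℚ * (r + r)
    Kf≡ {G = G} iso kf = trans (sym chainNet-total)
      (net-Kf chainNet (P k h w) chainNet-covers chainNet-mem {G = G} iso kf)

  flat : Vec ℕ h′
  flat = replicate h′ 0

  flat-≤ : All (_≤ K) flat
  flat-≤ = zeros h′
    where
    zeros : ∀ n → All (_≤ K) (replicate n 0)
    zeros zero    = []
    zeros (suc n) = z≤n ∷ zeros n

  flat-mids : Allᴸ (λ w → proj₁ w ≡ 0) (mids K flat)
  flat-mids = zeros h′
    where
    zeros : ∀ n → Allᴸ (λ w → proj₁ w ≡ 0) (mids K (replicate n 0))
    zeros zero    = []
    zeros (suc n) = refl ∷ zeros n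

  allˡ⇒flat : ∀ {n} (w : Vec ℕ n) → Allᴸ (λ w → proj₁ w ≡ 0) (mids K w) → w ≡ replicate n 0
  allˡ⇒flat []      []          = refl
  allˡ⇒flat (a ∷ w) (refl ∷ zs) = cong (0 ∷_) (allˡ⇒flat w zs)

  allʳ⇒full : ∀ {n} (w : Vec ℕ n) → All (_≤ K) w →
    Allᴸ (λ w → proj₂ w ≡ 0) (mids K w) → w ≡ replicate n K
  allʳ⇒full []      []       []       = refl
  allʳ⇒full (a ∷ w) (p ∷ ps) (z ∷ zs) =
    cong₂ _∷_ (ℕₚ.≤-antisym p (ℕₚ.m∸n≡0⇒m≤n z)) (allʳ⇒full w ps zs)

  module _ (w : Vec ℕ h′) (w≤ : All (_≤ K) w)
    {m n : ℕ} {G : Graph m} {G₀ : Graph n} (iso : G ≅ P k h w) (iso₀ : G₀ ≅ D k h)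
    {r r₀ : ℚ} (kf : IsKf G r) (kf₀ : IsKf G₀ r₀) where
    private
      len : length (mids K w) ≡ length (mids K flat)
      len = trans (length-mids K w) (sym (length-mids K flat))
      double : ∀ x → 2ℚ * (x + x) ≡ 4ℚ * x
      double = solve-∀ ℚ-ring
      eq : value (mids K w) ≡ 4ℚ * r
      eq = trans (Kf≡ w w≤ {G = G} iso kf) (double r)
      eq₀ : value (mids K flat) ≡ 4ℚ * r₀
      eq₀ = trans (Kf≡ flat flat-≤ {G = G₀} iso₀ kf₀) (double r₀)

    Kf-min : r₀ ≤ℚ r
    Kf-min = *-cancelˡ-≤-pos 4ℚ (subst₂ _≤ℚ_ eq₀ eq
      (run-total-min (skew end) (size M₀) (gap M₀) (Σψ² M₀) (Σends M₀) (total M₀) gap₀≥0 excess₀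
        len (mids-split K w w≤) (mids-split K flat flat-≤) flat-mids))

    Kf-unique : r ≡ r₀ → w ≡ replicate h′ 0 ⊎ w ≡ replicate h′ K
    Kf-unique r≡r₀ = Sum.map (allˡ⇒flat w) (allʳ⇒full w w≤)
      (run-total-unique (skew end) (size M₀) (gap M₀) (Σψ² M₀) (Σends M₀) (total M₀) gap₀≥0 excess₀
        len (mids-split K w w≤) (mids-split K flat flat-≤) flat-mids
        (trans eq (trans (cong (4ℚ *_) r≡r₀) (sym eq₀))))

  -- Minimality of the flat chain, applied in both directions.
  Kf-≅ : ∀ {m n} {G : Graph m} {G₀ : Graph n} → G ≅ D k h → G₀ ≅ D k h →
    ∀ {r r₀} → IsKf G r → IsKf G₀ r₀ → r ≡ r₀
  Kf-≅ {G = G} {G₀} iso iso₀ kf kf₀ = ≤-antisym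
    (Kf-min flat flat-≤ {G = G₀} {G} iso₀ iso kf₀ kf)
    (Kf-min flat flat-≤ {G = G} {G₀} iso iso₀ kf kf₀)

-- The segments are consecutive intervals starting at 0, followed by one infinite segment.
offset : List ℕ → ℕ → ℕ
offset []       s       = 0
offset (l ∷ ls) zero    = 0
offset (l ∷ ls) (suc s) = l ℕ.+ offset ls s

InSegment : List ℕ → ℕ → ℕ → Set
InSegment []       zero    i = ⊤
InSegment []       (suc s) i = ⊥
InSegment (l ∷ ls) zero    i = i < l
InSegment (l ∷ ls) (suc s) i = InSegment ls s i

locate : List ℕ → ℕ → ℕ × ℕ
locate []       x = 0 , x
locate (l ∷ ls) x with x ℕₚ.<? l
... | yes _ = 0 , x
... | no _  = let s , i = locate ls (x ∸ l) in suc s , i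

locate-in : ∀ ls x → InSegment ls (proj₁ (locate ls x)) (proj₂ (locate ls x))
locate-in []       x = tt
locate-in (l ∷ ls) x with x ℕₚ.<? l
... | yes x<l = x<l
... | no _    = locate-in ls (x ∸ l)

offset-locate : ∀ ls x → offset ls (proj₁ (locate ls x)) ℕ.+ proj₂ (locate ls x) ≡ x
offset-locate []       x = refl
offset-locate (l ∷ ls) x with x ℕₚ.<? l
... | yes _  = refl
... | no x≮l = trans (ℕₚ.+-assoc l _ _)
  (trans (cong (l ℕ.+_) (offset-locate ls (x ∸ l))) (ℕₚ.m+[n∸m]≡n (ℕₚ.≮⇒≥ x≮l)))

locate-offset : ∀ ls s i → InSegment ls s i → locate ls (offset ls s ℕ.+ i) ≡ (s , i)
locate-offset []       zero    i _   = refl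
locate-offset (l ∷ ls) zero    i i<l with i ℕₚ.<? l
... | yes _  = refl
... | no i≮l = contradiction i<l i≮l
locate-offset (l ∷ ls) (suc s) i h with (l ℕ.+ offset ls s ℕ.+ i) ℕₚ.<? l
... | yes lt = contradiction (ℕₚ.≤-trans (ℕₚ.m≤m+n l (offset ls s)) (ℕₚ.m≤m+n (l ℕ.+ offset ls s) i))
  (ℕₚ.<⇒≱ lt)
... | no _ = cong (λ p → suc (proj₁ p) , proj₂ p)
  (trans (cong (locate ls) (trans (cong (_∸ l) (ℕₚ.+-assoc l (offset ls s) i)) (ℕₚ.m+n∸m≡n l _)))
    (locate-offset ls s i h))

module Segments (ls : List ℕ) (π : ℕ → ℕ) (π-involutive : ∀ s → π (π s) ≡ s)
  (π-in : ∀ s {i} → InSegment ls s i → InSegment ls (π s) i)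
  (π-end : π (length ls) ≡ length ls) where

  abstract
    f : ℕ → ℕ
    f x = offset ls (π (proj₁ (locate ls x))) ℕ.+ proj₂ (locate ls x)

    f-def : ∀ x → f x ≡ offset ls (π (proj₁ (locate ls x))) ℕ.+ proj₂ (locate ls x)
    f-def x = refl

  f-at : ∀ {x y} s i → InSegment ls s i → x ≡ offset ls s ℕ.+ i →
    offset ls (π s) ℕ.+ i ≡ y → f x ≡ y
  f-at s i h refl refl = trans (f-def (offset ls s ℕ.+ i))
    (cong (λ p → offset ls (π (proj₁ p)) ℕ.+ proj₂ p) (locate-offset ls s i h))

  f-involutive : ∀ x → f (f x) ≡ x
  f-involutive x = f-at (π s) i (π-in s (locate-in ls x)) (f-def x)
    (trans (cong (λ s → offset ls s ℕ.+ i) (π-involutive s)) (offset-locate ls x))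
    where
    s = proj₁ (locate ls x)
    i = proj₂ (locate ls x)

  -- Numbers from `sum ls` on form the infinite segment, fixed by `π-end`; this lets `f` restrict to
  -- the vertices of the chain.
  f-beyond : ∀ {x} → sum ls ≤ x → f x ≡ x
  f-beyond {x} n≤x = f-at (length ls) (x ∸ sum ls) (end-in ls) eq
    (trans (cong (λ s → offset ls s ℕ.+ (x ∸ sum ls)) π-end) (sym eq))
    where
    end-in : ∀ ls {i} → InSegment ls (length ls) i
    end-in []       = tt
    end-in (_ ∷ ls) = end-in ls
    end-offset : ∀ ls → offset ls (length ls) ≡ sum ls
    end-offset []       = refl
    end-offset (l ∷ ls) = cong (l ℕ.+_) (end-offset ls)
    eq : x ≡ offset ls (length ls) ℕ.+ (x ∸ sum ls)
    eq = sym (trans (cong (ℕ._+ (x ∸ sum ls)) (end-offset ls)) (ℕₚ.m+[n∸m]≡n n≤x))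

-- Relabelling edge lists by an involution

module Relabel (f : ℕ → ℕ) (f-involutive : ∀ x → f (f x) ≡ x) where

  Corr : List Edge → List Edge → Set
  Corr E E′ = ∀ u v → mem E u v ≡ mem E′ (f u) (f v)

  f-injective : ∀ {x y} → f x ≡ f y → x ≡ y
  f-injective {x} {y} e = trans (sym (f-involutive x)) (trans (cong f e) (f-involutive y))

  ≡ᵇ-f : ∀ x y → (x ≡ᵇ y) ≡ (f x ≡ᵇ f y)
  ≡ᵇ-f x y with x ℕₚ.≟ y
  ... | yes refl = trans (≡ᵇ-refl x) (sym (≡ᵇ-refl (f x)))
  ... | no x≢y   = trans (≡ᵇ-≢ x≢y) (sym (≡ᵇ-≢ (x≢y ∘ f-injective)))

  fᵉ : Edge → Edge
  fᵉ (a , b) = f a , f b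

  joins-f : ∀ u v e → joins u v e ≡ joins (f u) (f v) (fᵉ e)
  joins-f u v (a , b) = cong₂ _∨_ (cong₂ _∧_ (≡ᵇ-f a u) (≡ᵇ-f b v)) (cong₂ _∧_ (≡ᵇ-f a v) (≡ᵇ-f b u))

  corr-map : ∀ E {E′} → map fᵉ E ≡ E′ → Corr E E′
  corr-map []      refl u v = refl
  corr-map (e ∷ E) refl u v = cong₂ _∨_ (joins-f u v e) (corr-map E refl u v)

  joins-at : ∀ {a b a′ b′} → f a ≡ a′ → f b ≡ b′ → ∀ u v →
    joins u v (a , b) ≡ joins (f u) (f v) (a′ , b′)
  joins-at {a} {b} refl refl u v = joins-f u v (a , b)

  corr-path : ∀ {x y x′ y′ c c′} m → f x ≡ x′ → f y ≡ y′ →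
    (∀ i → i < m → f (c ℕ.+ i) ≡ c′ ℕ.+ i) → Corr (pathEdges x y c m) (pathEdges x′ y′ c′ m)
  corr-path m fx fy fc = corr-map (pathEdges _ _ _ m) (map-path m fx fy fc)
    where
    map-path : ∀ {x y x′ y′ c c′} m → f x ≡ x′ → f y ≡ y′ →
      (∀ i → i < m → f (c ℕ.+ i) ≡ c′ ℕ.+ i) →
      map fᵉ (pathEdges x y c m) ≡ pathEdges x′ y′ c′ m
    map-path zero    refl refl _ = refl
    map-path {c = c} {c′} (suc m) fx fy h = cong₂ _∷_ (cong₂ _,_ fx c₀)
      (map-path m c₀ fy (λ i i<m → trans (cong f (sym (ℕₚ.+-suc c i)))
        (trans (h (suc i) (s≤s i<m)) (ℕₚ.+-suc c′ i))))
      where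
      c₀ : f c ≡ c′
      c₀ = trans (cong f (sym (ℕₚ.+-identityʳ c))) (trans (h 0 (s≤s z≤n)) (ℕₚ.+-identityʳ c′))

  module _ {n : ℕ} (f-beyond : ∀ {x : ℕ} → n ≤ x → f x ≡ x) where

    -- If `f x` were at least `n`, it would be fixed by `f`, and so equal to `x`.
    f-< : ∀ {x} → x < n → f x < n
    f-< {x} x<n with f x ℕₚ.<? n
    ... | yes fx<n = fx<n
    ... | no fx≮n  = contradiction
      (subst (n ≤_) (trans (sym (f-beyond (ℕₚ.≮⇒≥ fx≮n))) (f-involutive x)) (ℕₚ.≮⇒≥ fx≮n))
      (ℕₚ.<⇒≱ x<n)

    fᶠ : Fin n → Fin n
    fᶠ u = fromℕ< (f-< (toℕ<n u))

    toℕ-fᶠ : ∀ u → toℕ (fᶠ u) ≡ f (toℕ u)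
    toℕ-fᶠ u = toℕ-fromℕ< (f-< (toℕ<n u))

    fᶠ-involutive : ∀ u → fᶠ (fᶠ u) ≡ u
    fᶠ-involutive u = toℕ-injective (trans (toℕ-fᶠ (fᶠ u))
      (trans (cong f (toℕ-fᶠ u)) (f-involutive (toℕ u))))

    corr⇒≅ : ∀ {E E′} → Corr E E′ → edgeGraph {n} E ≅ edgeGraph {n} E′
    corr⇒≅ {E} {E′} corr = mk↔ₛ′ fᶠ fᶠ fᶠ-involutive fᶠ-involutive , λ u v →
      trans (corr (toℕ u) (toℕ v)) (sym (cong₂ (mem E′) (toℕ-fᶠ u) (toℕ-fᶠ v)))

-- Exchanging the two sides of the chain

-- Exposes the last edge of a path, which for odd `k` is exchanged with the last rung.
path-snoc : ∀ x y c m u v → mem (pathEdges x y c (suc m)) u v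
  ≡ mem (pathEdges x (c ℕ.+ m) c m) u v ∨ joins u v (c ℕ.+ m , y)
path-snoc x y c zero    u v rewrite ℕₚ.+-identityʳ c =
  l (joins u v (x , c)) (joins u v (c , y))
  where
  l : ∀ p q → p ∨ (q ∨ false) ≡ (p ∨ false) ∨ q
  l = ∨-Solver.solve 2 (λ p q → p ⊕ (q ⊕ ∨-Solver.id) ⊜ (p ⊕ ∨-Solver.id) ⊕ q) refl
path-snoc x y c (suc m) u v = trans (cong (joins u v (x , c) ∨_) (path-snoc c y (suc c) m u v))
  (trans (cong (λ d → joins u v (x , c) ∨ (mem (pathEdges c d (suc c) m) u v ∨ joins u v (d , y)))
      (sym (ℕₚ.+-suc c m)))
    (sym (∨-assoc (joins u v (x , c)) (mem (pathEdges c (c ℕ.+ suc m) (suc c) m) u v)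
      (joins u v (c ℕ.+ suc m , y)))))

module Exchange (h′ K p q : ℕ) where
  h : ℕ
  h = suc (suc h′)
  open Build h K using (B; sV; upRungs) public

  cm cl : ℕ
  cm = B ℕ.+ p ℕ.+ q
  cl = cm ℕ.+ h′ ℕ.* K

  mid : ℕ → ℕ → List Edge
  mid a b = squareEdges h 1 cm (List.replicate h′ (a , b))

  t₁ b₁ tₗ bₗ : List Edge
  t₁ = pathEdges 0 1 B p
  b₁ = pathEdges (sV 0) (sV 1) (B ℕ.+ p) q
  tₗ = pathEdges (suc h′) h cl p
  bₗ = pathEdges (sV (suc h′)) (sV h) (cl ℕ.+ p) q

  -- Adjacency with the outer rungs and end squares set apart, as these are the pieces that move
  -- differently for even and odd `k`. Only `mid` depends on `a` and `b`.
  canon : ℕ → ℕ → ℕ → ℕ → Bool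
  canon a b u v = mem (upRungs 0 (suc h′)) u v ∨ (joins u v (0 , sV 0) ∨ (joins u v (h , sV h)
    ∨ ((mem t₁ u v ∨ mem b₁ u v) ∨ (mem (mid a b) u v ∨ (mem tₗ u v ∨ mem bₗ u v)))))

  upRungs-snoc : ∀ r j u v → mem (upRungs j (suc r)) u v
    ≡ mem (upRungs j r) u v ∨ joins u v (suc (r ℕ.+ j) , sV (suc (r ℕ.+ j)))
  upRungs-snoc zero    j u v = ∨-identityʳ (joins u v (suc j , sV (suc j)))
  upRungs-snoc (suc r) j u v = trans (cong (joins u v (suc j , sV (suc j)) ∨_) (upRungs-snoc r (suc j) u v))
    (trans (cong (λ n → joins u v (suc j , sV (suc j)) ∨ (mem (upRungs (suc j) r) u v ∨ joins u v (suc n , sV (suc n))))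
        (ℕₚ.+-suc r j))
      (sym (∨-assoc (joins u v (suc j , sV (suc j))) (mem (upRungs (suc j) r) u v)
        (joins u v (suc (suc (r ℕ.+ j)) , sV (suc (suc (r ℕ.+ j))))))))

  squares-replicate : ∀ a b r j c ws → squareEdges h j c (List.replicate r (a , b) ++ ws)
    ≡ squareEdges h j c (List.replicate r (a , b)) ++ squareEdges h (r ℕ.+ j) (c ℕ.+ r ℕ.* (a ℕ.+ b)) ws
  squares-replicate a b zero    j c ws = cong (λ c → squareEdges h j c ws) (sym (ℕₚ.+-identityʳ c))
  squares-replicate a b (suc r) j c ws = begin
    X ++ Y ++ squareEdges h (suc j) (c ℕ.+ a ℕ.+ b) (List.replicate r (a , b) ++ ws)
      ≡⟨ cong (λ z → X ++ Y ++ z) (squares-replicate a b r (suc j) (c ℕ.+ a ℕ.+ b) ws) ⟩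
    X ++ Y ++ (Z ++ squareEdges h (r ℕ.+ suc j) (c ℕ.+ a ℕ.+ b ℕ.+ r ℕ.* (a ℕ.+ b)) ws)
      ≡⟨ cong₂ (λ j c → X ++ Y ++ (Z ++ squareEdges h j c ws)) (ℕₚ.+-suc r j) (l c a b (r ℕ.* (a ℕ.+ b))) ⟩
    X ++ Y ++ (Z ++ W)
      ≡⟨ cong (X ++_) (sym (++-assoc Y Z W)) ⟩
    X ++ ((Y ++ Z) ++ W)
      ≡⟨ sym (++-assoc X (Y ++ Z) W) ⟩
    (X ++ Y ++ Z) ++ W ∎
    where
    open ≡-Reasoning
    X = pathEdges j (suc j) c a
    Y = pathEdges (sV j) (sV (suc j)) (c ℕ.+ a) b
    Z = squareEdges h (suc j) (c ℕ.+ a ℕ.+ b) (List.replicate r (a , b))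
    W = squareEdges h (suc (r ℕ.+ j)) (c ℕ.+ (a ℕ.+ b ℕ.+ r ℕ.* (a ℕ.+ b))) ws
    l : ∀ c a b m → c ℕ.+ a ℕ.+ b ℕ.+ m ≡ c ℕ.+ (a ℕ.+ b ℕ.+ m)
    l = solveℕ-∀

  mem-chain : ∀ a b → a ℕ.+ b ≡ K → ∀ u v →
    mem (rungs h ++ squareEdges h 0 B ((p , q) ∷ List.replicate h′ (a , b) ++ (p , q) ∷ [])) u v
      ≡ canon a b u v
  mem-chain a b eq u v = trans (mem-++ (rungs h) (squareEdges h 0 B ws) u v)
    (trans (cong₂ _∨_ rungs-eq squares-eq)
      (l (mem (upRungs 0 (suc h′)) u v) (joins u v (0 , sV 0)) (joins u v (h , sV h)) (mem t₁ u v)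
        (mem b₁ u v) (mem (mid a b) u v) (mem tₗ u v) (mem bₗ u v)))
    where
    ws = (p , q) ∷ List.replicate h′ (a , b) ++ (p , q) ∷ []
    l : ∀ r j₀ jₕ t₁ b₁ m tₗ bₗ → ((r ∨ jₕ) ∨ (j₀ ∨ false)) ∨ (t₁ ∨ (b₁ ∨ (m ∨ (tₗ ∨ (bₗ ∨ false)))))
      ≡ r ∨ (j₀ ∨ (jₕ ∨ ((t₁ ∨ b₁) ∨ (m ∨ (tₗ ∨ bₗ)))))
    l = ∨-Solver.solve 8 (λ r j₀ jₕ t₁ b₁ m tₗ bₗ →
      ((r ⊕ jₕ) ⊕ (j₀ ⊕ ∨-Solver.id)) ⊕ (t₁ ⊕ (b₁ ⊕ (m ⊕ (tₗ ⊕ (bₗ ⊕ ∨-Solver.id)))))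
      ⊜ r ⊕ (j₀ ⊕ (jₕ ⊕ ((t₁ ⊕ b₁) ⊕ (m ⊕ (tₗ ⊕ bₗ)))))) refl
    rungs-eq : mem (rungs h) u v
      ≡ (mem (upRungs 0 (suc h′)) u v ∨ joins u v (h , sV h)) ∨ (joins u v (0 , sV 0) ∨ false)
    rungs-eq = trans (cong (λ es → mem es u v) (rungs≡ (suc h′)))
      (trans (cong (λ n → mem (rungsFrom h (suc n)) u v) (sym (ℕₚ.+-identityʳ h)))
        (trans (mem-rungsFrom h K h 0 u v)
          (cong (_∨ mem (rungsFrom h 1) u v) (trans (upRungs-snoc (suc h′) 0 u v)
            (cong (λ n → mem (upRungs 0 (suc h′)) u v ∨ joins u v (suc (suc n) , sV (suc (suc n))))
              (ℕₚ.+-identityʳ h′))))))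
    squares-eq : mem (squareEdges h 0 B ws) u v
      ≡ mem t₁ u v ∨ (mem b₁ u v ∨ (mem (mid a b) u v ∨ (mem tₗ u v ∨ (mem bₗ u v ∨ false))))
    squares-eq = trans (mem-++ t₁ _ u v) (cong (mem t₁ u v ∨_) (trans (mem-++ b₁ _ u v)
      (cong (mem b₁ u v ∨_) (trans
        (cong (λ es → mem es u v) (trans (squares-replicate a b h′ 1 cm ((p , q) ∷ []))
          (cong₂ (λ j c → mid a b ++ squareEdges h j c ((p , q) ∷ [])) (ℕₚ.+-comm h′ 1)
            (cong (λ K → cm ℕ.+ h′ ℕ.* K) eq))))
        (trans (mem-++ (mid a b) _ u v) (cong (mem (mid a b) u v ∨_)
          (trans (mem-++ tₗ _ u v) (cong (mem tₗ u v ∨_) (mem-++ bₗ [] u v)))))))))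

  module _ (f : ℕ → ℕ) (f-involutive : ∀ x → f (f x) ≡ x) where
    open Relabel f f-involutive

    corr-upRungs : ∀ r j → (∀ i → i < r → f (suc j ℕ.+ i) ≡ sV (suc j ℕ.+ i)) →
      Corr (upRungs j r) (upRungs j r)
    corr-upRungs zero    j _ u v = refl
    corr-upRungs (suc r) j ft u v = cong₂ _∨_
      (trans (joins-at fj fs u v)
        (joins-flip (f u) (f v) (sV (suc j)) (suc j)))
      (corr-upRungs r (suc j)
        (λ i i<r → subst (λ n → f n ≡ sV n) (cong suc (ℕₚ.+-suc j i)) (ft (suc i) (s≤s i<r))) u v)
      where
      fj : f (suc j) ≡ sV (suc j)
      fj = subst (λ n → f n ≡ sV n) (cong suc (ℕₚ.+-identityʳ j)) (ft 0 (s≤s z≤n))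
      fs : f (sV (suc j)) ≡ suc j
      fs = trans (cong f (sym fj)) (f-involutive (suc j))

    -- An inner square uses the same `K` numbers whichever side they subdivide, so these are fixed
    -- while the two sides trade places.
    corr-mid : ∀ r j c → (∀ i → i ≤ r → f (j ℕ.+ i) ≡ sV (j ℕ.+ i)) →
      (∀ i → i < r ℕ.* K → f (c ℕ.+ i) ≡ c ℕ.+ i) →
      Corr (squareEdges h j c (List.replicate r (K , 0))) (squareEdges h j c (List.replicate r (0 , K)))
    corr-mid zero    j c _  _  u v = refl
    corr-mid (suc r) j c ft fc u v = trans
      (trans (mem-++ (pathEdges j (suc j) c K) _ u v)
        (cong (λ d → mem (pathEdges j (suc j) c K) u v ∨ (joins u v (sV j , sV (suc j))
          ∨ mem (squareEdges h (suc j) d (List.replicate r (K , 0))) u v)) (ℕₚ.+-identityʳ (c ℕ.+ K))))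
      (trans (cong₂ _∨_ (corr-path K fj fj′ (λ i i<K → fc i (ℕₚ.<-≤-trans i<K (ℕₚ.m≤m+n K (r ℕ.* K)))) u v)
          (cong₂ _∨_ (joins-at fs fs′ u v)
            (corr-mid r (suc j) (c ℕ.+ K)
              (λ i i≤r → subst (λ n → f n ≡ sV n) (ℕₚ.+-suc j i) (ft (suc i) (s≤s i≤r)))
              (λ i i< → subst (λ n → f n ≡ n) (sym (ℕₚ.+-assoc c K i)) (fc (K ℕ.+ i) (ℕₚ.+-monoʳ-< K i<)))
              u v)))
        (trans (l (mem (pathEdges (sV j) (sV (suc j)) c K) (f u) (f v)) (joins (f u) (f v) (j , suc j)) _)
          (cong (joins (f u) (f v) (j , suc j) ∨_)
            (trans (cong (λ d → mem (pathEdges (sV j) (sV (suc j)) d K) (f u) (f v)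
                ∨ mem (squareEdges h (suc j) (d ℕ.+ K) (List.replicate r (0 , K))) (f u) (f v))
                (sym (ℕₚ.+-identityʳ c)))
              (sym (mem-++ (pathEdges (sV j) (sV (suc j)) (c ℕ.+ 0) K) _ (f u) (f v)))))))
      where
      l : ∀ p q r → p ∨ (q ∨ r) ≡ q ∨ (p ∨ r)
      l = ∨-Solver.solve 3 (λ p q r → p ⊕ (q ⊕ r) ⊜ q ⊕ (p ⊕ r)) refl
      fj : f j ≡ sV j
      fj = subst (λ n → f n ≡ sV n) (ℕₚ.+-identityʳ j) (ft 0 z≤n)
      fj′ : f (suc j) ≡ sV (suc j)
      fj′ = subst (λ n → f n ≡ sV n) (ℕₚ.+-comm j 1) (ft 1 (s≤s z≤n))
      fs : f (sV j) ≡ j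
      fs = trans (cong f (sym fj)) (f-involutive j)
      fs′ : f (sV (suc j)) ≡ suc j
      fs′ = trans (cong f (sym fj′)) (f-involutive (suc j))

-- For k even, t_j and s_j are exchanged for all j; the paths of the end squares have equal length.
module Even (h′ q : ℕ) where
  K : ℕ
  K = q ℕ.+ q
  open Exchange h′ K q q

  -- Segments: the t_j; the s_j; top and bottom of the first square; the inner squares; top and
  -- bottom of the last square.
  ls : List ℕ
  ls = suc h ∷ suc h ∷ q ∷ q ∷ h′ ℕ.* K ∷ q ∷ q ∷ []

  π : ℕ → ℕ
  π 0 = 1
  π 1 = 0
  π 2 = 3
  π 3 = 2
  π 5 = 6
  π 6 = 5
  π s = s

  π-involutive : ∀ s → π (π s) ≡ s
  π-involutive 0 = refl
  π-involutive 1 = refl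
  π-involutive 2 = refl
  π-involutive 3 = refl
  π-involutive 4 = refl
  π-involutive 5 = refl
  π-involutive 6 = refl
  π-involutive (suc (suc (suc (suc (suc (suc (suc _))))))) = refl

  π-in : ∀ s {i} → InSegment ls s i → InSegment ls (π s) i
  π-in 0 p = p
  π-in 1 p = p
  π-in 2 p = p
  π-in 3 p = p
  π-in 4 p = p
  π-in 5 p = p
  π-in 6 p = p
  π-in (suc (suc (suc (suc (suc (suc (suc _))))))) p = p

  open Segments ls π π-involutive π-in refl
  open Relabel f f-involutive

  f-t : ∀ i → i ≤ h → f i ≡ sV i
  f-t i i≤h = f-at 0 i (s≤s i≤h) refl (l h i)
    where
    l : ∀ h i → suc h ℕ.+ 0 ℕ.+ i ≡ h ℕ.+ 1 ℕ.+ i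
    l = solveℕ-∀

  f-s : ∀ i → i ≤ h → f (sV i) ≡ i
  f-s i i≤h = trans (cong f (sym (f-t i i≤h))) (f-involutive i)

  f-x : ∀ i → i < q → f (B ℕ.+ i) ≡ B ℕ.+ q ℕ.+ i
  f-x i i<q = f-at 2 i i<q (l h i) (l′ h q i)
    where
    l : ∀ h i → 2 ℕ.* h ℕ.+ 2 ℕ.+ i ≡ suc h ℕ.+ (suc h ℕ.+ 0) ℕ.+ i
    l = solveℕ-∀
    l′ : ∀ h q i → suc h ℕ.+ (suc h ℕ.+ (q ℕ.+ 0)) ℕ.+ i ≡ 2 ℕ.* h ℕ.+ 2 ℕ.+ q ℕ.+ i
    l′ = solveℕ-∀

  f-y : ∀ i → i < q → f (B ℕ.+ q ℕ.+ i) ≡ B ℕ.+ i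
  f-y i i<q = trans (cong f (sym (f-x i i<q))) (f-involutive (B ℕ.+ i))

  f-m : ∀ i → i < h′ ℕ.* K → f (cm ℕ.+ i) ≡ cm ℕ.+ i
  f-m i i< = f-at 4 i i< (l h q i) (sym (l h q i))
    where
    l : ∀ h q i → 2 ℕ.* h ℕ.+ 2 ℕ.+ q ℕ.+ q ℕ.+ i
      ≡ suc h ℕ.+ (suc h ℕ.+ (q ℕ.+ (q ℕ.+ 0))) ℕ.+ i
    l = solveℕ-∀

  f-xₗ : ∀ i → i < q → f (cl ℕ.+ i) ≡ cl ℕ.+ q ℕ.+ i
  f-xₗ i i<q = f-at 5 i i<q (l h q (h′ ℕ.* K) i) (l′ h q (h′ ℕ.* K) i)
    where
    l : ∀ h q m i → 2 ℕ.* h ℕ.+ 2 ℕ.+ q ℕ.+ q ℕ.+ m ℕ.+ i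
      ≡ suc h ℕ.+ (suc h ℕ.+ (q ℕ.+ (q ℕ.+ (m ℕ.+ 0)))) ℕ.+ i
    l = solveℕ-∀
    l′ : ∀ h q m i → suc h ℕ.+ (suc h ℕ.+ (q ℕ.+ (q ℕ.+ (m ℕ.+ (q ℕ.+ 0))))) ℕ.+ i
      ≡ 2 ℕ.* h ℕ.+ 2 ℕ.+ q ℕ.+ q ℕ.+ m ℕ.+ q ℕ.+ i
    l′ = solveℕ-∀

  f-yₗ : ∀ i → i < q → f (cl ℕ.+ q ℕ.+ i) ≡ cl ℕ.+ i
  f-yₗ i i<q = trans (cong f (sym (f-xₗ i i<q))) (f-involutive (cl ℕ.+ i))

  numV≡sum : numV (suc (suc (suc (suc K)))) h ≡ sum ls
  numV≡sum = l h′ q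
    where
    l : ∀ h′ q → suc (suc h′) ℕ.* suc (suc (q ℕ.+ q)) ℕ.+ 2
      ≡ suc (suc (suc h′)) ℕ.+ (suc (suc (suc h′)) ℕ.+ (q ℕ.+ (q ℕ.+ (h′ ℕ.* (q ℕ.+ q) ℕ.+ (q ℕ.+ (q ℕ.+ 0))))))
    l = solveℕ-∀

  corr-canon : ∀ u v → canon K 0 u v ≡ canon 0 K (f u) (f v)
  corr-canon u v = cong₂ _∨_
    (corr-upRungs f f-involutive (suc h′) 0 (λ i i< → f-t (suc i) (s≤s (ℕₚ.<⇒≤ i<))) u v)
    (cong₂ _∨_
      (trans (joins-at (f-t 0 z≤n) (f-s 0 z≤n) u v) (joins-flip (f u) (f v) (sV 0) 0))
      (cong₂ _∨_
        (trans (joins-at (f-t h ℕₚ.≤-refl) (f-s h ℕₚ.≤-refl) u v) (joins-flip (f u) (f v) (sV h) h))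
        (cong₂ _∨_
          (trans (cong₂ _∨_
              (corr-path q (f-t 0 z≤n) (f-t 1 (s≤s z≤n)) f-x u v)
              (corr-path q (f-s 0 z≤n) (f-s 1 (s≤s z≤n)) f-y u v))
            (∨-comm (mem b₁ (f u) (f v)) (mem t₁ (f u) (f v))))
          (cong₂ _∨_
            (corr-mid f f-involutive h′ 1 cm (λ i i≤h′ → f-t (1 ℕ.+ i) (s≤s (ℕₚ.m≤n⇒m≤1+n i≤h′))) f-m u v)
            (trans (cong₂ _∨_
                (corr-path q (f-t (suc h′) (ℕₚ.n≤1+n (suc h′))) (f-t h ℕₚ.≤-refl) f-xₗ u v)
                (corr-path q (f-s (suc h′) (ℕₚ.n≤1+n (suc h′))) (f-s h ℕₚ.≤-refl) f-yₗ u v))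
              (∨-comm (mem bₗ (f u) (f v)) (mem tₗ (f u) (f v))))))))

-- For k odd, the first square is reflected in the axis through t_0, exchanging t_1 and s_1,
-- and the last square in the axis through t_h; the other t_j and s_j are exchanged as before.
module Odd (h′ q : ℕ) where
  K : ℕ
  K = suc (q ℕ.+ q)
  open Exchange h′ K (suc q) q

  -- Segments 0 to 5 are t_0, the inner t_j, t_h, s_0, the inner s_j, s_h. In the first square, 6 is
  -- the top vertex next to t_0, 7 the other top vertices, 8 the bottom ones; 9 is the inner
  -- squares. In the last square, 11 is the top vertex next to t_h, 10 the other top vertices, 12
  -- the bottom ones.
  ls : List ℕ
  ls = 1 ∷ suc h′ ∷ 1 ∷ 1 ∷ suc h′ ∷ 1 ∷ 1 ∷ q ∷ q ∷ h′ ℕ.* K ∷ q ∷ 1 ∷ q ∷ []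

  π : ℕ → ℕ
  π 1  = 4
  π 4  = 1
  π 3  = 6
  π 6  = 3
  π 5  = 11
  π 11 = 5
  π 7  = 8
  π 8  = 7
  π 10 = 12
  π 12 = 10
  π s  = s

  π-involutive : ∀ s → π (π s) ≡ s
  π-involutive 0  = refl
  π-involutive 1  = refl
  π-involutive 2  = refl
  π-involutive 3  = refl
  π-involutive 4  = refl
  π-involutive 5  = refl
  π-involutive 6  = refl
  π-involutive 7  = refl
  π-involutive 8  = refl
  π-involutive 9  = refl
  π-involutive 10 = refl
  π-involutive 11 = refl
  π-involutive 12 = refl
  π-involutive (suc (suc (suc (suc (suc (suc (suc (suc (suc (suc (suc (suc (suc _))))))))))))) = refl

  π-in : ∀ s {i} → InSegment ls s i → InSegment ls (π s) i
  π-in 0  p = p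
  π-in 1  p = p
  π-in 2  p = p
  π-in 3  p = p
  π-in 4  p = p
  π-in 5  p = p
  π-in 6  p = p
  π-in 7  p = p
  π-in 8  p = p
  π-in 9  p = p
  π-in 10 p = p
  π-in 11 p = p
  π-in 12 p = p
  π-in (suc (suc (suc (suc (suc (suc (suc (suc (suc (suc (suc (suc (suc _))))))))))))) p = p

  open Segments ls π π-involutive π-in refl
  open Relabel f f-involutive

  f-t₀ : f 0 ≡ 0
  f-t₀ = f-at 0 0 (s≤s z≤n) refl refl

  f-t : ∀ i → i ≤ h′ → f (suc i) ≡ sV (suc i)
  f-t i i≤h′ = f-at 1 i (s≤s i≤h′) refl (l h′ i)
    where
    l : ∀ h i → 1 ℕ.+ (suc h ℕ.+ (1 ℕ.+ (1 ℕ.+ 0))) ℕ.+ i ≡ suc (suc h) ℕ.+ 1 ℕ.+ suc i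
    l = solveℕ-∀

  f-s : ∀ i → i ≤ h′ → f (sV (suc i)) ≡ suc i
  f-s i i≤h′ = trans (cong f (sym (f-t i i≤h′))) (f-involutive (suc i))

  f-tₕ : f h ≡ h
  f-tₕ = f-at 2 0 (s≤s z≤n) (l h′) (sym (l h′))
    where
    l : ∀ h → suc (suc h) ≡ 1 ℕ.+ (suc h ℕ.+ 0) ℕ.+ 0
    l = solveℕ-∀

  f-s₀ : f (sV 0) ≡ B
  f-s₀ = f-at 3 0 (s≤s z≤n) (l h′) (l′ h′)
    where
    l : ∀ h → suc (suc h) ℕ.+ 1 ℕ.+ 0 ≡ 1 ℕ.+ (suc h ℕ.+ (1 ℕ.+ 0)) ℕ.+ 0
    l = solveℕ-∀
    l′ : ∀ h → 1 ℕ.+ (suc h ℕ.+ (1 ℕ.+ (1 ℕ.+ (suc h ℕ.+ (1 ℕ.+ 0))))) ℕ.+ 0 ≡ 2 ℕ.* suc (suc h) ℕ.+ 2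
    l′ = solveℕ-∀

  f-x₀ : f B ≡ sV 0
  f-x₀ = trans (cong f (sym f-s₀)) (f-involutive (sV 0))

  f-x : ∀ i → i < q → f (suc B ℕ.+ i) ≡ B ℕ.+ suc q ℕ.+ i
  f-x i i<q = f-at 7 i i<q (l h′ i) (l′ h′ q i)
    where
    l : ∀ h i → suc (2 ℕ.* suc (suc h) ℕ.+ 2) ℕ.+ i
      ≡ 1 ℕ.+ (suc h ℕ.+ (1 ℕ.+ (1 ℕ.+ (suc h ℕ.+ (1 ℕ.+ (1 ℕ.+ 0)))))) ℕ.+ i
    l = solveℕ-∀
    l′ : ∀ h q i → 1 ℕ.+ (suc h ℕ.+ (1 ℕ.+ (1 ℕ.+ (suc h ℕ.+ (1 ℕ.+ (1 ℕ.+ (q ℕ.+ 0))))))) ℕ.+ i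
      ≡ 2 ℕ.* suc (suc h) ℕ.+ 2 ℕ.+ suc q ℕ.+ i
    l′ = solveℕ-∀

  f-y : ∀ i → i < q → f (B ℕ.+ suc q ℕ.+ i) ≡ suc B ℕ.+ i
  f-y i i<q = trans (cong f (sym (f-x i i<q))) (f-involutive (suc B ℕ.+ i))

  f-m : ∀ i → i < h′ ℕ.* K → f (cm ℕ.+ i) ≡ cm ℕ.+ i
  f-m i i< = f-at 9 i i< (l h′ q i) (sym (l h′ q i))
    where
    l : ∀ h q i → 2 ℕ.* suc (suc h) ℕ.+ 2 ℕ.+ suc q ℕ.+ q ℕ.+ i
      ≡ 1 ℕ.+ (suc h ℕ.+ (1 ℕ.+ (1 ℕ.+ (suc h ℕ.+ (1 ℕ.+ (1 ℕ.+ (q ℕ.+ (q ℕ.+ 0)))))))) ℕ.+ i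
    l = solveℕ-∀

  f-xₗ : ∀ i → i < q → f (cl ℕ.+ i) ≡ cl ℕ.+ suc q ℕ.+ i
  f-xₗ i i<q = f-at 10 i i<q (l h′ q (h′ ℕ.* K) i) (l′ h′ q (h′ ℕ.* K) i)
    where
    l : ∀ h q m i → 2 ℕ.* suc (suc h) ℕ.+ 2 ℕ.+ suc q ℕ.+ q ℕ.+ m ℕ.+ i
      ≡ 1 ℕ.+ (suc h ℕ.+ (1 ℕ.+ (1 ℕ.+ (suc h ℕ.+ (1 ℕ.+ (1 ℕ.+ (q ℕ.+ (q ℕ.+ (m ℕ.+ 0))))))))) ℕ.+ i
    l = solveℕ-∀
    l′ : ∀ h q m i → 1 ℕ.+ (suc h ℕ.+ (1 ℕ.+ (1 ℕ.+ (suc h ℕ.+ (1 ℕ.+ (1 ℕ.+ (q ℕ.+ (q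
        ℕ.+ (m ℕ.+ (q ℕ.+ (1 ℕ.+ 0))))))))))) ℕ.+ i
      ≡ 2 ℕ.* suc (suc h) ℕ.+ 2 ℕ.+ suc q ℕ.+ q ℕ.+ m ℕ.+ suc q ℕ.+ i
    l′ = solveℕ-∀

  f-yₗ : ∀ i → i < q → f (cl ℕ.+ suc q ℕ.+ i) ≡ cl ℕ.+ i
  f-yₗ i i<q = trans (cong f (sym (f-xₗ i i<q))) (f-involutive (cl ℕ.+ i))

  f-sₕ : f (sV h) ≡ cl ℕ.+ q
  f-sₕ = f-at 5 0 (s≤s z≤n) (l h′) (l′ h′ q (h′ ℕ.* K))
    where
    l : ∀ h → suc (suc h) ℕ.+ 1 ℕ.+ suc (suc h) ≡ 1 ℕ.+ (suc h ℕ.+ (1 ℕ.+ (1 ℕ.+ (suc h ℕ.+ 0)))) ℕ.+ 0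
    l = solveℕ-∀
    l′ : ∀ h q m → 1 ℕ.+ (suc h ℕ.+ (1 ℕ.+ (1 ℕ.+ (suc h ℕ.+ (1 ℕ.+ (1 ℕ.+ (q ℕ.+ (q
        ℕ.+ (m ℕ.+ (q ℕ.+ 0)))))))))) ℕ.+ 0
      ≡ 2 ℕ.* suc (suc h) ℕ.+ 2 ℕ.+ suc q ℕ.+ q ℕ.+ m ℕ.+ q
    l′ = solveℕ-∀

  f-xₕ : f (cl ℕ.+ q) ≡ sV h
  f-xₕ = trans (cong f (sym f-sₕ)) (f-involutive (sV h))

  numV≡sum : numV (suc (suc (suc (suc K)))) h ≡ sum ls
  numV≡sum = l h′ q
    where
    l : ∀ h q → suc (suc h) ℕ.* suc (suc (suc (q ℕ.+ q))) ℕ.+ 2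
      ≡ 1 ℕ.+ (suc h ℕ.+ (1 ℕ.+ (1 ℕ.+ (suc h ℕ.+ (1 ℕ.+ (1 ℕ.+ (q ℕ.+ (q
        ℕ.+ (h ℕ.* suc (q ℕ.+ q) ℕ.+ (q ℕ.+ (1 ℕ.+ (q ℕ.+ 0))))))))))))
    l = solveℕ-∀

  -- The outer rungs are not preserved: the rung at t_0 is exchanged with the first edge of `t₁`,
  -- the rung at t_h with the last edge of `tₗ`. The identity `l` puts the image edges back in
  -- order.
  corr-canon : ∀ u v → canon K 0 u v ≡ canon 0 K (f u) (f v)
  corr-canon u v = trans
    (cong₂ _∨_ (corr-upRungs f f-involutive (suc h′) 0 (λ { i (s≤s i≤h′) → f-t i i≤h′ }) u v)
      (cong₂ _∨_ (joins-at f-t₀ f-s₀ u v)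
        (cong₂ _∨_ (joins-at f-tₕ f-sₕ u v)
          (cong₂ _∨_
            (cong₂ _∨_
              (cong₂ _∨_ (joins-at f-t₀ f-x₀ u v) (corr-path q f-x₀ (f-t 0 z≤n) f-x u v))
              (corr-path q f-s₀ (f-s 0 z≤n) f-y u v))
            (cong₂ _∨_
              (corr-mid f f-involutive h′ 1 cm f-t f-m u v)
              (cong₂ _∨_
                (trans (path-snoc (suc h′) h cl q u v) (cong₂ _∨_
                  (corr-path q (f-t h′ ℕₚ.≤-refl) f-xₕ f-xₗ u v) (joins-at f-xₕ f-tₕ u v)))
                (corr-path q (f-s h′ ℕₚ.≤-refl) f-sₕ f-yₗ u v)))))))
    (trans (l (mem (upRungs 0 (suc h′)) (f u) (f v)) (jn 0 B) (jn h (cl ℕ.+ q)) (jn 0 (sV 0)) (mem b₁ (f u) (f v))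
        (mem (pathEdges B 1 (suc B) q) (f u) (f v)) (mem (mid 0 K) (f u) (f v)) (mem bₗ (f u) (f v))
        (jn (sV h) h) (mem (pathEdges (suc h′) (cl ℕ.+ q) cl q) (f u) (f v)))
      (cong₂ (λ j t → mem (upRungs 0 (suc h′)) (f u) (f v) ∨ (jn 0 (sV 0) ∨ (j
          ∨ ((mem t₁ (f u) (f v) ∨ mem b₁ (f u) (f v)) ∨ (mem (mid 0 K) (f u) (f v) ∨ (t ∨ mem bₗ (f u) (f v)))))))
        (joins-flip (f u) (f v) (sV h) h)
        (trans (cong (mem (pathEdges (suc h′) (cl ℕ.+ q) cl q) (f u) (f v) ∨_)
            (joins-flip (f u) (f v) h (cl ℕ.+ q)))
          (sym (path-snoc (suc h′) h cl q (f u) (f v))))))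
    where
    jn : ℕ → ℕ → Bool
    jn a b = joins (f u) (f v) (a , b)
    l : ∀ r x₀ xₕ j₀ b₁ π₁ m bₗ jₕ πₗ →
      r ∨ (x₀ ∨ (xₕ ∨ (((j₀ ∨ b₁) ∨ π₁) ∨ (m ∨ ((bₗ ∨ jₕ) ∨ πₗ)))))
      ≡ r ∨ (j₀ ∨ (jₕ ∨ (((x₀ ∨ π₁) ∨ b₁) ∨ (m ∨ ((πₗ ∨ xₕ) ∨ bₗ)))))
    l = ∨-Solver.solve 10 (λ r x₀ xₕ j₀ b₁ π₁ m bₗ jₕ πₗ →
      r ⊕ (x₀ ⊕ (xₕ ⊕ (((j₀ ⊕ b₁) ⊕ π₁) ⊕ (m ⊕ ((bₗ ⊕ jₕ) ⊕ πₗ)))))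
      ⊜ r ⊕ (j₀ ⊕ (jₕ ⊕ (((x₀ ⊕ π₁) ⊕ b₁) ⊕ (m ⊕ ((πₗ ⊕ xₕ) ⊕ bₗ)))))) refl

-- Isomorphism of the two extremal chains and the characterisation of equality

≅-refl : ∀ {n} (G : Graph n) → G ≅ G
≅-refl G = ↔-id _ , λ u v → refl

≅-trans : ∀ {l m n} (G : Graph l) (H : Graph m) (J : Graph n) → G ≅ H → H ≅ J → G ≅ J
≅-trans G H J (π , p) (ρ , q) = ρ ↔-∘ π , λ u v → trans (p u v) (q (Inverse.to π u) (Inverse.to π v))

halves : ∀ n → ⌈ n /2⌉ ≡ ⌊ n /2⌋ ⊎ ⌈ n /2⌉ ≡ suc ⌊ n /2⌋
halves 0             = inj₁ refl
halves 1             = inj₂ refl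
halves (suc (suc n)) = Sum.map (cong suc) (cong suc) (halves n)

chainList : ∀ h′ → ℕ × ℕ → ℕ × ℕ → List (ℕ × ℕ)
chainList h′ e w = rungs h ++ squareEdges h 0 (2 ℕ.* h ℕ.+ 2) (e ∷ List.replicate h′ w ++ e ∷ [])
  where
  h : ℕ
  h = suc (suc h′)

Exchangeable : ℕ → ℕ → ℕ → ℕ → Set
Exchangeable h′ K p q = edgeGraph {n} (chainList h′ (p , q) (K , 0))
  ≅ edgeGraph {n} (chainList h′ (p , q) (0 , K))
  where
  n : ℕ
  n = numV (suc (suc (suc (suc K)))) (suc (suc h′))

exchange-even : ∀ h′ q → Exchangeable h′ (q ℕ.+ q) q q
exchange-even h′ q = corr⇒≅ {n} (λ {x} n≤x → f-beyond (subst (_≤ x) numV≡sum n≤x))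
  {chainList h′ (q , q) (K , 0)} {chainList h′ (q , q) (0 , K)}
  (λ u v → trans (mem-chain K 0 (ℕₚ.+-identityʳ K) u v)
    (trans (corr-canon u v) (sym (mem-chain 0 K refl (f u) (f v)))))
  where
  open Even h′ q
  open Exchange h′ K q q
  open Segments ls π π-involutive π-in refl
  open Relabel f f-involutive
  n : ℕ
  n = numV (suc (suc (suc (suc K)))) h

exchange-odd : ∀ h′ q → Exchangeable h′ (suc (q ℕ.+ q)) (suc q) q
exchange-odd h′ q = corr⇒≅ {n} (λ {x} n≤x → f-beyond (subst (_≤ x) numV≡sum n≤x))
  {chainList h′ (suc q , q) (K , 0)} {chainList h′ (suc q , q) (0 , K)}
  (λ u v → trans (mem-chain K 0 (ℕₚ.+-identityʳ K) u v)
    (trans (corr-canon u v) (sym (mem-chain 0 K refl (f u) (f v)))))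
  where
  open Odd h′ q
  open Exchange h′ K (suc q) q
  open Segments ls π π-involutive π-in refl
  open Relabel f f-involutive
  n : ℕ
  n = numV (suc (suc (suc (suc K)))) h

mids-replicate : ∀ n K a → mids K (replicate n a) ≡ List.replicate n (a , K ∸ a)
mids-replicate zero    K a = refl
mids-replicate (suc n) K a = cong ((a , K ∸ a) ∷_) (mids-replicate n K a)

exchange : ∀ h′ p q → p ≡ q ⊎ p ≡ suc q → Exchangeable h′ (p ℕ.+ q) p q
exchange h′ p q (inj₁ refl) = exchange-even h′ q
exchange h′ p q (inj₂ refl) = exchange-odd h′ q

full≅flat : ∀ h′ K → let k = suc (suc (suc (suc K))) in
  P k (suc (suc h′)) (replicate h′ K) ≅ D k (suc (suc h′))
full≅flat h′ K = subst₂ (λ xs ys → chain xs ≅ chain ys)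
  (sym (trans (mids-replicate h′ K K) (cong (λ b → List.replicate h′ (K , b)) (ℕₚ.n∸n≡0 K))))
  (sym (mids-replicate h′ K 0))
  (subst (λ K′ → Exchangeable h′ K′ ⌈ K /2⌉ ⌊ K /2⌋)
    (trans (ℕₚ.+-comm ⌈ K /2⌉ ⌊ K /2⌋) (ℕₚ.⌊n/2⌋+⌈n/2⌉≡n K))
    (exchange h′ ⌈ K /2⌉ ⌊ K /2⌋ (halves K)))
  where
  h : ℕ
  h = suc (suc h′)
  chain : List (ℕ × ℕ) → Graph (numV (suc (suc (suc (suc K)))) h)
  chain ws = edgeGraph (rungs h ++ squareEdges h 0 (2 ℕ.* h ℕ.+ 2)
    ((⌈ K /2⌉ , ⌊ K /2⌋) ∷ ws ++ (⌈ K /2⌉ , ⌊ K /2⌋) ∷ []))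

module _ (K′ h′ : ℕ) where
  open Chain K′ h′

  D-refl : D k h ≅ D k h
  D-refl = ≅-refl (D k h)

  equal-Kf⇒≅ : (w : Vec ℕ h′) → All (_≤ K) w → ∀ {n} (G : Graph n) → G ≅ P k h w →
    ∀ {r r₀} → IsKf G r → IsKf (D k h) r₀ → r ≡ r₀ → G ≅ D k h
  equal-Kf⇒≅ w w≤ G iso {r} {r₀} kf kf₀ r≡r₀ =
    conclude (Kf-unique w w≤ {G = G} {D k h} iso D-refl {r} {r₀} kf kf₀ r≡r₀)
    where
    conclude : w ≡ replicate h′ 0 ⊎ w ≡ replicate h′ K → G ≅ D k h
    conclude (inj₁ eq) = subst (λ w → G ≅ P k h w) eq iso
    conclude (inj₂ eq) = ≅-trans G (P k h (replicate h′ K)) (D k h)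
      (subst (λ w → G ≅ P k h w) eq iso) (full≅flat h′ K)

  Kf-extremal : (w : Vec ℕ h′) → All (_≤ K) w → ∀ {n} (G : Graph n) → G ≅ P k h w →
    (r r₀ : ℚ) → IsKf G r → IsKf (D k h) r₀ → (r₀ ≤ℚ r) × ((r ≡ r₀) ⇔ (G ≅ D k h))
  Kf-extremal w w≤ G iso r r₀ kf kf₀ = Kf-min w w≤ {G = G} {D k h} iso D-refl {r} {r₀} kf kf₀ ,
    mk⇔ (equal-Kf⇒≅ w w≤ G iso {r} {r₀} kf kf₀)
        (λ iso₀ → Kf-≅ {G = G} {D k h} iso₀ D-refl {r} {r₀} kf kf₀)

theorem1p1 : (k h : ℕ) → 5 ≤ k → 2 ≤ h →
    (w : Vec ℕ (h ∸ 2)) → All (λ a → a ≤ k ∸ 4) w →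
    ∀ {n} (G : Graph n) → G ≅ P k h w →
    (r r₀ : ℚ) → IsKf G r → IsKf (D k h) r₀ →
    (r₀ ≤ℚ r) × ((r ≡ r₀) ⇔ (G ≅ D k h))
theorem1p1 _ _ (s≤s (s≤s (s≤s (s≤s (s≤s (z≤n {K′})))))) (s≤s (s≤s (z≤n {h′}))) = Kf-extremal K′ h′
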